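{- Let $q$ be a prime power and $m\ge 1$ a natural number. Then there is an isomorphism of monoids $$T_q^m\;\cong\;\prod_{k\mid m}\left(M_{[\pi(k)]}\ltimes_\Gamma C_k^{\pi(k)}\right),$$ where the (direct) product runs over all positive divisors $k$ of $m$.
   Context: A map $f:\mathbb{F}_{q^m}\to\mathbb{F}_{q^m}$ is called subfield preserving if $f(\mathbb{F}_q)\subseteq\mathbb{F}_q$ and, for all positive divisors $d,s$ of $m$, $f(\mathbb{F}_{q^d}\setminus\mathbb{F}_{q^s})\subseteq\mathbb{F}_{q^d}\setminus\mathbb{F}_{q^s}$. $T_q^m$ denotes the set of subfield preserving maps $f:\mathbb{F}_{q^m}\to\mathbb{F}_{q^m}$ whose polynomial representation (the unique polynomial of degree less than $q^m$ inducing $f$) has coefficients in $\mathbb{F}_q$; it is a monoid under composition. $\pi(k)$ is the number of monic irreducible polynomials of degree $k$ over $\mathbb{F}_q$, i.e. $\pi(k)=\frac1k\sum_{j\mid k}\mu(k/j)q^j$ with $\mu$ the Möbius function. For a natural number $n$, $[n]=\{1,\dots,n\}$ and $M_{[n]}$ is the monoid (under composition) of all maps $[n]\to[n]$. $C_k$ is the cyclic group of order $k$. Semidirect product of monoids: given monoids $M,N$ and an antihomomorphism of monoids $\Gamma:M\to\operatorname{End}(N)$, $m\mapsto\Gamma_m$ (so $\Gamma_{m_1m_2}=\Gamma_{m_2}\circ\Gamma_{m_1}$), $M\ltimes_\Gamma N$ is the monoid with underlying set $M\times N$ and operation $(m_1,n_1)*(m_2,n_2)=(m_1m_2,\Gamma_{m_2}(n_1)\,n_2)$.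 Here $\Gamma:M_{[n]}\to\operatorname{End}(C_k^n)$ is given by $\Gamma_\sigma(\gamma_1,\dots,\gamma_n)=(\gamma_{\sigma(1)},\dots,\gamma_{\sigma(n)})$, with $n=\pi(k)$. -}

module Defs where

open import Level using (0ℓ)
open import Algebra.Bundles using (Monoid; CommutativeMonoid; CommutativeRing; AbelianGroup; Semiring; RawSemiring)
open import Algebra.Morphism.Structures using (module MonoidMorphisms; module RingMorphisms)
open import Algebra.Structures using (IsCommutativeRing)
import Algebra.Construct.Pointwise as Pointwise
import Algebra.Definitions.RawSemiring as RawSemiringDefinitions
import Algebra.Properties.CommutativeMonoid.Sum as Sum
import Algebra.Properties.CommutativeSemigroup as CommutativeSemigroupProperties
open import Data.Bool.Base using (Bool; T)
open import Data.Empty using (⊥-elim)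
open import Data.Fin.Base using (Fin; zero; suc; punchIn)
open import Data.Fin.Properties using (punchInᵢ≢i) renaming (_≟_ to _≟ᶠ_)
open import Data.Fin.Permutation using (Permutation′; permutation)
open import Data.Integer.Base as ℤ using (ℤ; +_; 0ℤ)
open import Data.Integer.Divisibility.Signed as ℤ∣ using (divides)
import Data.Integer.Properties as ℤₚ
import Data.Integer.Solver as ℤSolver
open import Data.List.Base using (List; []; _∷_; map)
open import Data.Nat.Base using (ℕ; zero; suc; _^_; _≤_)
open import Data.Nat.Divisibility using (_∣_)
open import Data.Nat.Primality using (Prime)
open import Data.Product.Base using (Σ-syntax; ∃; ∃-syntax; ∃₂; _×_; _,_; proj₁; proj₂)
open import Data.Vec.Base as Vec using (Vec; []; _∷_; toList; _∷ʳ_; zipWith)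
open import Data.Vec.Functional using (removeAt)
open import Function.Base using (_∘_; id)
open import Function.Bundles using (_↔_; Inverse)
import Relation.Binary.Construct.On as On
open import Relation.Binary.PropositionalEquality
  using (_≡_; _≢_; refl; sym; trans; cong; cong₂; subst; setoid; module ≡-Reasoning)
open import Relation.Nullary using (¬_; Dec; yes; no)

------------------------------------------------------------------------
-- Monoids

_≅_ : ∀ {a ℓ b ℓ′} → Monoid a ℓ → Monoid b ℓ′ → Set _
M ≅ N = Σ[ φ ∈ (M.Carrier → N.Carrier) ] IsMonoidIsomorphism φ
  where
  module M = Monoid M
  module N = Monoid N
  open MonoidMorphisms M.rawMonoid N.rawMonoid

-- The product f ∙ g is "first g, then f".  (In Function.Endo.Setoid
-- the order is the opposite one.)
Maps : Set → Monoid 0ℓ 0ℓ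
Maps A = record
  { Carrier  = A → A
  ; _≈_      = λ f g → ∀ x → f x ≡ g x
  ; _∙_      = λ f g → f ∘ g
  ; ε        = id
  ; isMonoid = record
    { isSemigroup = record
      { isMagma = record
        { isEquivalence = record
          { refl  = λ _ → refl
          ; sym   = λ p x → sym (p x)
          ; trans = λ p q x → trans (p x) (q x)
          }
        ; ∙-cong = λ {f} {g} {h} {k} p q x → trans (cong f (q x)) (p (k x))
        }
      ; assoc = λ _ _ _ _ → refl
      }
    ; identity = (λ _ _ → refl) , (λ _ _ → refl)
    }
  }

M[_] : ℕ → Monoid 0ℓ 0ℓ
M[ n ] = Maps (Fin n)

submonoid : ∀ {a ℓ} (M : Monoid a ℓ) (P : Monoid.Carrier M → Set) → P (Monoid.ε M) →
            (∀ {x y} → P x → P y → P (Monoid._∙_ M x y)) → Monoid a ℓ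
submonoid M P Pε P∙ = record
  { Carrier  = Σ[ x ∈ Carrier ] P x
  ; _≈_      = λ x y → proj₁ x ≈ proj₁ y
  ; _∙_      = λ (x , Px) (y , Py) → x ∙ y , P∙ Px Py
  ; ε        = ε , Pε
  ; isMonoid = record
    { isSemigroup = record
      { isMagma = record
        { isEquivalence = On.isEquivalence proj₁ isEquivalence
        ; ∙-cong        = ∙-cong
        }
      ; assoc = λ (x , _) (y , _) (z , _) → assoc x y z
      }
    ; identity = (λ (x , _) → identityˡ x) , (λ (x , _) → identityʳ x)
    }
  }
  where open Monoid M

Π : (I : Set) → (I → Monoid 0ℓ 0ℓ) → Monoid 0ℓ 0ℓ
Π I M = record
  { Carrier  = ∀ i → Carrier (M i)
  ; _≈_      = λ x y → ∀ i → _≈_ (M i) (x i) (y i)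
  ; _∙_      = λ x y i → _∙_ (M i) (x i) (y i)
  ; ε        = λ i → ε (M i)
  ; isMonoid = record
    { isSemigroup = record
      { isMagma = record
        { isEquivalence = record
          { refl  = λ i → Monoid.refl (M i)
          ; sym   = λ p i → Monoid.sym (M i) (p i)
          ; trans = λ p q i → Monoid.trans (M i) (p i) (q i)
          }
        ; ∙-cong = λ p q i → ∙-cong (M i) (p i) (q i)
        }
      ; assoc = λ x y z i → assoc (M i) (x i) (y i) (z i)
      }
    ; identity = (λ x i → identityˡ (M i) (x i)) , (λ x i → identityʳ (M i) (x i))
    }
  }
  where open Monoid using (Carrier; _≈_; _∙_; ε; ∙-cong; assoc; identityˡ; identityʳ)

-- Antihomomorphisms of monoids from M to End(N).
record AntiHom (M N : Monoid 0ℓ 0ℓ) : Set where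
  private
    module M = Monoid M
    module N = Monoid N
  open MonoidMorphisms N.rawMonoid N.rawMonoid using (IsMonoidHomomorphism)
  field
    act           : M.Carrier → N.Carrier → N.Carrier
    isEndo        : ∀ m → IsMonoidHomomorphism (act m)
    act-cong      : ∀ {m₁ m₂} → m₁ M.≈ m₂ → ∀ n → act m₁ n N.≈ act m₂ n
    act-ε         : ∀ n → act M.ε n N.≈ n
    act-anti-homo : ∀ m₁ m₂ n → act (m₁ M.∙ m₂) n N.≈ act m₂ (act m₁ n)

infix 5 _⋉_by_
_⋉_by_ : (M N : Monoid 0ℓ 0ℓ) → AntiHom M N → Monoid 0ℓ 0ℓ
M ⋉ N by Γ = record
  { Carrier  = M.Carrier × N.Carrier
  ; _≈_      = λ (m₁ , n₁) (m₂ , n₂) → m₁ M.≈ m₂ × n₁ N.≈ n₂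
  ; _∙_      = λ (m₁ , n₁) (m₂ , n₂) → m₁ M.∙ m₂ , act m₂ n₁ N.∙ n₂
  ; ε        = M.ε , N.ε
  ; isMonoid = record
    { isSemigroup = record
      { isMagma = record
        { isEquivalence = record
          { refl  = M.refl , N.refl
          ; sym   = λ (p , q) → M.sym p , N.sym q
          ; trans = λ (p , q) (p′ , q′) → M.trans p p′ , N.trans q q′
          }
        ; ∙-cong = λ { {_} {_} {m₂ , _} (p , q) (p′ , q′) →
            M.∙-cong p p′ ,
            N.∙-cong (N.trans (endo.⟦⟧-cong m₂ q) (act-cong p′ _)) q′ }
        }
      ; assoc = λ (m₁ , n₁) (m₂ , n₂) (m₃ , n₃) →
          M.assoc m₁ m₂ m₃ ,
          N.trans (N.∙-congʳ (endo.homo m₃ _ _))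
            (N.trans (N.assoc _ _ _)
              (N.∙-congʳ (N.sym (act-anti-homo m₂ m₃ n₁))))
      }
    ; identity =
        (λ (m , n) → M.identityˡ m , N.trans (N.∙-congʳ (endo.ε-homo m)) (N.identityˡ n)) ,
        (λ (m , n) → M.identityʳ m , N.trans (N.identityʳ _) (act-ε n))
    }
  }
  where
  module M = Monoid M
  module N = Monoid N
  open AntiHom Γ
  module endo (m : M.Carrier) =
    MonoidMorphisms.IsMonoidHomomorphism (isEndo m)

record _≈_mod_ (x y : ℤ) (k : ℕ) : Set where
  constructor congruent
  field
    divides-diff : + k ℤ∣.∣ x ℤ.- y

-- The cyclic group ℤ/kℤ of order k (for k ≥ 1): integers, with
-- congruence modulo k as the equality.
C : ℕ → AbelianGroup 0ℓ 0ℓ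
C k = record
  { Carrier        = ℤ
  ; _≈_            = λ x y → x ≈ y mod k
  ; _∙_            = ℤ._+_
  ; ε              = 0ℤ
  ; _⁻¹            = ℤ.-_
  ; isAbelianGroup = record
    { isGroup = record
      { isMonoid = record
        { isSemigroup = record
          { isMagma = record
            { isEquivalence = record
              { refl  = ≡⇒≈ refl
              ; sym   = λ {x} {y} (congruent p) →
                  congruent (subst (+ k ℤ∣.∣_) (neg-diff x y) (ℤ∣.∣m⇒∣-m p))
              ; trans = λ {x} {y} {z} (congruent p) (congruent q) →
                  congruent (subst (+ k ℤ∣.∣_) (add-diff x y z) (ℤ∣.∣m∣n⇒∣m+n p q))
              }
            ; ∙-cong = λ {x} {y} {u} {v} (congruent p) (congruent q) →
                congruent (subst (+ k ℤ∣.∣_) (sum-diff x y u v) (ℤ∣.∣m∣n⇒∣m+n p q))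
            }
          ; assoc = λ x y z → ≡⇒≈ (ℤₚ.+-assoc x y z)
          }
        ; identity = (λ x → ≡⇒≈ (ℤₚ.+-identityˡ x)) , (λ x → ≡⇒≈ (ℤₚ.+-identityʳ x))
        }
      ; inverse = (λ x → ≡⇒≈ (ℤₚ.+-inverseˡ x)) , (λ x → ≡⇒≈ (ℤₚ.+-inverseʳ x))
      ; ⁻¹-cong = λ {x} {y} (congruent p) →
          congruent (subst (+ k ℤ∣.∣_) (neg-neg x y) (ℤ∣.∣m⇒∣-m p))
      }
    ; comm = λ x y → ≡⇒≈ (ℤₚ.+-comm x y)
    }
  }
  where
  ≡⇒≈ : ∀ {x y} → x ≡ y → x ≈ y mod k
  ≡⇒≈ {x} refl = congruent (divides 0ℤ (ℤₚ.+-inverseʳ x))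

  open ℤSolver.+-*-Solver

  neg-diff : ∀ x y → ℤ.- (x ℤ.- y) ≡ y ℤ.- x
  neg-diff = solve 2 (λ x y → :- (x :- y) := y :- x) refl

  neg-neg : ∀ x y → ℤ.- (x ℤ.- y) ≡ (ℤ.- x) ℤ.- (ℤ.- y)
  neg-neg = solve 2 (λ x y → :- (x :- y) := (:- x) :- (:- y)) refl

  add-diff : ∀ x y z → (x ℤ.- y) ℤ.+ (y ℤ.- z) ≡ x ℤ.- z
  add-diff = solve 3 (λ x y z → (x :- y) :+ (y :- z) := x :- z) refl

  sum-diff : ∀ x y u v → (x ℤ.- y) ℤ.+ (u ℤ.- v) ≡ (x ℤ.+ u) ℤ.- (y ℤ.+ v)
  sum-diff = solve 4 (λ x y u v → (x :- y) :+ (u :- v) := (x :+ u) :- (y :+ v)) refl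

C[_]^_ : ℕ → ℕ → Monoid 0ℓ 0ℓ
C[ k ]^ n = Pointwise.monoid (Fin n) (AbelianGroup.monoid (C k))

Γ : ∀ k n → AntiHom M[ n ] (C[ k ]^ n)
Γ k n = record
  { act           = λ σ γ i → γ (σ i)
  ; isEndo        = λ σ → record
    { isMagmaHomomorphism = record
      { isRelHomomorphism = record { cong = λ p i → p (σ i) }
      ; homo              = λ _ _ _ → A.refl
      }
    ; ε-homo = λ _ → A.refl
    }
  ; act-cong      = λ p γ i → A.reflexive (cong γ (p i))
  ; act-ε         = λ _ _ → A.refl
  ; act-anti-homo = λ _ _ _ _ → A.refl
  }
  where module A = AbelianGroup (C k)

------------------------------------------------------------------------
-- Finite fields

IsPrimePower : ℕ → Set
IsPrimePower q = ∃₂ λ p e → Prime p × 1 ≤ e × q ≡ p ^ e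

record FiniteField (n : ℕ) : Set₁ where
  infixl 6 _+_
  infixl 7 _*_
  field
    Carrier           : Set
    _+_ _*_           : Carrier → Carrier → Carrier
    -_                : Carrier → Carrier
    0# 1#             : Carrier
    isCommutativeRing : IsCommutativeRing _≡_ _+_ _*_ -_ 0# 1#
    0≢1               : 0# ≢ 1#
    invertible        : ∀ x → x ≢ 0# → ∃[ y ] x * y ≡ 1#
    finite            : Carrier ↔ Fin n

  commutativeRing : CommutativeRing 0ℓ 0ℓ
  commutativeRing = record { isCommutativeRing = isCommutativeRing }

  open CommutativeRing commutativeRing public using (rawRing)

record _↪_ {n n′} (K : FiniteField n) (L : FiniteField n′) : Set where
  private
    module K = FiniteField K
    module L = FiniteField L
  open RingMorphisms K.rawRing L.rawRing using (IsRingHomomorphism)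
  field
    ⟦_⟧                : K.Carrier → L.Carrier
    isRingHomomorphism : IsRingHomomorphism ⟦_⟧

record Subfield {n} (L : FiniteField n) (r : ℕ) : Set where
  open FiniteField L
  field
    member    : Carrier → Bool
    0-closed  : T (member 0#)
    1-closed  : T (member 1#)
    +-closed  : ∀ {x y} → T (member x) → T (member y) → T (member (x + y))
    *-closed  : ∀ {x y} → T (member x) → T (member y) → T (member (x * y))
    neg-closed : ∀ {x} → T (member x) → T (member (- x))
    inv-closed : ∀ {x y} → T (member x) → x * y ≡ 1# → T (member y)
    order     : (∃[ x ] T (member x)) ↔ Fin r

-- x lies in the subfield of order r.  A finite field has at most one
-- subfield of each order, so "in some" and "in the" agree.
InSubfield : ∀ {n} (L : FiniteField n) (r : ℕ) → FiniteField.Carrier L → Set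
InSubfield L r x = Σ[ S ∈ Subfield L r ] T (Subfield.member S x)

------------------------------------------------------------------------
-- Polynomials over a finite field

module _ {n} (K : FiniteField n) where
  open FiniteField K

  -- Coefficients, constant term first; trailing zeros are allowed, and
  -- equality is equality of all coefficients.
  Poly : Set
  Poly = List Carrier

  coeff : Poly → ℕ → Carrier
  coeff []      _       = 0#
  coeff (a ∷ p) zero    = a
  coeff (a ∷ p) (suc i) = coeff p i

  addPoly : Poly → Poly → Poly
  addPoly []      q       = q
  addPoly p       []      = p
  addPoly (a ∷ p) (b ∷ q) = (a + b) ∷ addPoly p q

  mulPoly : Poly → Poly → Poly
  mulPoly []      q = []
  mulPoly (a ∷ p) q = addPoly (map (a *_) q) (0# ∷ mulPoly p q)

  polyRawSemiring : RawSemiring 0ℓ 0ℓ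
  polyRawSemiring = record
    { Carrier = Poly
    ; _≈_     = λ p q → ∀ i → coeff p i ≡ coeff q i
    ; _+_     = addPoly
    ; _*_     = mulPoly
    ; 0#      = []
    ; 1#      = 1# ∷ []
    }

  open RawSemiringDefinitions polyRawSemiring using (Irreducible)

  monic : ∀ {k} → Vec Carrier k → Poly
  monic v = toList (v ∷ʳ 1#)

  -- A monic polynomial of degree k is given by its k lower coefficients.
  MonicIrreducible : ℕ → Set
  MonicIrreducible k = Σ[ v ∈ Vec Carrier k ] Irreducible (monic v)

  -- There are exactly c of them; proofs of irreducibility are not compared.
  MonicIrreducibleCount : ℕ → ℕ → Set
  MonicIrreducibleCount k c =
    Inverse (On.setoid (setoid (Vec Carrier k)) (proj₁ {B = Irreducible ∘ monic}))
            (setoid (Fin c))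

------------------------------------------------------------------------
-- x ^ n ≡ x in a field with n elements; used below to reduce composites
-- of polynomials to degree less than n

module Fermat {n} (L : FiniteField n) where
  open FiniteField L
  open CommutativeRing commutativeRing
    using (*-commutativeMonoid; semiring; *-assoc; *-comm; *-identityˡ; *-identityʳ; zeroˡ; zeroʳ)
  open Inverse finite using (to; from; strictlyInverseˡ; strictlyInverseʳ)
  open Sum *-commutativeMonoid
    using (sum-remove; sum-permute; sum-cong-≗; ∑-distrib-+; sum-replicate; sum-replicate-zero)
    renaming (sum to ∏)
  open RawSemiringDefinitions (Semiring.rawSemiring semiring) using () renaming (_^_ to _^ᶠ_) public
  open ≡-Reasoning

  infix 4 _≟_
  _≟_ : (x y : Carrier) → Dec (x ≡ y)
  x ≟ y with to x ≟ᶠ to y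
  ... | yes p = yes (trans (sym (strictlyInverseʳ x)) (trans (cong from p) (strictlyInverseʳ y)))
  ... | no ¬p = no (¬p ∘ cong to)

  *-nonzero : ∀ {x y} → x ≢ 0# → y ≢ 0# → x * y ≢ 0#
  *-nonzero {x} {y} x≢0 y≢0 xy≡0 with invertible x x≢0
  ... | x⁻¹ , xx⁻¹≡1 = y≢0 (begin
    y                ≡⟨ *-identityˡ y ⟨
    1# * y           ≡⟨ cong (_* y) xx⁻¹≡1 ⟨
    (x * x⁻¹) * y    ≡⟨ cong (_* y) (*-comm x x⁻¹) ⟩
    (x⁻¹ * x) * y    ≡⟨ *-assoc x⁻¹ x y ⟩
    x⁻¹ * (x * y)    ≡⟨ cong (x⁻¹ *_) xy≡0 ⟩
    x⁻¹ * 0#         ≡⟨ zeroʳ x⁻¹ ⟩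
    0#               ∎)

  ∏-nonzero : ∀ {k} (f : Fin k → Carrier) → (∀ i → f i ≢ 0#) → ∏ f ≢ 0#
  ∏-nonzero {zero}  f f≢0 = 0≢1 ∘ sym
  ∏-nonzero {suc k} f f≢0 = *-nonzero (f≢0 zero) (∏-nonzero (f ∘ suc) (f≢0 ∘ suc))

  ∏-single : ∀ {k} (f : Fin k → Carrier) i → (∀ j → j ≢ i → f j ≡ 1#) → ∏ f ≡ f i
  ∏-single {suc k} f i f≡1 = begin
    ∏ f                         ≡⟨ sum-remove {i = i} f ⟩
    f i * ∏ (removeAt f i)      ≡⟨ cong (f i *_) (sum-cong-≗ (λ j → f≡1 (punchIn i j) (punchInᵢ≢i i j))) ⟩
    f i * ∏ {k} (λ _ → 1#)      ≡⟨ cong (f i *_) (sum-replicate-zero k) ⟩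
    f i * 1#                    ≡⟨ *-identityʳ (f i) ⟩
    f i                         ∎

  module _ (x : Carrier) (x≢0 : x ≢ 0#) where
    private
      x⁻¹ = proj₁ (invertible x x≢0)

      cancel : ∀ z → x⁻¹ * (x * z) ≡ z
      cancel z = begin
        x⁻¹ * (x * z)    ≡⟨ *-assoc x⁻¹ x z ⟨
        (x⁻¹ * x) * z    ≡⟨ cong (_* z) (*-comm x⁻¹ x) ⟩
        (x * x⁻¹) * z    ≡⟨ cong (_* z) (proj₂ (invertible x x≢0)) ⟩
        1# * z           ≡⟨ *-identityˡ z ⟩
        z                ∎

      cancel′ : ∀ z → x * (x⁻¹ * z) ≡ z
      cancel′ z = begin
        x * (x⁻¹ * z)    ≡⟨ *-assoc x x⁻¹ z ⟨
        (x * x⁻¹) * z    ≡⟨ cong (_* z) (proj₂ (invertible x x≢0)) ⟩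
        1# * z           ≡⟨ *-identityˡ z ⟩
        z                ∎

      -- Off zero the triple (h, k, l) is (id, x, 1); at zero it is (1, 1, x).
      h k l : Carrier → Carrier
      h z with z ≟ 0#
      ... | yes _ = 1#
      ... | no  _ = z
      k z with z ≟ 0#
      ... | yes _ = 1#
      ... | no  _ = x
      l z with z ≟ 0#
      ... | yes _ = x
      ... | no  _ = 1#

      h-mul : ∀ z → h (x * z) ≡ k z * h z
      h-mul z with z ≟ 0# | x * z ≟ 0#
      ... | yes _   | yes _    = sym (*-identityˡ 1#)
      ... | yes z≡0 | no  xz≢0 = ⊥-elim (xz≢0 (trans (cong (x *_) z≡0) (zeroʳ x)))
      ... | no z≢0  | yes xz≡0 = ⊥-elim (*-nonzero x≢0 z≢0 xz≡0)
      ... | no _    | no _     = refl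

      h-nonzero : ∀ z → h z ≢ 0#
      h-nonzero z with z ≟ 0#
      ... | yes _  = 0≢1 ∘ sym
      ... | no z≢0 = z≢0

      kl≡x : ∀ z → k z * l z ≡ x
      kl≡x z with z ≟ 0#
      ... | yes _ = *-identityˡ x
      ... | no  _ = *-identityʳ x

      l-zero : l 0# ≡ x
      l-zero with 0# ≟ 0#
      ... | yes _  = refl
      ... | no 0≢0 = ⊥-elim (0≢0 refl)

      l-nonzero : ∀ {z} → z ≢ 0# → l z ≡ 1#
      l-nonzero {z} z≢0 with z ≟ 0#
      ... | yes z≡0 = ⊥-elim (z≢0 z≡0)
      ... | no  _   = refl

      perm : Permutation′ n
      perm = permutation (λ i → to (x * from i)) (λ i → to (x⁻¹ * from i))
        (λ i → trans (cong (λ z → to (x * z)) (strictlyInverseʳ _))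
                 (trans (cong to (cancel′ (from i))) (strictlyInverseˡ i)))
        (λ i → trans (cong (λ z → to (x⁻¹ * z)) (strictlyInverseʳ _))
                 (trans (cong to (cancel (from i))) (strictlyInverseˡ i)))

      P Q : Carrier
      P = ∏ {n} (h ∘ from)
      Q = ∏ {n} (k ∘ from)

      P≡QP : P ≡ Q * P
      P≡QP = begin
        P                                        ≡⟨ sum-permute (h ∘ from) perm ⟩
        ∏ (λ i → h (from (to (x * from i))))     ≡⟨ sum-cong-≗ {n} (λ i → cong h (strictlyInverseʳ (x * from i))) ⟩
        ∏ (λ i → h (x * from i))                 ≡⟨ sum-cong-≗ (λ i → h-mul (from i)) ⟩
        ∏ (λ i → k (from i) * h (from i))        ≡⟨ ∑-distrib-+ (k ∘ from) (h ∘ from) ⟩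
        Q * P                                    ∎

      Q≡1 : Q ≡ 1#
      Q≡1 with invertible P (∏-nonzero (h ∘ from) (h-nonzero ∘ from))
      ... | P⁻¹ , PP⁻¹≡1 = begin
        Q                ≡⟨ *-identityʳ Q ⟨
        Q * 1#           ≡⟨ cong (Q *_) PP⁻¹≡1 ⟨
        Q * (P * P⁻¹)    ≡⟨ *-assoc Q P P⁻¹ ⟨
        (Q * P) * P⁻¹    ≡⟨ cong (_* P⁻¹) P≡QP ⟨
        P * P⁻¹          ≡⟨ PP⁻¹≡1 ⟩
        1#               ∎

      ∏l≡x : ∏ {n} (l ∘ from) ≡ x
      ∏l≡x = begin
        ∏ (l ∘ from)     ≡⟨ ∏-single (l ∘ from) (to 0#) (λ j j≢0 → l-nonzero (λ fj≡0 →
                              j≢0 (trans (sym (strictlyInverseˡ j)) (cong to fj≡0)))) ⟩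
        l (from (to 0#)) ≡⟨ cong l (strictlyInverseʳ 0#) ⟩
        l 0#             ≡⟨ l-zero ⟩
        x                ∎

    nonzero-^ : x ^ᶠ n ≡ x
    nonzero-^ = begin
      x ^ᶠ n                               ≡⟨ sum-replicate n ⟨
      ∏ {n} (λ _ → x)                      ≡⟨ sum-cong-≗ {n} (λ i → kl≡x (from i)) ⟨
      ∏ (λ i → k (from i) * l (from i))    ≡⟨ ∑-distrib-+ (k ∘ from) (l ∘ from) ⟩
      Q * ∏ (l ∘ from)                     ≡⟨ cong₂ _*_ Q≡1 ∏l≡x ⟩
      1# * x                               ≡⟨ *-identityˡ x ⟩
      x                                    ∎

  zero-^ : ∀ {k} → Fin k → 0# ^ᶠ k ≡ 0#
  zero-^ {suc k} _ = zeroˡ (0# ^ᶠ k)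

  ^-order : ∀ x → x ^ᶠ n ≡ x
  ^-order x with x ≟ 0#
  ... | yes refl = zero-^ (to 0#)
  ... | no  x≢0  = nonzero-^ x x≢0

  order≥2 : ∃[ j ] n ≡ suc (suc j)
  order≥2 = two (to 0#) (to 1#) λ p →
    0≢1 (trans (sym (strictlyInverseʳ 0#)) (trans (cong from p) (strictlyInverseʳ 1#)))
    where
    two : ∀ {n} (i j : Fin n) → i ≢ j → ∃[ k ] n ≡ suc (suc k)
    two {suc zero}    zero zero i≢j = ⊥-elim (i≢j refl)
    two {suc (suc n)} _    _    _   = n , refl

------------------------------------------------------------------------
-- Subfield preserving maps

module _ (q m : ℕ) (K : FiniteField q) (L : FiniteField (q ^ m)) (ι : K ↪ L) where
  open FiniteField L
  open _↪_ ι
  private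
    module K = FiniteField K

  SubfieldPreserving : (Carrier → Carrier) → Set
  SubfieldPreserving f =
    (∀ a → ∃[ b ] f ⟦ a ⟧ ≡ ⟦ b ⟧) ×
    (∀ d s → d ∣ m → s ∣ m → ∀ x →
       InSubfield L (q ^ d) x × ¬ InSubfield L (q ^ s) x →
       InSubfield L (q ^ d) (f x) × ¬ InSubfield L (q ^ s) (f x))

  eval : List K.Carrier → Carrier → Carrier
  eval []      x = 0#
  eval (a ∷ p) x = ⟦ a ⟧ + x * eval p x

  -- For n = q ^ m the polynomial over L of degree less than n inducing f
  -- is unique, so this says that its coefficients lie in K.
  InducedByPoly : ℕ → (Carrier → Carrier) → Set
  InducedByPoly n f = Σ[ p ∈ Vec K.Carrier n ] (∀ x → f x ≡ eval (toList p) x)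

  IsT : (Carrier → Carrier) → Set
  IsT f = SubfieldPreserving f × InducedByPoly (q ^ m) f

  private
    open CommutativeRing commutativeRing
      using ( *-assoc; *-comm; *-identityʳ; zeroˡ; zeroʳ; distribˡ; distribʳ
            ; +-identityˡ; +-identityʳ; +-assoc; +-comm; +-commutativeMonoid)
    open CommutativeSemigroupProperties (CommutativeMonoid.commutativeSemigroup +-commutativeMonoid) using (interchange)
    open RingMorphisms.IsRingHomomorphism isRingHomomorphism
      using (+-homo; *-homo; 0#-homo; 1#-homo)
    open Fermat L using (_^ᶠ_; ^-order; order≥2)
    open ≡-Reasoning

    ext : ∀ {n f g} → (∀ x → f x ≡ g x) → InducedByPoly n g → InducedByPoly n f
    ext f≗g (p , g≗p) = p , λ x → trans (f≗g x) (g≗p x)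

    zeroᵖ : ∀ n → InducedByPoly n (λ _ → 0#)
    zeroᵖ zero    = [] , λ _ → refl
    zeroᵖ (suc n) = let p , 0≗p = zeroᵖ n in K.0# ∷ p , λ x → sym (begin
      ⟦ K.0# ⟧ + x * eval (toList p) x    ≡⟨ cong₂ _+_ 0#-homo (cong (x *_) (sym (0≗p x))) ⟩
      0# + x * 0#                         ≡⟨ +-identityˡ _ ⟩
      x * 0#                              ≡⟨ zeroʳ x ⟩
      0#                                  ∎)

    constᵖ : ∀ {n} a → InducedByPoly (suc n) (λ _ → ⟦ a ⟧)
    constᵖ {n} a = let p , 0≗p = zeroᵖ n in a ∷ p , λ x → sym (begin
      ⟦ a ⟧ + x * eval (toList p) x       ≡⟨ cong (λ z → ⟦ a ⟧ + x * z) (sym (0≗p x)) ⟩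
      ⟦ a ⟧ + x * 0#                      ≡⟨ cong (λ z → ⟦ a ⟧ + z) (zeroʳ x) ⟩
      ⟦ a ⟧ + 0#                          ≡⟨ +-identityʳ _ ⟩
      ⟦ a ⟧                               ∎)

    linearᵖ : ∀ {n} a → InducedByPoly (suc (suc n)) (λ x → x * ⟦ a ⟧)
    linearᵖ a = let p , a≗p = constᵖ a in K.0# ∷ p , λ x → sym (begin
      ⟦ K.0# ⟧ + x * eval (toList p) x    ≡⟨ cong₂ _+_ 0#-homo (cong (x *_) (sym (a≗p x))) ⟩
      0# + x * ⟦ a ⟧                      ≡⟨ +-identityˡ _ ⟩
      x * ⟦ a ⟧                           ∎)

    eval-add : ∀ {n} (p r : Vec K.Carrier n) x →
               eval (toList p) x + eval (toList r) x ≡ eval (toList (zipWith K._+_ p r)) x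
    eval-add []      []      x = +-identityˡ 0#
    eval-add (a ∷ p) (b ∷ r) x = begin
      (⟦ a ⟧ + x * u) + (⟦ b ⟧ + x * v)    ≡⟨ interchange _ _ _ _ ⟩
      (⟦ a ⟧ + ⟦ b ⟧) + (x * u + x * v)    ≡⟨ cong₂ _+_ (sym (+-homo a b)) (sym (distribˡ x u v)) ⟩
      ⟦ a K.+ b ⟧ + x * (u + v)            ≡⟨ cong (λ z → ⟦ a K.+ b ⟧ + x * z) (eval-add p r x) ⟩
      _                                    ∎
      where
      u = eval (toList p) x
      v = eval (toList r) x

    addᵖ : ∀ {n f g} → InducedByPoly n f → InducedByPoly n g → InducedByPoly n (λ x → f x + g x)
    addᵖ (p , f≗p) (r , g≗r) =
      zipWith K._+_ p r , λ x → trans (cong₂ _+_ (f≗p x) (g≗r x)) (eval-add p r x)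

    eval-scale : ∀ {n} a (p : Vec K.Carrier n) x →
                 ⟦ a ⟧ * eval (toList p) x ≡ eval (toList (Vec.map (a K.*_) p)) x
    eval-scale a []      x = zeroʳ _
    eval-scale a (b ∷ p) x = begin
      ⟦ a ⟧ * (⟦ b ⟧ + x * u)              ≡⟨ distribˡ _ _ _ ⟩
      ⟦ a ⟧ * ⟦ b ⟧ + ⟦ a ⟧ * (x * u)      ≡⟨ cong₂ _+_ (sym (*-homo a b)) (begin
        ⟦ a ⟧ * (x * u)    ≡⟨ *-assoc _ _ _ ⟨
        (⟦ a ⟧ * x) * u    ≡⟨ cong (_* u) (*-comm _ _) ⟩
        (x * ⟦ a ⟧) * u    ≡⟨ *-assoc _ _ _ ⟩
        x * (⟦ a ⟧ * u)    ≡⟨ cong (x *_) (eval-scale a p x) ⟩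
        _                  ∎) ⟩
      _                                    ∎
      where u = eval (toList p) x

    scaleᵖ : ∀ {n f} a → InducedByPoly n f → InducedByPoly n (λ x → ⟦ a ⟧ * f x)
    scaleᵖ a (p , f≗p) =
      Vec.map (a K.*_) p , λ x → trans (cong (λ z → ⟦ a ⟧ * z) (f≗p x)) (eval-scale a p x)

    -- Shifting the coefficients up by one, c being the one that drops out.
    shift : ∀ {n} b (p : Vec K.Carrier n) → ∃₂ λ (r : Vec K.Carrier n) c → ∀ x →
            ⟦ b ⟧ + x * eval (toList p) x ≡ eval (toList r) x + (x ^ᶠ n) * ⟦ c ⟧
    shift b []      = [] , b , λ x → begin
      ⟦ b ⟧ + x * 0#     ≡⟨ cong (λ z → ⟦ b ⟧ + z) (zeroʳ x) ⟩
      ⟦ b ⟧ + 0#         ≡⟨ +-comm _ _ ⟩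
      0# + ⟦ b ⟧         ≡⟨ cong (λ z → 0# + z) (CommutativeRing.*-identityˡ commutativeRing ⟦ b ⟧) ⟨
      0# + 1# * ⟦ b ⟧    ∎
    shift {suc n} b (a ∷ p) = let r , c , eq = shift a p in b ∷ r , c , λ x → begin
      ⟦ b ⟧ + x * (⟦ a ⟧ + x * eval (toList p) x)
        ≡⟨ cong (λ z → ⟦ b ⟧ + x * z) (eq x) ⟩
      ⟦ b ⟧ + x * (eval (toList r) x + (x ^ᶠ n) * ⟦ c ⟧)
        ≡⟨ cong (λ z → ⟦ b ⟧ + z) (distribˡ _ _ _) ⟩
      ⟦ b ⟧ + (x * eval (toList r) x + x * ((x ^ᶠ n) * ⟦ c ⟧))
        ≡⟨ +-assoc _ _ _ ⟨
      (⟦ b ⟧ + x * eval (toList r) x) + x * ((x ^ᶠ n) * ⟦ c ⟧)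
        ≡⟨ cong (λ z → ⟦ b ⟧ + x * eval (toList r) x + z) (sym (*-assoc _ _ _)) ⟩
      (⟦ b ⟧ + x * eval (toList r) x) + (x * (x ^ᶠ n)) * ⟦ c ⟧
        ∎

    module Closure {n} (^-fix : ∀ x → x ^ᶠ n ≡ x) (n≥2 : ∃[ j ] n ≡ suc (suc j)) where

      const′ : ∀ a → InducedByPoly n (λ _ → ⟦ a ⟧)
      const′ a = subst (λ k → InducedByPoly k _) (sym (proj₂ n≥2)) (constᵖ a)

      linear′ : ∀ a → InducedByPoly n (λ x → x * ⟦ a ⟧)
      linear′ a = subst (λ k → InducedByPoly k _) (sym (proj₂ n≥2)) (linearᵖ a)

      timesX : ∀ {f} → InducedByPoly n f → InducedByPoly n (λ x → x * f x)
      timesX {f} (p , f≗p) = let r , c , eq = shift K.0# p in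
        ext (λ x → begin
          x * f x                                  ≡⟨ cong (x *_) (f≗p x) ⟩
          x * eval (toList p) x                    ≡⟨ +-identityˡ _ ⟨
          0# + x * eval (toList p) x               ≡⟨ cong (_+ x * eval (toList p) x) 0#-homo ⟨
          ⟦ K.0# ⟧ + x * eval (toList p) x         ≡⟨ eq x ⟩
          eval (toList r) x + (x ^ᶠ n) * ⟦ c ⟧     ≡⟨ cong (λ z → eval (toList r) x + z * ⟦ c ⟧) (^-fix x) ⟩
          eval (toList r) x + x * ⟦ c ⟧            ∎)
        (addᵖ (r , λ _ → refl) (linear′ c))

      mul-eval : ∀ {f} (r : List K.Carrier) → InducedByPoly n f →
                 InducedByPoly n (λ x → eval r x * f x)
      mul-eval {f} []      F = ext (λ x → zeroˡ (f x)) (zeroᵖ n)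
      mul-eval {f} (b ∷ r) F =
        ext (λ x → trans (distribʳ (f x) ⟦ b ⟧ _) (cong (λ z → ⟦ b ⟧ * f x + z) (*-assoc x _ (f x))))
            (addᵖ (scaleᵖ b F) (timesX (mul-eval r F)))

      compose-eval : ∀ {g} (p : List K.Carrier) → InducedByPoly n g →
                     InducedByPoly n (λ x → eval p (g x))
      compose-eval     []      G         = zeroᵖ n
      compose-eval {g} (a ∷ p) (r , g≗r) =
        addᵖ (const′ a)
          (ext (λ x → cong (_* eval p (g x)) (g≗r x))
               (mul-eval (toList r) (compose-eval p (r , g≗r))))

      idᵖ : InducedByPoly n id
      idᵖ = ext (λ x → trans (sym (*-identityʳ x)) (cong (x *_) (sym 1#-homo))) (linear′ K.1#)

      composeᵖ : ∀ {f g} → InducedByPoly n f → InducedByPoly n g → InducedByPoly n (f ∘ g)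
      composeᵖ {f} {g} (p , f≗p) G = ext (λ x → f≗p (g x)) (compose-eval (toList p) G)

    open Closure ^-order order≥2

  IsT-id : IsT id
  IsT-id = ((λ a → a , refl) , λ _ _ _ _ _ → id) , idᵖ

  IsT-∘ : ∀ {f g} → IsT f → IsT g → IsT (f ∘ g)
  IsT-∘ {f} {g} ((f-K , f-L) , F) ((g-K , g-L) , G) =
    ( (λ a → let b , eq = g-K a ; c , eq′ = f-K b in c , trans (cong f eq) eq′)
    , (λ d s d∣m s∣m x → f-L d s d∣m s∣m (g x) ∘ g-L d s d∣m s∣m x)
    ) , composeᵖ F G

  𝒯 : Monoid 0ℓ 0ℓ
  𝒯 = submonoid (Maps Carrier) IsT IsT-id IsT-∘

-- Let F x = x^q. Interpolation and uniqueness of coefficients show that the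
-- maps induced by polynomials over K are exactly those commuting with F, and
-- since the subfield of order q^d is the set of fixed points of F^d, such a
-- map preserves subfields iff it preserves the period of every point under F.
-- For k dividing m, sending a point of period k to its minimal polynomial
-- identifies the F-orbits of length k with the monic irreducible polynomials
-- of degree k. Choosing a root x_i of the i-th polynomial, a map f in T is
-- determined, freely, by the equations f (x_i) = F^(γ i) x_(σ i), with
-- γ i taken modulo k, and composition of maps becomes the semidirect product.

module Submission where

open import Defs
open import Level using (0ℓ)
open import Algebra.Bundles using (CommutativeRing; AbelianGroup; Monoid)
open import Algebra.Morphism.Structures using (module RingMorphisms)
open import Algebra.Structures using (IsCommutativeRing)
import Algebra.Definitions.RawSemiring as RawSemiringDefinitions
import Algebra.Definitions.RawMagma as RawMagmaDefinitions
import Algebra.Properties.CommutativeSemiring.Exp as Exp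
import Algebra.Properties.Group as GroupProperties
import Algebra.Properties.Ring as RingProperties
import Algebra.Solver.Ring.NaturalCoefficients.Default as RingSolver
open import Data.Bool.Base using (Bool; T)
open import Data.Bool.Properties using (T-irrelevant; T?)
open import Data.Empty using (⊥; ⊥-elim)
open import Data.Fin.Base as Fin using (Fin; zero; suc; toℕ; inject≤; punchOut)
import Data.Fin.Properties as Finₚ
open import Data.Integer.Base as ℤ using (ℤ; +_)
open import Data.Integer.Divisibility.Signed as ℤ∣ using (divides)
open import Data.Integer.DivMod using (_%ℕ_; _/ℕ_; a≡a%ℕn+[a/ℕn]*n)
import Data.Integer.Properties as ℤₚ
open import Data.List.Base as List using (List; []; _∷_; length)
open import Data.Nat.Base as ℕ using (ℕ; zero; suc; _^_; _≤_; _<_; z≤n; s≤s; NonZero)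
open import Data.Nat.Divisibility as ℕ∣ using (_∣_)
open import Data.Nat.DivMod using (_%_; _/_; m≡m%n+[m/n]*n; m%n<n)
import Data.Nat.Properties as ℕₚ
open import Data.Product.Base using (Σ-syntax; ∃; ∃₂; _×_; _,_; proj₁; proj₂)
open import Data.Product.Function.NonDependent.Propositional using (_×-↔_)
open import Data.Sum.Base using (_⊎_; inj₁; inj₂)
open import Function.Construct.Composition using (_↔-∘_)
open import Function.Construct.Symmetry using (↔-sym)
open import Data.Vec.Base as Vec using (Vec; []; _∷_; _∷ʳ_; replicate; zipWith; toList)
import Data.Vec.Properties as Vecₚ
open import Function.Base using (_∘_; id; case_of_)
open import Function.Bundles using (_↔_; Inverse; mk↔ₛ′)
open import Function.Definitions using (Injective)
open import Relation.Binary.PropositionalEquality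
  using (_≡_; _≢_; isEquivalence; refl; sym; trans; cong; cong₂; subst; module ≡-Reasoning)
open import Relation.Nullary using (¬_; Dec; yes; no)
open import Relation.Nullary.Decidable using (⌊_⌋; toWitness; fromWitness; map′)
open import Relation.Unary using (Decidable)

-- Polynomial functions over a finite field

-- `K`, `L` and `ι` are abstract, so every fact relating them comes from counting roots. A nonzero
-- polynomial has at most as many roots as its degree, while `x ^ n ≡ x` in a field with n elements
-- supplies polynomials that vanish everywhere. Upper bounds make F additive and its fixed points
-- scalars: otherwise some polynomial would have too many roots. Lower bounds run the other way: a
-- monic polynomial vanishing on all of L has degree at least q^m. This gives enough fixed points of
-- F^d, through a relative trace. A similar count gives each irreducible w whose degree divides m a
-- root in L, once w is known to divide X^(q^m) - X. For that divisibility K[X]/(w) is built as a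
-- finite field, in which the class of X satisfies Fermat's identity. The last obstacle is choice:
-- roots and exponents are found by search, so the map to the product and its inverse must be shown
-- not to depend on them, up to congruence modulo k.

module FieldProperties {n} (L : FiniteField n) where
  open FiniteField L
  open Fermat L
  open CommutativeRing commutativeRing
    using ( commutativeSemiring; *-assoc; *-identityˡ; *-identityʳ; zeroˡ; zeroʳ; distribˡ; distribʳ
          ; +-identityˡ; +-identityʳ; +-assoc; -‿inverseʳ; +-group; ring)
  open Exp commutativeSemiring using (^-homo-*)
  open GroupProperties +-group using (x∙y⁻¹≈ε⇒x≈y)
  open Inverse finite using (to; from; strictlyInverseˡ; strictlyInverseʳ)
  open RingSolver commutativeSemiring using (solve; _:=_; _:+_; _:*_; con)
  open ≡-Reasoning

  from-injective : Injective _≡_ _≡_ from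
  from-injective p = trans (sym (strictlyInverseˡ _)) (trans (cong to p) (strictlyInverseˡ _))

  search : ∀ {P : Carrier → Set} → Decidable P → Dec (∃ P)
  search {P} P? = map′ (λ (i , p) → from i , p)
    (λ (x , p) → to x , subst P (sym (strictlyInverseʳ x)) p) (Finₚ.any? (P? ∘ from))

  zero-product : ∀ {x y} → x * y ≡ 0# → x ≡ 0# ⊎ y ≡ 0#
  zero-product {x} {y} xy≡0 with x ≟ 0# | y ≟ 0#
  ... | yes x≡0 | _       = inj₁ x≡0
  ... | no _    | yes y≡0 = inj₂ y≡0
  ... | no x≢0  | no y≢0  = ⊥-elim (*-nonzero x≢0 y≢0 xy≡0)

  *-cancelʳ : ∀ {x y z} → z ≢ 0# → x * z ≡ y * z → x ≡ y
  *-cancelʳ {x} {y} {z} z≢0 eq = let z⁻¹ , zz⁻¹≡1 = invertible z z≢0 in begin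
    x                ≡⟨ *-identityʳ x ⟨
    x * 1#           ≡⟨ cong (x *_) zz⁻¹≡1 ⟨
    x * (z * z⁻¹)    ≡⟨ *-assoc x z z⁻¹ ⟨
    x * z * z⁻¹      ≡⟨ cong (_* z⁻¹) eq ⟩
    y * z * z⁻¹      ≡⟨ *-assoc y z z⁻¹ ⟩
    y * (z * z⁻¹)    ≡⟨ cong (y *_) zz⁻¹≡1 ⟩
    y * 1#           ≡⟨ *-identityʳ y ⟩
    y                ∎

  -- The length stands for a strict degree bound, so it can be compared directly with a number of
  -- roots.
  ev : ∀ {k} → Vec Carrier k → Carrier → Carrier
  ev []      x = 0#
  ev (a ∷ p) x = a + x * ev p x

  -- Synthetic division by X - c.
  divide : ∀ {k} → Vec Carrier (suc k) → Carrier → Vec Carrier k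
  divide (b ∷ [])        c = []
  divide (b ∷ p@(_ ∷ _)) c = ev p c ∷ divide p c

  -- p = p(c) + (X - c) · divide p c, with both sides moved so that no
  -- subtraction occurs.
  divide-ev : ∀ {k} (p : Vec Carrier (suc k)) c x →
              ev p x + c * ev (divide p c) x ≡ ev p c + x * ev (divide p c) x
  divide-ev (b ∷ []) c x =
    solve 3 (λ b c x → (b :+ x :* con 0) :+ c :* con 0 := (b :+ c :* con 0) :+ x :* con 0) refl b c x
  divide-ev (b ∷ p@(_ ∷ _)) c x = begin
    (b + x * E) + c * (e + x * Q)    ≡⟨ solve 6 (λ b c x e E Q → (b :+ x :* E) :+ c :* (e :+ x :* Q) :=
                                         (b :+ c :* e) :+ x :* (E :+ c :* Q)) refl b c x e E Q ⟩
    (b + c * e) + x * (E + c * Q)    ≡⟨ cong (λ z → (b + c * e) + x * z) (divide-ev p c x) ⟩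
    (b + c * e) + x * (e + x * Q)    ∎
    where
    e = ev p c
    E = ev p x
    Q = ev (divide p c) x

  ev-zero : ∀ k x → ev (replicate k 0#) x ≡ 0#
  ev-zero zero    x = refl
  ev-zero (suc k) x = trans (+-identityˡ _) (trans (cong (x *_) (ev-zero k x)) (zeroʳ x))

  -- The coefficients of the quotient are the Horner values at c of the proper tails of p. If they
  -- and `ev p c` all vanish, each coefficient of p is zero in turn.
  divide-zero : ∀ {k} (p : Vec Carrier (suc k)) c →
                divide p c ≡ replicate k 0# → ev p c ≡ 0# → p ≡ replicate (suc k) 0#
  divide-zero (b ∷ []) c _ eq = cong (_∷ []) (begin
    b             ≡⟨ +-identityʳ b ⟨
    b + 0#        ≡⟨ cong (λ z → b + z) (zeroʳ c) ⟨
    b + c * 0#    ≡⟨ eq ⟩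
    0#            ∎)
  divide-zero (b ∷ p@(_ ∷ _)) c div≡0 eq = cong₂ _∷_ (begin
    b               ≡⟨ +-identityʳ b ⟨
    b + 0#          ≡⟨ cong (λ z → b + z) (zeroʳ c) ⟨
    b + c * 0#      ≡⟨ cong (λ z → b + c * z) e≡0 ⟨
    b + c * ev p c  ≡⟨ eq ⟩
    0#              ∎)
    (divide-zero p c (Vecₚ.∷-injectiveʳ div≡0) e≡0)
    where e≡0 = Vecₚ.∷-injectiveˡ div≡0

  -- Divide by X - c for the first root c. The quotient has one coefficient fewer and vanishes at
  -- the other roots: a nonzero value at x could be cancelled, giving x = c.
  root-bound : ∀ {k} (p : Vec Carrier k) (a : Fin k → Carrier) → Injective _≡_ _≡_ a →
               (∀ i → ev p (a i) ≡ 0#) → p ≡ replicate k 0#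
  root-bound {zero}  []  a a-inj root = refl
  root-bound {suc k} p   a a-inj root =
    divide-zero p c (root-bound (divide p c) (a ∘ suc) (Finₚ.suc-injective ∘ a-inj) root′) (root zero)
    where
    c = a zero
    root′ : ∀ i → ev (divide p c) (a (suc i)) ≡ 0#
    root′ i with ev (divide p c) (a (suc i)) ≟ 0#
    ... | yes eq = eq
    ... | no neq = case a-inj (*-cancelʳ neq (begin
      c * Q                 ≡⟨ +-identityˡ _ ⟨
      0# + c * Q            ≡⟨ cong (_+ c * Q) (root (suc i)) ⟨
      ev p x + c * Q        ≡⟨ divide-ev p c x ⟩
      ev p c + x * Q        ≡⟨ cong (_+ x * Q) (root zero) ⟩
      0# + x * Q            ≡⟨ +-identityˡ _ ⟩
      x * Q                 ∎)) of λ ()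
      where
      x = a (suc i)
      Q = ev (divide p c) x

  ev-+ : ∀ {k} (p r : Vec Carrier k) x → ev (zipWith _+_ p r) x ≡ ev p x + ev r x
  ev-+ []      []      x = sym (+-identityˡ 0#)
  ev-+ (a ∷ p) (b ∷ r) x = trans (cong (λ z → (a + b) + x * z) (ev-+ p r x))
    (solve 5 (λ a b x P R → (a :+ b) :+ x :* (P :+ R) := (a :+ x :* P) :+ (b :+ x :* R)) refl a b x _ _)

  ev-scale : ∀ {k} c (p : Vec Carrier k) x → ev (Vec.map (c *_) p) x ≡ c * ev p x
  ev-scale c []      x = sym (zeroʳ c)
  ev-scale c (a ∷ p) x = trans (cong (λ z → c * a + x * z) (ev-scale c p x))
    (solve 4 (λ c a x P → c :* a :+ x :* (c :* P) := c :* (a :+ x :* P)) refl c a x _)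

  ev-∷ʳ : ∀ {k} (p : Vec Carrier k) c x → ev (p ∷ʳ c) x ≡ x ^ᶠ k * c + ev p x
  ev-∷ʳ []      c x = solve 2 (λ c x → c :+ x :* con 0 := con 1 :* c :+ con 0) refl c x
  ev-∷ʳ {suc k} (a ∷ p) c x = trans (cong (λ z → a + x * z) (ev-∷ʳ p c x))
    (solve 5 (λ a c x P X → a :+ x :* (X :* c :+ P) := x :* X :* c :+ (a :+ x :* P)) refl a c x _ _)

  private
    difference-zero : ∀ {k} (p r : Vec Carrier k) →
      zipWith _+_ p (Vec.map (- 1# *_) r) ≡ replicate k 0# → p ≡ r
    difference-zero []      []      _  = refl
    difference-zero (a ∷ p) (b ∷ r) eq = cong₂ _∷_
      (x∙y⁻¹≈ε⇒x≈y a b (trans (cong (λ z → a + z) (sym (RingProperties.-1*x≈-x ring b))) (Vecₚ.∷-injectiveˡ eq)))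
      (difference-zero p r (Vecₚ.∷-injectiveʳ eq))

  ev-unique : ∀ {k} (p r : Vec Carrier k) (a : Fin k → Carrier) → Injective _≡_ _≡_ a →
              (∀ i → ev p (a i) ≡ ev r (a i)) → p ≡ r
  ev-unique p r a a-inj eq = difference-zero p r (root-bound _ a a-inj λ i → begin
    ev (zipWith _+_ p (Vec.map (- 1# *_) r)) (a i)    ≡⟨ ev-+ p _ (a i) ⟩
    ev p (a i) + ev (Vec.map (- 1# *_) r) (a i)       ≡⟨ cong₂ _+_ (eq i) (ev-scale _ r (a i)) ⟩
    ev r (a i) + - 1# * ev r (a i)                    ≡⟨ cong (λ z → ev r (a i) + z) (RingProperties.-1*x≈-x ring _) ⟩
    ev r (a i) + - ev r (a i)                         ≡⟨ -‿inverseʳ _ ⟩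
    0#                                                ∎)

  -- e + (X + c) · p
  shift-add : ∀ {k} → Carrier → Carrier → Vec Carrier k → Vec Carrier (suc k)
  shift-add c e []      = e ∷ []
  shift-add c e (b ∷ p) = (e + c * b) ∷ shift-add c b p

  ev-shift-add : ∀ {k} c e (p : Vec Carrier k) x → ev (shift-add c e p) x ≡ e + (x + c) * ev p x
  ev-shift-add c e []      x = solve 3 (λ c e x → e :+ x :* con 0 := e :+ (x :+ c) :* con 0) refl c e x
  ev-shift-add c e (b ∷ p) x = trans (cong (λ z → (e + c * b) + x * z) (ev-shift-add c b p x))
    (solve 5 (λ c e b x P → (e :+ c :* b) :+ x :* (b :+ (x :+ c) :* P) := e :+ (x :+ c) :* (b :+ x :* P))
      refl c e b x _)

  -- Newton interpolation: apply the induction hypothesis to the divided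
  -- difference of f at the first point.
  interpolate : ∀ {k} (a : Fin k → Carrier) → Injective _≡_ _≡_ a → (f : Carrier → Carrier) →
                ∃ λ (p : Vec Carrier k) → ∀ i → ev p (a i) ≡ f (a i)
  interpolate {zero}  a a-inj f = [] , λ ()
  interpolate {suc k} a a-inj f = shift-add (- c) (f c) p , at
    where
    c = a zero

    quotient : ∀ x → ∃ λ y → x ≢ c → f x ≡ f c + (x + - c) * y
    quotient x with x ≟ c
    -- A default value: the divided difference is only used at the remaining points, which differ
    -- from c.
    ... | yes x≡c = 0# , λ x≢c → ⊥-elim (x≢c x≡c)
    ... | no x≢c  = let z , xc·z≡1 = invertible (x + - c) (x≢c ∘ x∙y⁻¹≈ε⇒x≈y x c) in
      z * (f x + - f c) , λ _ → sym (begin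
        f c + (x + - c) * (z * (f x + - f c))    ≡⟨ cong (λ w → f c + w) (sym (*-assoc _ _ _)) ⟩
        f c + (x + - c) * z * (f x + - f c)      ≡⟨ cong (λ w → f c + w * (f x + - f c)) xc·z≡1 ⟩
        f c + 1# * (f x + - f c)                 ≡⟨ solve 3 (λ a b c → a :+ con 1 :* (b :+ c) := b :+ (a :+ c)) refl (f c) (f x) (- f c) ⟩
        f x + (f c + - f c)                      ≡⟨ cong (λ w → f x + w) (-‿inverseʳ _) ⟩
        f x + 0#                                 ≡⟨ +-identityʳ _ ⟩
        f x                                      ∎)

    IH = interpolate (a ∘ suc) (Finₚ.suc-injective ∘ a-inj) (proj₁ ∘ quotient)
    p = proj₁ IH

    at : ∀ i → ev (shift-add (- c) (f c) p) (a i) ≡ f (a i)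
    at zero = begin
      ev (shift-add (- c) (f c) p) c    ≡⟨ ev-shift-add (- c) (f c) p c ⟩
      f c + (c + - c) * ev p c          ≡⟨ cong (λ z → f c + z * ev p c) (-‿inverseʳ c) ⟩
      f c + 0# * ev p c                 ≡⟨ cong (λ z → f c + z) (zeroˡ _) ⟩
      f c + 0#                          ≡⟨ +-identityʳ _ ⟩
      f c                               ∎
    at (suc i) = let x = a (suc i) in begin
      ev (shift-add (- c) (f c) p) x            ≡⟨ ev-shift-add (- c) (f c) p x ⟩
      f c + (x + - c) * ev p x                  ≡⟨ cong (λ z → f c + (x + - c) * z) (proj₂ IH i) ⟩
      f c + (x + - c) * proj₁ (quotient x)      ≡⟨ proj₂ (quotient x) (λ eq → case a-inj eq of λ ()) ⟨
      f x                                       ∎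

  -- Degree bounds are put on functions, so products and powers need only the existence of
  -- coefficients and no convolution of vectors. Since different polynomials may induce one
  -- function, this is an upper bound and not a degree.
  Low : ℕ → (Carrier → Carrier) → Set
  Low k f = ∃ λ (p : Vec Carrier k) → ∀ x → f x ≡ ev p x

  low-ext : ∀ {k f g} → (∀ x → f x ≡ g x) → Low k g → Low k f
  low-ext f≗g (p , eq) = p , λ x → trans (f≗g x) (eq x)

  low-zero : ∀ {k} → Low k (λ _ → 0#)
  low-zero {k} = replicate k 0# , λ x → sym (ev-zero k x)

  low-const : ∀ {k} c → Low (suc k) (λ _ → c)
  low-const {k} c = c ∷ replicate k 0# , λ x →
    sym (trans (cong (λ z → c + x * z) (ev-zero k x)) (trans (cong (λ z → c + z) (zeroʳ x)) (+-identityʳ c)))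

  low-+ : ∀ {k f g} → Low k f → Low k g → Low k (λ x → f x + g x)
  low-+ (p , f≗p) (r , g≗r) = zipWith _+_ p r , λ x → trans (cong₂ _+_ (f≗p x) (g≗r x)) (sym (ev-+ p r x))

  low-scale : ∀ {k f} c → Low k f → Low k (λ x → c * f x)
  low-scale c (p , f≗p) = Vec.map (c *_) p , λ x → trans (cong (c *_) (f≗p x)) (sym (ev-scale c p x))

  low-X* : ∀ {k f} → Low k f → Low (suc k) (λ x → x * f x)
  low-X* (p , f≗p) = 0# ∷ p , λ x → trans (cong (x *_) (f≗p x)) (sym (+-identityˡ _))

  low-weaken : ∀ {j k f} → j ≤ k → Low j f → Low k f
  low-weaken {f = f} j≤k (p , f≗p) = let r , p≗r = go j≤k p in r , λ x → trans (f≗p x) (p≗r x)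
    where
    go : ∀ {j k} → j ≤ k → (p : Vec Carrier j) → Low k (ev p)
    go z≤n       []      = low-zero
    go (s≤s j≤k) (a ∷ p) = let r , p≗r = go j≤k p in a ∷ r , λ x → cong (λ z → a + x * z) (p≗r x)

  -- One bound is strict and the other weak: degree below j times degree at most k is degree below j
  -- + k. This also covers j = 0, where the product is zero.
  low-* : ∀ {j k f g} → Low j f → Low (suc k) g → Low (j ℕ.+ k) (λ x → f x * g x)
  low-* {g = g} (p , f≗p) G = low-ext (λ x → cong (_* g x) (f≗p x)) (go p)
    where
    go : ∀ {j} (p : Vec Carrier j) → Low (j ℕ.+ _) (λ x → ev p x * g x)
    go []      = low-ext (λ x → zeroˡ (g x)) low-zero
    go {suc j} (a ∷ p) =
      low-ext (λ x → solve 4 (λ a x P G → (a :+ x :* P) :* G := a :* G :+ x :* (P :* G)) refl a x _ _)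
        (low-+ (low-weaken (s≤s (ℕₚ.m≤n+m _ j)) (low-scale a G)) (low-X* (go p)))

  low-X^* : ∀ {k f} j → Low k f → Low (j ℕ.+ k) (λ x → x ^ᶠ j * f x)
  low-X^* zero    F = low-ext (λ x → *-identityˡ _) F
  low-X^* (suc j) F = low-ext (λ x → *-assoc x _ _) (low-X* (low-X^* j F))

  low-vanishing : ∀ {k f} → Low k f → (a : Fin k → Carrier) → Injective _≡_ _≡_ a →
                  (∀ i → f (a i) ≡ 0#) → ∀ x → f x ≡ 0#
  low-vanishing {k} (p , f≗p) a a-inj root x = begin
    _                        ≡⟨ f≗p x ⟩
    ev p x                   ≡⟨ cong (λ r → ev r x) (root-bound p a a-inj λ i → trans (sym (f≗p (a i))) (root i)) ⟩
    ev (replicate k 0#) x    ≡⟨ ev-zero k x ⟩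
    0#                       ∎

  Monicᶠ : ℕ → (Carrier → Carrier) → Set
  Monicᶠ k f = ∃ λ l → Low k l × (∀ x → f x ≡ x ^ᶠ k + l x)

  monic-ext : ∀ {k f g} → (∀ x → f x ≡ g x) → Monicᶠ k g → Monicᶠ k f
  monic-ext f≗g (l , low , eq) = l , low , λ x → trans (f≗g x) (eq x)

  monic⇒low : ∀ {k f} → Monicᶠ k f → Low (suc k) f
  monic⇒low {k} (l , (p , l≗p) , f≗) = p ∷ʳ 1# , λ x → begin
    _                         ≡⟨ f≗ x ⟩
    x ^ᶠ k + l x              ≡⟨ cong₂ _+_ (sym (*-identityʳ _)) (l≗p x) ⟩
    x ^ᶠ k * 1# + ev p x      ≡⟨ ev-∷ʳ p 1# x ⟨
    ev (p ∷ʳ 1#) x            ∎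

  monic-+ : ∀ {k f g} → Monicᶠ k f → Low k g → Monicᶠ k (λ x → f x + g x)
  monic-+ {g = g} (l , low , f≗) G =
    (λ x → l x + g x) , low-+ low G , λ x → trans (cong (_+ g x) (f≗ x)) (+-assoc _ _ _)

  monic-one : Monicᶠ 0 (λ _ → 1#)
  monic-one = (λ _ → 0#) , low-zero , λ x → sym (+-identityʳ 1#)

  monic-X^ : ∀ k → Monicᶠ k (_^ᶠ k)
  monic-X^ k = (λ _ → 0#) , low-zero , λ x → sym (+-identityʳ _)

  monic-X+ : ∀ c → Monicᶠ 1 (_+ c)
  monic-X+ c = (λ _ → c) , low-const c , λ x → cong (_+ c) (sym (*-identityʳ x))

  monic-* : ∀ {j k f g} → Monicᶠ j f → Monicᶠ k g → Monicᶠ (j ℕ.+ k) (λ x → f x * g x)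
  monic-* {j} {k} {f} {g} (l , low , f≗) G@(l′ , low′ , g≗) =
    (λ x → x ^ᶠ j * l′ x + l x * g x) ,
    low-+ (low-X^* j low′) (low-* low (monic⇒low G)) , λ x → begin
    f x * g x                                     ≡⟨ cong (_* g x) (f≗ x) ⟩
    (x ^ᶠ j + l x) * g x                          ≡⟨ distribʳ _ _ _ ⟩
    x ^ᶠ j * g x + l x * g x                      ≡⟨ cong (λ z → x ^ᶠ j * z + l x * g x) (g≗ x) ⟩
    x ^ᶠ j * (x ^ᶠ k + l′ x) + l x * g x          ≡⟨ cong (_+ l x * g x) (distribˡ _ _ _) ⟩
    (x ^ᶠ j * x ^ᶠ k + x ^ᶠ j * l′ x) + l x * g x ≡⟨ +-assoc _ _ _ ⟩
    x ^ᶠ j * x ^ᶠ k + (x ^ᶠ j * l′ x + l x * g x) ≡⟨ cong (_+ _) (^-homo-* x j k) ⟨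
    x ^ᶠ (j ℕ.+ k) + (x ^ᶠ j * l′ x + l x * g x)  ∎

  monic-^ : ∀ {k f} → Monicᶠ k f → ∀ j → Monicᶠ (j ℕ.* k) (λ x → f x ^ᶠ j)
  monic-^ F zero    = monic-one
  monic-^ F (suc j) = monic-* F (monic-^ F j)

  private
    last-zero : ∀ {k} (p : Vec Carrier k) {c} → p ∷ʳ c ≡ replicate (suc k) 0# → c ≡ 0#
    last-zero []      eq = Vecₚ.∷-injectiveˡ eq
    last-zero (a ∷ p) eq = last-zero p (Vecₚ.∷-injectiveʳ eq)

  -- The leading coefficient 1 prevents the coefficient vector of length k + 1 from being zero.
  monic-root-bound : ∀ {k f} → Monicᶠ k f → (a : Fin (suc k) → Carrier) → Injective _≡_ _≡_ a →
                     ¬ (∀ i → f (a i) ≡ 0#)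
  monic-root-bound F@(_ , (p , _) , _) a a-inj root = let r , f≗r = monic⇒low F in
    0≢1 (sym (last-zero p (root-bound r a a-inj λ i → trans (sym (f≗r (a i))) (root i))))

  -- The source of lower bounds: if k < n, then k + 1 elements of L would be roots of a monic
  -- polynomial of degree k.
  monic-vanishing : ∀ {k f} → Monicᶠ k f → (∀ x → f x ≡ 0#) → n ≤ k
  monic-vanishing {k} F f≗0 = ℕₚ.≮⇒≥ λ k<n → monic-root-bound F (λ i → from (inject≤ i k<n))
    (λ eq → Finₚ.inject≤-injective k<n k<n _ _ (from-injective eq)) (λ i → f≗0 _)

-- The Frobenius map

module Frobenius {q m} (1≤m : 1 ≤ m) (K : FiniteField q) (L : FiniteField (q ^ m)) (ι : K ↪ L) where
  open FiniteField L
  private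
    module K = FiniteField K
  open _↪_ ι
  open Fermat L
  open FieldProperties L
  open RingMorphisms.IsRingHomomorphism isRingHomomorphism
  open CommutativeRing commutativeRing
    using (commutativeSemiring; *-comm; *-identityʳ; zeroˡ; +-comm; -‿inverseˡ; +-group; ring)
  open Exp commutativeSemiring using (^-assocʳ; ^-distrib-*)
  open GroupProperties +-group using (x∙y⁻¹≈ε⇒x≈y; x≈y⇒x∙y⁻¹≈ε; ∙-cancelˡ; inverseˡ-unique)
  open ≡-Reasoning

  2≤q : 2 ≤ q
  2≤q = let j , q≡2+j = Fermat.order≥2 K in subst (2 ≤_) (sym q≡2+j) (s≤s (s≤s z≤n))

  instance
    q≢0 : NonZero q
    q≢0 = ℕ.>-nonZero (ℕₚ.<-trans ℕₚ.0<1+n 2≤q)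

  -- If a ≠ b, then a - b is a unit, and a unit sent to 0 would force 0 = 1 in L.
  ⟦⟧-injective : ∀ {a b} → ⟦ a ⟧ ≡ ⟦ b ⟧ → a ≡ b
  ⟦⟧-injective {a} {b} eq with Fermat._≟_ K (a K.+ K.- b) K.0#
  ... | yes a-b≡0 = GroupProperties.x∙y⁻¹≈ε⇒x≈y (CommutativeRing.+-group K.commutativeRing) a b a-b≡0
  ... | no a-b≢0  = let y , [a-b]y≡1 = K.invertible _ a-b≢0 in ⊥-elim (0≢1 (begin
    0#                          ≡⟨ zeroˡ ⟦ y ⟧ ⟨
    0# * ⟦ y ⟧                  ≡⟨ cong (_* ⟦ y ⟧) (x≈y⇒x∙y⁻¹≈ε eq) ⟨
    (⟦ a ⟧ + - ⟦ b ⟧) * ⟦ y ⟧   ≡⟨ cong (λ z → (⟦ a ⟧ + z) * ⟦ y ⟧) (-‿homo b) ⟨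
    (⟦ a ⟧ + ⟦ K.- b ⟧) * ⟦ y ⟧ ≡⟨ cong (_* ⟦ y ⟧) (+-homo a _) ⟨
    ⟦ a K.+ K.- b ⟧ * ⟦ y ⟧     ≡⟨ *-homo _ y ⟨
    ⟦ (a K.+ K.- b) K.* y ⟧     ≡⟨ cong ⟦_⟧ [a-b]y≡1 ⟩
    ⟦ K.1# ⟧                    ≡⟨ 1#-homo ⟩
    1#                          ∎))

  F : Carrier → Carrier
  F x = x ^ᶠ q

  F-⟦⟧ : ∀ a → F ⟦ a ⟧ ≡ ⟦ a ⟧
  F-⟦⟧ a = trans (power q) (cong ⟦_⟧ (Fermat.^-order K a))
    where
    power : ∀ j → ⟦ a ⟧ ^ᶠ j ≡ ⟦ Fermat._^ᶠ_ K a j ⟧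
    power zero    = sym 1#-homo
    power (suc j) = trans (cong (⟦ a ⟧ *_) (power j)) (sym (*-homo _ _))

  F-* : ∀ x y → F (x * y) ≡ F x * F y
  F-* x y = ^-distrib-* x y q

  F-zero : F 0# ≡ 0#
  F-zero = trans (cong F (sym 0#-homo)) (trans (F-⟦⟧ K.0#) 0#-homo)

  F-one : F 1# ≡ 1#
  F-one = trans (cong F (sym 1#-homo)) (trans (F-⟦⟧ K.1#) 1#-homo)

  private
    scalar : Fin q → Carrier
    scalar i = ⟦ Inverse.from K.finite i ⟧

    scalar-injective : Injective _≡_ _≡_ scalar
    scalar-injective = FieldProperties.from-injective K ∘ ⟦⟧-injective

    -- (X + y)^q - X^q - y^q has degree less than q = ∣ K ∣.
    additive-from-K : ∀ y → (∀ a → F (⟦ a ⟧ + y) ≡ F ⟦ a ⟧ + F y) → ∀ x → F (x + y) ≡ F x + F y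
    additive-from-K y on-K x with subst (λ k → Monicᶠ k (λ x → F (x + y))) (ℕₚ.*-identityʳ q) (monic-^ (monic-X+ y) q)
    ... | l , low , F≗ = trans (F≗ x) (cong (λ z → F x + z) (x∙y⁻¹≈ε⇒x≈y _ _
      (low-vanishing (low-+ low (low-weaken (ℕₚ.<⇒≤ 2≤q) (low-const (- F y)))) scalar scalar-injective
        (λ i → x≈y⇒x∙y⁻¹≈ε (∙-cancelˡ _ _ _ (trans (sym (F≗ _)) (on-K _)))) x)))

  -- On K additivity is clear, since F fixes every scalar. `additive-from-K` is then used twice:
  -- once to free the first argument, and again, after swapping, to free the other.
  F-+ : ∀ x y → F (x + y) ≡ F x + F y
  F-+ x y = additive-from-K y (λ a → trans (cong F (+-comm _ _)) (trans (F-+⟦⟧ a) (+-comm _ _))) x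
    where
    F-+⟦⟧ : ∀ a → F (y + ⟦ a ⟧) ≡ F y + F ⟦ a ⟧
    F-+⟦⟧ a = additive-from-K ⟦ a ⟧ (λ b → begin
      F (⟦ b ⟧ + ⟦ a ⟧)      ≡⟨ cong F (+-homo b a) ⟨
      F ⟦ b K.+ a ⟧          ≡⟨ F-⟦⟧ _ ⟩
      ⟦ b K.+ a ⟧            ≡⟨ +-homo b a ⟩
      ⟦ b ⟧ + ⟦ a ⟧          ≡⟨ cong₂ _+_ (F-⟦⟧ b) (F-⟦⟧ a) ⟨
      F ⟦ b ⟧ + F ⟦ a ⟧      ∎) y

  F-neg : ∀ x → F (- x) ≡ - F x
  F-neg x = inverseˡ-unique (F (- x)) (F x)
    (trans (sym (F-+ (- x) x)) (trans (cong F (-‿inverseˡ x)) F-zero))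

  Fr : ℕ → Carrier → Carrier
  Fr zero    x = x
  Fr (suc j) x = F (Fr j x)

  Fr-∘ : ∀ i j x → Fr (i ℕ.+ j) x ≡ Fr i (Fr j x)
  Fr-∘ zero    j x = refl
  Fr-∘ (suc i) j x = cong F (Fr-∘ i j x)

  Fr-comm : ∀ i j x → Fr i (Fr j x) ≡ Fr j (Fr i x)
  Fr-comm i j x = trans (sym (Fr-∘ i j x)) (trans (cong (λ k → Fr k x) (ℕₚ.+-comm i j)) (Fr-∘ j i x))

  Fr-+ : ∀ j x y → Fr j (x + y) ≡ Fr j x + Fr j y
  Fr-+ zero    x y = refl
  Fr-+ (suc j) x y = trans (cong F (Fr-+ j x y)) (F-+ _ _)

  Fr-* : ∀ j x y → Fr j (x * y) ≡ Fr j x * Fr j y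
  Fr-* zero    x y = refl
  Fr-* (suc j) x y = trans (cong F (Fr-* j x y)) (F-* _ _)

  Fr-neg : ∀ j x → Fr j (- x) ≡ - Fr j x
  Fr-neg zero    x = refl
  Fr-neg (suc j) x = trans (cong F (Fr-neg j x)) (F-neg _)

  Fr-⟦⟧ : ∀ j a → Fr j ⟦ a ⟧ ≡ ⟦ a ⟧
  Fr-⟦⟧ zero    a = refl
  Fr-⟦⟧ (suc j) a = trans (cong F (Fr-⟦⟧ j a)) (F-⟦⟧ a)

  Fr-^ : ∀ j x → Fr j x ≡ x ^ᶠ (q ^ j)
  Fr-^ zero    x = sym (*-identityʳ x)
  Fr-^ (suc j) x = begin
    F (Fr j x)              ≡⟨ cong F (Fr-^ j x) ⟩
    (x ^ᶠ (q ^ j)) ^ᶠ q     ≡⟨ ^-assocʳ x (q ^ j) q ⟩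
    x ^ᶠ (q ^ j ℕ.* q)      ≡⟨ cong (x ^ᶠ_) (ℕₚ.*-comm (q ^ j) q) ⟩
    x ^ᶠ (q ℕ.* q ^ j)      ∎

  Fr-order : ∀ x → Fr m x ≡ x
  Fr-order x = trans (Fr-^ m x) (^-order x)

  F⁻¹ : Carrier → Carrier
  F⁻¹ = Fr (ℕ.pred m)

  F-F⁻¹ : ∀ x → F (F⁻¹ x) ≡ x
  F-F⁻¹ x = trans (cong (λ k → Fr k x) (ℕₚ.suc-pred m {{ℕ.>-nonZero 1≤m}})) (Fr-order x)

  F⁻¹-F : ∀ x → F⁻¹ (F x) ≡ x
  F⁻¹-F x = trans (Fr-comm (ℕ.pred m) 1 x) (F-F⁻¹ x)

  F-injective : ∀ {x y} → F x ≡ F y → x ≡ y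
  F-injective eq = trans (sym (F⁻¹-F _)) (trans (cong F⁻¹ eq) (F⁻¹-F _))

  Fr-injective : ∀ j {x y} → Fr j x ≡ Fr j y → x ≡ y
  Fr-injective zero    eq = eq
  Fr-injective (suc j) eq = Fr-injective j (F-injective eq)

  monic-X^-X : ∀ {k} → 2 ≤ k → Monicᶠ k (λ x → x ^ᶠ k + - x)
  monic-X^-X {k} 2≤k = monic-+ (monic-X^ k) (low-weaken 2≤k (low-ext
    (λ x → trans (sym (RingProperties.-1*x≈-x ring x)) (*-comm _ x)) (low-X* (low-const (- 1#)))))

  -- The q scalars are already roots of X^q - X; any further fixed point would be root number q + 1.
  fixed⇒scalar : ∀ {x} → F x ≡ x → ∃ λ a → x ≡ ⟦ a ⟧
  fixed⇒scalar {x} Fx≡x with FieldProperties.search K (λ a → x ≟ ⟦ a ⟧)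
  ... | yes ∃a = ∃a
  ... | no ∄a = ⊥-elim (monic-root-bound (monic-X^-X 2≤q) point point-injective root)
    where
    point : Fin (suc q) → Carrier
    point zero    = x
    point (suc i) = scalar i

    point-injective : Injective _≡_ _≡_ point
    point-injective {zero}  {zero}  _  = refl
    point-injective {zero}  {suc j} eq = ⊥-elim (∄a (_ , eq))
    point-injective {suc i} {zero}  eq = ⊥-elim (∄a (_ , sym eq))
    point-injective {suc i} {suc j} eq = cong suc (scalar-injective eq)

    root : ∀ i → F (point i) + - point i ≡ 0#
    root zero    = x≈y⇒x∙y⁻¹≈ε Fx≡x
    root (suc i) = x≈y⇒x∙y⁻¹≈ε (F-⟦⟧ _)

  ev-map-F : ∀ {k} (p : Vec Carrier k) x → ev (Vec.map F p) (F x) ≡ F (ev p x)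
  ev-map-F []      x = sym F-zero
  ev-map-F (a ∷ p) x = begin
    F a + F x * ev (Vec.map F p) (F x)    ≡⟨ cong (λ z → F a + F x * z) (ev-map-F p x) ⟩
    F a + F x * F (ev p x)                ≡⟨ cong (λ z → F a + z) (F-* x _) ⟨
    F a + F (x * ev p x)                  ≡⟨ F-+ a _ ⟨
    F (a + x * ev p x)                    ∎

  -- Applying F to the coefficients gives a polynomial that agrees with p at all points F x. As k ≤
  -- q^m there are k distinct such points, so the two coincide: each coefficient is fixed by F and
  -- hence a scalar.
  descend : ∀ {k} → k ≤ q ^ m → (p : Vec Carrier k) → (∀ x → ev p (F x) ≡ F (ev p x)) →
            ∃ λ p′ → Vec.map ⟦_⟧ p′ ≡ p
  descend {k} k≤N p comm = coefficients p (ev-unique (Vec.map F p) p point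
      (Finₚ.inject≤-injective k≤N k≤N _ _ ∘ from-injective ∘ F-injective)
      (λ i → trans (ev-map-F p _) (sym (comm _))))
    where
    point : Fin k → Carrier
    point i = F (Inverse.from finite (inject≤ i k≤N))

    coefficients : ∀ {k} (p : Vec Carrier k) → Vec.map F p ≡ p → ∃ λ p′ → Vec.map ⟦_⟧ p′ ≡ p
    coefficients []      _  = [] , refl
    coefficients (c ∷ p) eq =
      let a , c≡a = fixed⇒scalar (Vecₚ.∷-injectiveˡ eq) ; p′ , eq′ = coefficients p (Vecₚ.∷-injectiveʳ eq)
      in a ∷ p′ , cong₂ _∷_ (sym c≡a) eq′

  evalᴷ : List K.Carrier → Carrier → Carrier
  evalᴷ = eval q m K L ι

  eval-ev : ∀ {k} (p : Vec K.Carrier k) x → evalᴷ (toList p) x ≡ ev (Vec.map ⟦_⟧ p) x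
  eval-ev []      x = refl
  eval-ev (a ∷ p) x = cong (λ z → ⟦ a ⟧ + x * z) (eval-ev p x)

  eval-Fr : ∀ j p x → evalᴷ p (Fr j x) ≡ Fr j (evalᴷ p x)
  eval-Fr zero    p x = refl
  eval-Fr (suc j) p x = trans (eval-F p (Fr j x)) (cong F (eval-Fr j p x))
    where
    eval-F : ∀ p x → evalᴷ p (F x) ≡ F (evalᴷ p x)
    eval-F []      x = sym F-zero
    eval-F (a ∷ p) x = begin
      ⟦ a ⟧ + F x * evalᴷ p (F x)        ≡⟨ cong₂ _+_ (sym (F-⟦⟧ a)) (cong (F x *_) (eval-F p x)) ⟩
      F ⟦ a ⟧ + F x * F (evalᴷ p x)      ≡⟨ cong (λ z → F ⟦ a ⟧ + z) (F-* x _) ⟨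
      F ⟦ a ⟧ + F (x * evalᴷ p x)        ≡⟨ F-+ _ _ ⟨
      F (⟦ a ⟧ + x * evalᴷ p x)          ∎

  induced⇒commutes : ∀ {k f} → InducedByPoly q m K L ι k f → ∀ x → f (F x) ≡ F (f x)
  induced⇒commutes (p , f≗p) x = trans (f≗p (F x)) (trans (eval-Fr 1 (toList p) x) (cong F (sym (f≗p x))))

  commutes⇒induced : ∀ {f} → (∀ x → f (F x) ≡ F (f x)) → InducedByPoly q m K L ι (q ^ m) f
  commutes⇒induced {f} comm =
    let p , p≗f′ = interpolate (Inverse.from finite) from-injective f
        p≗f : ∀ x → ev p x ≡ f x
        p≗f x = subst (λ y → ev p y ≡ f y) (Inverse.strictlyInverseʳ finite x) (p≗f′ (Inverse.to finite x))
        p′ , eq = descend ℕₚ.≤-refl p (λ x → trans (p≗f (F x)) (trans (comm x) (cong F (sym (p≗f x)))))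
    in p′ , λ x → trans (sym (p≗f x)) (trans (cong (λ r → ev r x) (sym eq)) (sym (eval-ev p′ x)))

-- Subfields

isCommutativeRing-≡ : {A : Set} {_+_ _*_ : A → A → A} { -_ : A → A} {0# 1# : A} →
  (∀ x y z → (x + y) + z ≡ x + (y + z)) → (∀ x y → x + y ≡ y + x) → (∀ x → 0# + x ≡ x) →
  (∀ x → (- x) + x ≡ 0#) →
  (∀ x y z → (x * y) * z ≡ x * (y * z)) → (∀ x y → x * y ≡ y * x) → (∀ x → 1# * x ≡ x) →
  (∀ x y z → x * (y + z) ≡ (x * y) + (x * z)) →
  IsCommutativeRing _≡_ _+_ _*_ -_ 0# 1#
isCommutativeRing-≡ {_+_ = _+_} {_*_} { -_ } +-assoc +-comm +-idˡ +-invˡ *-assoc *-comm *-idˡ distribˡ = record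
  { isRing = record
    { +-isAbelianGroup = record
      { isGroup = record
        { isMonoid = record
          { isSemigroup = record
            { isMagma = record { isEquivalence = isEquivalence ; ∙-cong = cong₂ _+_ }
            ; assoc = +-assoc
            }
          ; identity = +-idˡ , λ x → trans (+-comm x _) (+-idˡ x)
          }
        ; inverse = +-invˡ , λ x → trans (+-comm x _) (+-invˡ x)
        ; ⁻¹-cong = cong (-_)
        }
      ; comm = +-comm
      }
    ; *-cong = cong₂ _*_
    ; *-assoc = *-assoc
    ; *-identity = *-idˡ , λ x → trans (*-comm x _) (*-idˡ x)
    ; distrib = distribˡ , λ x y z → trans (*-comm _ x) (trans (distribˡ x y z) (cong₂ _+_ (*-comm x y) (*-comm x z)))
    }
  ; *-comm = *-comm
  }

element-≡ : {A : Set} {P : A → Bool} {x y : ∃ (T ∘ P)} → proj₁ x ≡ proj₁ y → x ≡ y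
element-≡ {x = x , p} {_ , p′} refl = cong (x ,_) (T-irrelevant p p′)

module _ {n} (L : FiniteField n) where
  open FiniteField L
  open Fermat L using (_^ᶠ_)
  open CommutativeRing commutativeRing
    using (+-assoc; +-comm; +-identityˡ; -‿inverseˡ; *-assoc; *-comm; *-identityˡ; distribˡ)

  module _ {r} (S : Subfield L r) where
    open Subfield S

    -- Serves to apply `^-order` inside the subfield, which turns membership into the equation
    -- `x ^ r ≡ x`.
    subfield⇒field : FiniteField r
    subfield⇒field = record
      { Carrier = ∃ (T ∘ member)
      ; _+_ = λ (x , p) (y , p′) → x + y , +-closed p p′
      ; _*_ = λ (x , p) (y , p′) → x * y , *-closed p p′
      ; -_ = λ (x , p) → - x , neg-closed p
      ; 0# = 0# , 0-closed
      ; 1# = 1# , 1-closed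
      ; isCommutativeRing = isCommutativeRing-≡
          (λ _ _ _ → element-≡ (+-assoc _ _ _)) (λ _ _ → element-≡ (+-comm _ _))
          (λ _ → element-≡ (+-identityˡ _)) (λ _ → element-≡ (-‿inverseˡ _))
          (λ _ _ _ → element-≡ (*-assoc _ _ _)) (λ _ _ → element-≡ (*-comm _ _))
          (λ _ → element-≡ (*-identityˡ _)) (λ _ _ _ → element-≡ (distribˡ _ _ _))
      ; 0≢1 = 0≢1 ∘ cong proj₁
      ; invertible = λ (x , p) x≢0 →
          let y , xy≡1 = invertible x (x≢0 ∘ element-≡) in (y , inv-closed p xy≡1) , element-≡ xy≡1
      ; finite = order
      }

    subfield-^ : ∀ {x} → T (member x) → x ^ᶠ r ≡ x
    subfield-^ {x} p = trans (sym (power r)) (cong proj₁ (Fermat.^-order subfield⇒field (x , p)))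
      where
      power : ∀ j → proj₁ (Fermat._^ᶠ_ subfield⇒field (x , p) j) ≡ x ^ᶠ j
      power zero    = refl
      power (suc j) = cong (x *_) (power j)

-- Counting a decidable subset of a finite set

module _ where
  private
    skip : ∀ {n} (P : Fin (suc n) → Bool) → ¬ T (P zero) → (∃ (T ∘ P ∘ suc)) ↔ (∃ (T ∘ P))
    skip {n} P ¬P0 = mk↔ₛ′ (λ (i , p) → suc i , p) unskip
      (λ { (zero , p) → ⊥-elim (¬P0 p) ; (suc i , p) → refl }) (λ _ → refl)
      where
      unskip : ∃ (T ∘ P) → ∃ (T ∘ P ∘ suc)
      unskip (zero  , p) = ⊥-elim (¬P0 p)
      unskip (suc i , p) = i , p

    keep : ∀ {n c} (P : Fin (suc n) → Bool) → T (P zero) → (∃ (T ∘ P ∘ suc)) ↔ Fin c → (∃ (T ∘ P)) ↔ Fin (suc c)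
    keep P P0 e = mk↔ₛ′ (λ { (zero , p) → zero ; (suc i , p) → suc (to (i , p)) })
      (λ { zero → zero , P0 ; (suc j) → suc (proj₁ (from j)) , proj₂ (from j) })
      (λ { zero → refl ; (suc j) → cong suc (strictlyInverseˡ j) })
      (λ { (zero , p) → cong (zero ,_) (T-irrelevant P0 p)
         ; (suc i , p) → cong (λ (j , r) → suc j , r) (strictlyInverseʳ (i , p)) })
      where
      open Inverse e

  enumerate : ∀ {n} (P : Fin n → Bool) → ∃ λ c → (∃ (T ∘ P)) ↔ Fin c
  enumerate {zero}  P = 0 , mk↔ₛ′ (λ ()) (λ ()) (λ ()) (λ ())
  enumerate {suc n} P with enumerate (P ∘ suc) | T? (P zero)
  ... | c , e | yes P0 = suc c , keep P P0 e
  ... | c , e | no ¬P0 = c , (e ↔-∘ ↔-sym (skip P ¬P0))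

-- The fixed points of F^d as the subfield of order q^d

module FixedField {q m} (1≤m : 1 ≤ m) (K : FiniteField q) (L : FiniteField (q ^ m)) (ι : K ↪ L) where
  open FiniteField L
  open Fermat L
  open FieldProperties L
  open Frobenius 1≤m K L ι
  open CommutativeRing commutativeRing
    using (*-comm; *-identityʳ; zeroˡ; zeroʳ; +-assoc; +-comm; +-group)
  open GroupProperties +-group using (x≈y⇒x∙y⁻¹≈ε; ∙-cancelʳ)
  open Inverse finite using (to; from; strictlyInverseˡ; strictlyInverseʳ)
  open ≡-Reasoning

  InSubfield⇒fixed : ∀ d {x} → InSubfield L (q ^ d) x → Fr d x ≡ x
  InSubfield⇒fixed d (S , x∈S) = trans (Fr-^ d _) (subfield-^ L S x∈S)

  -- The product of the z - g i. It is used both with g running through the fixed points of F^d,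
  -- evaluated at a trace, and with g running through the conjugates of a point.
  ∏-minus : ∀ {k} → (Fin k → Carrier) → Carrier → Carrier
  ∏-minus {zero}  g z = 1#
  ∏-minus {suc k} g z = (z + - g zero) * ∏-minus (g ∘ suc) z

  ∏-minus-zero : ∀ {k} (g : Fin k → Carrier) i {z} → z ≡ g i → ∏-minus g z ≡ 0#
  ∏-minus-zero g zero    eq = trans (cong (_* ∏-minus (g ∘ suc) _) (x≈y⇒x∙y⁻¹≈ε eq)) (zeroˡ _)
  ∏-minus-zero g (suc i) eq = trans (cong (λ z → _ * z) (∏-minus-zero (g ∘ suc) i eq)) (zeroʳ _)

  ∏-minus-monic : ∀ {k D t} (g : Fin k → Carrier) → 1 ≤ D → Monicᶠ D t → Monicᶠ (k ℕ.* D) (∏-minus g ∘ t)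
  ∏-minus-monic {zero}  g 1≤D t-monic = monic-one
  ∏-minus-monic {suc k} g 1≤D t-monic =
    monic-* (monic-+ t-monic (low-weaken 1≤D (low-const _))) (∏-minus-monic (g ∘ suc) 1≤D t-monic)

  2≤q^ : ∀ {d} → 1 ≤ d → 2 ≤ q ^ d
  2≤q^ {suc d} _ = ℕₚ.*-mono-≤ 2≤q (ℕₚ.m^n>0 q d)

  module _ (d : ℕ) (1≤d : 1 ≤ d) where
    -- The sum y + F^d y + ... + F^(i d) y. When m = (i + 1) d it is the relative trace from L to
    -- the fixed points of F^d.
    trace : ℕ → Carrier → Carrier
    trace zero    y = y
    trace (suc i) y = Fr (suc i ℕ.* d) y + trace i y

    trace-monic : ∀ i → Monicᶠ (q ^ (i ℕ.* d)) (trace i)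
    trace-monic zero    = monic-ext (λ x → sym (*-identityʳ x)) (monic-X^ 1)
    trace-monic (suc i) = monic-+ (monic-ext (Fr-^ (suc i ℕ.* d)) (monic-X^ _))
      (low-weaken (ℕₚ.^-monoʳ-< q 2≤q (ℕₚ.m<n+m (i ℕ.* d) 1≤d)) (monic⇒low (trace-monic i)))

    -- F^d shifts the sum by one term: F^((i + 1) d) y enters and y leaves. Adding y on the left
    -- avoids a subtraction.
    Fr-trace : ∀ i y → Fr d (trace i y) + y ≡ Fr (suc i ℕ.* d) y + trace i y
    Fr-trace zero    y = cong (λ j → Fr j y + y) (sym (ℕₚ.+-identityʳ d))
    Fr-trace (suc i) y = begin
      Fr d (Fr (suc i ℕ.* d) y + trace i y) + y             ≡⟨ cong (_+ y) (Fr-+ d _ _) ⟩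
      (Fr d (Fr (suc i ℕ.* d) y) + Fr d (trace i y)) + y    ≡⟨ +-assoc _ _ _ ⟩
      Fr d (Fr (suc i ℕ.* d) y) + (Fr d (trace i y) + y)    ≡⟨ cong₂ _+_ (sym (Fr-∘ d _ y)) (Fr-trace i y) ⟩
      Fr (suc (suc i) ℕ.* d) y + trace (suc i) y            ∎

  fixedᵇ : ℕ → Carrier → Bool
  fixedᵇ d x = ⌊ Fr d x ≟ x ⌋

  module _ (d : ℕ) (d∣m : d ∣ m) where
    private
      1≤d : 1 ≤ d
      1≤d = ℕₚ.n≢0⇒n>0 λ { refl → case ℕ∣.0∣⇒≡0 d∣m of λ { refl → case 1≤m of λ () } }

      c : ℕ
      c = proj₁ (enumerate (fixedᵇ d ∘ from))

      indices : (∃ (T ∘ fixedᵇ d ∘ from)) ↔ Fin c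
      indices = proj₂ (enumerate (fixedᵇ d ∘ from))

      module I = Inverse indices

      fixed-order : (∃ (T ∘ fixedᵇ d)) ↔ Fin c
      fixed-order = mk↔ₛ′
        (λ (x , p) → I.to (to x , subst (T ∘ fixedᵇ d) (sym (strictlyInverseʳ x)) p))
        (λ i → from (proj₁ (I.from i)) , proj₂ (I.from i))
        (λ i → trans (cong I.to (element-≡ (strictlyInverseˡ _))) (I.strictlyInverseˡ i))
        (λ (x , p) → element-≡ (trans (cong (from ∘ proj₁) (I.strictlyInverseʳ _)) (strictlyInverseʳ x)))

      point : Fin c → Carrier
      point = proj₁ ∘ Inverse.from fixed-order

      point-fixed : ∀ i → Fr d (point i) ≡ point i
      point-fixed i = toWitness (proj₂ (Inverse.from fixed-order i))

      point-surjective : ∀ {x} → Fr d x ≡ x → ∃ λ i → x ≡ point i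
      point-surjective {x} Fx≡x = _ , sym (cong proj₁ (Inverse.strictlyInverseʳ fixed-order (x , fromWitness Fx≡x)))

      point-injective : Injective _≡_ _≡_ point
      point-injective {i} {j} eq = trans (sym (Inverse.strictlyInverseˡ fixed-order i))
        (trans (cong (Inverse.to fixed-order) (element-≡ eq)) (Inverse.strictlyInverseˡ fixed-order j))

    private
      -- The fixed points of F^d are roots of X^(q^d) - X.
      c≤ : c ≤ q ^ d
      c≤ = ℕₚ.≮⇒≥ λ q^d<c → monic-root-bound (monic-X^-X (2≤q^ 1≤d)) (λ i → point (inject≤ i q^d<c))
        (Finₚ.inject≤-injective q^d<c q^d<c _ _ ∘ point-injective)
        (λ i → x≈y⇒x∙y⁻¹≈ε (trans (sym (Fr-^ d _)) (point-fixed _)))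

      -- With m = (j + 1) d, the trace maps L to the fixed points of F^d
      -- and has degree q^(j d), so ∏ (trace - z) over these fixed points z
      -- vanishes on L.
      ≤c : ∀ j → m ≡ j ℕ.* d → q ^ d ≤ c
      ≤c zero    m≡0    = ⊥-elim (ℕₚ.<⇒≢ 1≤m (sym m≡0))
      ≤c (suc j) m≡d+jd =
        -- Vanishing on L forces q^m ≤ c q^(j d), and q^m = q^d q^(j d), so the common factor can be
        -- cancelled.
        ℕₚ.*-cancelʳ-≤ (q ^ d) c (q ^ (j ℕ.* d)) {{ℕ.>-nonZero (ℕₚ.m^n>0 q (j ℕ.* d))}}
          (ℕₚ.≤-trans (ℕₚ.≤-reflexive (trans (sym (ℕₚ.^-distribˡ-+-* q d (j ℕ.* d))) (cong (q ^_) (sym m≡d+jd))))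
            (monic-vanishing (∏-minus-monic point (ℕₚ.m^n>0 q (j ℕ.* d)) (trace-monic d 1≤d j))
              λ y → let i , eq = point-surjective (trace-fixed y) in ∏-minus-zero point i eq))
        where
        trace-fixed : ∀ y → Fr d (trace d 1≤d j y) ≡ trace d 1≤d j y
        trace-fixed y = ∙-cancelʳ y _ _ (begin
          Fr d (trace d 1≤d j y) + y               ≡⟨ Fr-trace d 1≤d j y ⟩
          Fr (suc j ℕ.* d) y + trace d 1≤d j y     ≡⟨ cong (λ k → Fr k y + trace d 1≤d j y) m≡d+jd ⟨
          Fr m y + trace d 1≤d j y                 ≡⟨ cong (_+ trace d 1≤d j y) (Fr-order y) ⟩
          y + trace d 1≤d j y                      ≡⟨ +-comm _ _ ⟩
          trace d 1≤d j y + y                      ∎)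

    fixedSubfield : Subfield L (q ^ d)
    fixedSubfield = record
      { member = fixedᵇ d
      ; 0-closed = fromWitness (trans (cong (Fr d) (sym 0#-homo)) (trans (Fr-⟦⟧ d _) 0#-homo))
      ; 1-closed = fromWitness Fr-one
      ; +-closed = λ p r → fromWitness (trans (Fr-+ d _ _) (cong₂ _+_ (toWitness p) (toWitness r)))
      ; *-closed = λ p r → fromWitness (trans (Fr-* d _ _) (cong₂ _*_ (toWitness p) (toWitness r)))
      ; neg-closed = λ p → fromWitness (trans (Fr-neg d _) (cong -_ (toWitness p)))
      ; inv-closed = λ p xy≡1 → fromWitness (inverse-fixed (toWitness p) xy≡1)
      ; order = subst (λ r → (∃ (T ∘ fixedᵇ d)) ↔ Fin r) (ℕₚ.≤-antisym c≤ (≤c (ℕ∣.quotient d∣m) (ℕ∣._∣_.equality d∣m))) fixed-order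
      }
      where
      open RingMorphisms.IsRingHomomorphism (_↪_.isRingHomomorphism ι) using (0#-homo; 1#-homo)

      Fr-one : Fr d 1# ≡ 1#
      Fr-one = trans (cong (Fr d) (sym 1#-homo)) (trans (Fr-⟦⟧ d _) 1#-homo)

      inverse-fixed : ∀ {x y} → Fr d x ≡ x → x * y ≡ 1# → Fr d y ≡ y
      inverse-fixed {x} {y} Fx≡x xy≡1 = *-cancelʳ x≢0 (begin
        Fr d y * x         ≡⟨ cong (Fr d y *_) Fx≡x ⟨
        Fr d y * Fr d x    ≡⟨ Fr-* d y x ⟨
        Fr d (y * x)       ≡⟨ cong (Fr d) (trans (*-comm y x) xy≡1) ⟩
        Fr d 1#            ≡⟨ Fr-one ⟩
        1#                 ≡⟨ trans (*-comm y x) xy≡1 ⟨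
        y * x              ∎)
        where
        x≢0 : x ≢ 0#
        x≢0 x≡0 = 0≢1 (trans (sym (zeroˡ y)) (trans (cong (_* y) (sym x≡0)) xy≡1))

    fixed⇒InSubfield : ∀ {x} → Fr d x ≡ x → InSubfield L (q ^ d) x
    fixed⇒InSubfield Fx≡x = fixedSubfield , fromWitness Fx≡x

-- Polynomials

module Polynomials {q} (K : FiniteField q) where
  open FiniteField K
  open Fermat K using (_≟_; *-nonzero)
  open CommutativeRing commutativeRing
    using ( commutativeSemiring; *-assoc; *-comm; *-identityʳ; zeroˡ; zeroʳ; distribʳ
          ; +-identityˡ; +-identityʳ; -‿inverseʳ)
  open RingSolver commutativeSemiring using (solve; _:=_; _:+_)
  open RawSemiringDefinitions (polyRawSemiring K) using (Irreducible) renaming (_∣_ to _∣ᵖ_) public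
  open ≡-Reasoning

  infix 4 _≈ᵖ_
  _≈ᵖ_ : Poly K → Poly K → Set
  p ≈ᵖ r = ∀ i → coeff K p i ≡ coeff K r i

  coeff-add : ∀ p r i → coeff K (addPoly K p r) i ≡ coeff K p i + coeff K r i
  coeff-add []      r       i       = sym (+-identityˡ _)
  coeff-add (a ∷ p) []      i       = sym (+-identityʳ _)
  coeff-add (a ∷ p) (b ∷ r) zero    = refl
  coeff-add (a ∷ p) (b ∷ r) (suc i) = coeff-add p r i

  coeff-map : ∀ c p i → coeff K (List.map (c *_) p) i ≡ c * coeff K p i
  coeff-map c []      i       = sym (zeroʳ c)
  coeff-map c (a ∷ p) zero    = refl
  coeff-map c (a ∷ p) (suc i) = coeff-map c p i

  coeff-mul : ∀ a g h i → coeff K (mulPoly K (a ∷ g) h) i ≡ a * coeff K h i + coeff K (0# ∷ mulPoly K g h) i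
  coeff-mul a g h i = trans (coeff-add (List.map (a *_) h) _ i) (cong (_+ coeff K (0# ∷ mulPoly K g h) i) (coeff-map a h i))

  Below : ℕ → Poly K → Set
  Below d p = ∀ i → d ≤ i → coeff K p i ≡ 0#

  infix 5 _,ᵈ_
  -- Trailing zeros make the length of the list useless as a degree, so the degree is a relation;
  -- the zero polynomial has none.
  record HasDegree (p : Poly K) (d : ℕ) : Set where
    constructor _,ᵈ_
    field
      lead≢0  : coeff K p d ≢ 0#
      bounded : Below (suc d) p

  degree? : ∀ p → p ≈ᵖ [] ⊎ ∃ (HasDegree p)
  degree? [] = inj₁ λ _ → refl
  degree? (a ∷ p) with degree? p | a ≟ 0#
  ... | inj₂ (d , lead ,ᵈ below) | _      = inj₂ (suc d , lead ,ᵈ λ { (suc i) (s≤s d<i) → below i d<i })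
  ... | inj₁ p≈0                | yes a≡0 = inj₁ λ { zero → a≡0 ; (suc i) → p≈0 i }
  ... | inj₁ p≈0                | no a≢0  = inj₂ (0 , a≢0 ,ᵈ λ { (suc i) _ → p≈0 i })

  degree-below : ∀ {p d e} → HasDegree p d → Below e p → d < e
  degree-below (lead ,ᵈ _) below = ℕₚ.≰⇒> λ e≤d → lead (below _ e≤d)

  degree-unique : ∀ {p d e} → HasDegree p d → HasDegree p e → d ≡ e
  degree-unique D@(_ ,ᵈ below) E@(_ ,ᵈ below′) =
    ℕₚ.≤-antisym (ℕₚ.≤-pred (degree-below D below′)) (ℕₚ.≤-pred (degree-below E below))

  degree-resp : ∀ {p r : Poly K} {d} → p ≈ᵖ r → HasDegree p d → HasDegree r d
  degree-resp p≈r (lead ,ᵈ below) = (λ eq → lead (trans (p≈r _) eq)) ,ᵈ λ i d<i → trans (sym (p≈r i)) (below i d<i)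

  degree≉0 : ∀ {p d} → HasDegree p d → ¬ p ≈ᵖ []
  degree≉0 (lead ,ᵈ _) p≈0 = lead (p≈0 _)

  mul-zeroˡ : ∀ g h → g ≈ᵖ [] → mulPoly K g h ≈ᵖ []
  mul-zeroˡ []      h g≈0 i = refl
  mul-zeroˡ (a ∷ g) h g≈0 i = begin
    coeff K (mulPoly K (a ∷ g) h) i                         ≡⟨ coeff-mul a g h i ⟩
    a * coeff K h i + coeff K (0# ∷ mulPoly K g h) i        ≡⟨ cong₂ _+_ (cong (_* coeff K h i) (g≈0 0)) (tail i) ⟩
    0# * coeff K h i + 0#                                   ≡⟨ +-identityʳ _ ⟩
    0# * coeff K h i                                        ≡⟨ zeroˡ _ ⟩
    0#                                                      ∎
    where
    tail : ∀ i → coeff K (0# ∷ mulPoly K g h) i ≡ 0#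
    tail zero    = refl
    tail (suc i) = mul-zeroˡ g h (g≈0 ∘ suc) i

  mul-zeroʳ : ∀ g h → h ≈ᵖ [] → mulPoly K g h ≈ᵖ []
  mul-zeroʳ []      h h≈0 i = refl
  mul-zeroʳ (a ∷ g) h h≈0 i = begin
    coeff K (mulPoly K (a ∷ g) h) i                         ≡⟨ coeff-mul a g h i ⟩
    a * coeff K h i + coeff K (0# ∷ mulPoly K g h) i        ≡⟨ cong₂ _+_ (cong (a *_) (h≈0 i)) (tail i) ⟩
    a * 0# + 0#                                             ≡⟨ +-identityʳ _ ⟩
    a * 0#                                                  ≡⟨ zeroʳ a ⟩
    0#                                                      ∎
    where
    tail : ∀ i → coeff K (0# ∷ mulPoly K g h) i ≡ 0#
    tail zero    = refl
    tail (suc i) = mul-zeroʳ g h h≈0 i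

  -- Only upper bounds are assumed, so the induction can strip coefficients off g without tracking
  -- whether a leading coefficient vanishes; `degree-mul` brings that in afterwards.
  leading-mul : ∀ a b g h → Below (suc a) g → Below (suc b) h →
                coeff K (mulPoly K g h) (a ℕ.+ b) ≡ coeff K g a * coeff K h b ×
                Below (suc (a ℕ.+ b)) (mulPoly K g h)
  leading-mul a b [] h g< h< = sym (zeroˡ _) , λ _ _ → refl
  leading-mul zero b (c ∷ g) h g< h< = scaled b , λ i b<i →
    trans (scaled i) (trans (cong (c *_) (h< i b<i)) (zeroʳ c))
    where
    tail : ∀ i → coeff K (0# ∷ mulPoly K g h) i ≡ 0#
    tail zero    = refl
    tail (suc i) = mul-zeroˡ g h (λ j → g< (suc j) (s≤s z≤n)) i
    scaled : ∀ i → coeff K (mulPoly K (c ∷ g) h) i ≡ c * coeff K h i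
    scaled i = trans (coeff-mul c g h i) (trans (cong (λ z → c * coeff K h i + z) (tail i)) (+-identityʳ _))
  leading-mul (suc a) b (c ∷ g) h g< h< =
    trans (high (a ℕ.+ b) (ℕₚ.m≤n+m b a)) (proj₁ IH) ,
    λ { (suc i) (s≤s a+b<i) → trans (high i (ℕₚ.≤-trans (ℕₚ.m≤n+m b a) (ℕₚ.<⇒≤ a+b<i))) (proj₂ IH i a+b<i) }
    where
    IH = leading-mul a b g h (λ i a<i → g< (suc i) (s≤s a<i)) h<
    high : ∀ i → b ≤ i → coeff K (mulPoly K (c ∷ g) h) (suc i) ≡ coeff K (mulPoly K g h) i
    high i b≤i = begin
      coeff K (mulPoly K (c ∷ g) h) (suc i)                    ≡⟨ coeff-mul c g h (suc i) ⟩
      c * coeff K h (suc i) + coeff K (mulPoly K g h) i        ≡⟨ cong (λ z → c * z + coeff K (mulPoly K g h) i) (h< (suc i) (s≤s b≤i)) ⟩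
      c * 0# + coeff K (mulPoly K g h) i                       ≡⟨ cong (_+ coeff K (mulPoly K g h) i) (zeroʳ c) ⟩
      0# + coeff K (mulPoly K g h) i                           ≡⟨ +-identityˡ _ ⟩
      coeff K (mulPoly K g h) i                                ∎

  degree-mul : ∀ {g h a b} → HasDegree g a → HasDegree h b → HasDegree (mulPoly K g h) (a ℕ.+ b)
  degree-mul {g} {h} {a} {b} (g-lead ,ᵈ g<) (h-lead ,ᵈ h<) =
    let eq , below = leading-mul a b g h g< h< in (λ z → *-nonzero g-lead h-lead (trans (sym eq) z)) ,ᵈ below

  degree-monic : ∀ {k} (v : Vec Carrier k) → HasDegree (monic K v) k
  degree-monic []      = (λ 1≡0 → 0≢1 (sym 1≡0)) ,ᵈ λ { (suc i) _ → refl }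
  degree-monic (a ∷ v) = let lead ,ᵈ below = degree-monic v in lead ,ᵈ λ { (suc i) (s≤s k<i) → below i k<i }

  X^ : ℕ → Poly K
  X^ zero    = 1# ∷ []
  X^ (suc n) = 0# ∷ X^ n

  X^_-X : ℕ → Poly K
  X^ n -X = addPoly K (X^ n) (0# ∷ - 1# ∷ [])

  degree-X^-X : ∀ {n} → 2 ≤ n → HasDegree (X^ n -X) n
  degree-X^-X {suc (suc n)} (s≤s (s≤s _)) =
    let lead , below = degree-X^ n in
    (λ eq → lead (trans (sym (high n)) eq)) ,ᵈ λ { (suc (suc i)) (s≤s (s≤s n<i)) → trans (high i) (below i n<i) }
    where
    high : ∀ i → coeff K (X^ (suc (suc n)) -X) (suc (suc i)) ≡ coeff K (X^ n) i
    high i = trans (coeff-add (X^ n) [] i) (+-identityʳ _)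

    degree-X^ : ∀ n → coeff K (X^ n) n ≢ 0# × Below (suc n) (X^ n)
    degree-X^ zero    = (λ 1≡0 → 0≢1 (sym 1≡0)) , λ { (suc i) _ → refl }
    degree-X^ (suc n) = let lead , below = degree-X^ n in lead , λ { (suc i) (s≤s n<i) → below i n<i }

  -- Division is done on the tail first. If its remainder r has degree below d, then a + X r has
  -- degree at most d, and a single multiple of u removes the coefficient at d.
  divide-by : ∀ {u d} → HasDegree u d → ∀ p → ∃₂ λ h r → p ≈ᵖ addPoly K (mulPoly K h u) r × Below d r
  divide-by {u} {d} (lead ,ᵈ u<) []      = [] , [] , (λ _ → refl) , λ _ _ → refl
  divide-by {u} {d} (lead ,ᵈ u<) (a ∷ p) with divide-by (lead ,ᵈ u<) p
  ... | h , r , p≈ , r< = (c ∷ h) , r′ , eq , below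
    where
    u⁻¹ = proj₁ (invertible _ lead)
    s   = a ∷ r
    c   = coeff K s d * u⁻¹
    r′  = addPoly K s (List.map (- c *_) u)

    r′-coeff : ∀ i → coeff K r′ i ≡ coeff K s i + - c * coeff K u i
    r′-coeff i = trans (coeff-add s (List.map (- c *_) u) i) (cong (λ z → coeff K s i + z) (coeff-map (- c) u i))

    cancel : ∀ i → c * coeff K u i + - c * coeff K u i ≡ 0#
    cancel i = trans (sym (distribʳ _ c (- c))) (trans (cong (_* coeff K u i) (-‿inverseʳ c)) (zeroˡ _))

    shifted : ∀ i → coeff K (a ∷ p) i ≡ coeff K (0# ∷ mulPoly K h u) i + coeff K s i
    shifted zero    = sym (+-identityˡ a)
    shifted (suc i) = trans (p≈ i) (coeff-add (mulPoly K h u) r i)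

    eq : a ∷ p ≈ᵖ addPoly K (mulPoly K (c ∷ h) u) r′
    eq i = sym (begin
      coeff K (addPoly K (mulPoly K (c ∷ h) u) r′) i             ≡⟨ coeff-add (mulPoly K (c ∷ h) u) r′ i ⟩
      coeff K (mulPoly K (c ∷ h) u) i + coeff K r′ i             ≡⟨ cong₂ _+_ (coeff-mul c h u i) (r′-coeff i) ⟩
      (c * uᵢ + t) + (sᵢ + - c * uᵢ)                             ≡⟨ solve 4 (λ x t s y → (x :+ t) :+ (s :+ y) := (x :+ y) :+ (t :+ s)) refl (c * uᵢ) t sᵢ (- c * uᵢ) ⟩
      (c * uᵢ + - c * uᵢ) + (t + sᵢ)                             ≡⟨ cong (_+ (t + sᵢ)) (cancel i) ⟩
      0# + (t + sᵢ)                                              ≡⟨ +-identityˡ _ ⟩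
      t + sᵢ                                                     ≡⟨ shifted i ⟨
      coeff K (a ∷ p) i                                          ∎)
      where
      uᵢ = coeff K u i
      sᵢ = coeff K s i
      t  = coeff K (0# ∷ mulPoly K h u) i

    s< : ∀ i → d < i → coeff K s i ≡ 0#
    s< (suc i) (s≤s d≤i) = r< i d≤i

    at-d : c * coeff K u d ≡ coeff K s d
    at-d = begin
      coeff K s d * u⁻¹ * coeff K u d       ≡⟨ *-assoc _ _ _ ⟩
      coeff K s d * (u⁻¹ * coeff K u d)     ≡⟨ cong (coeff K s d *_) (trans (*-comm _ _) (proj₂ (invertible _ lead))) ⟩
      coeff K s d * 1#                      ≡⟨ *-identityʳ _ ⟩
      coeff K s d                           ∎

    below : Below d r′
    below i d≤i with ℕₚ.m≤n⇒m<n∨m≡n d≤i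
    ... | inj₂ refl = trans (r′-coeff d) (trans (cong (_+ - c * coeff K u d) (sym at-d)) (cancel d))
    ... | inj₁ d<i  = trans (r′-coeff i) (trans (cong₂ _+_ (s< i d<i) (trans (cong (- c *_) (u< i d<i)) (zeroʳ _))) (+-identityˡ 0#))

  degree-0⇒unit : ∀ {h} → HasDegree h 0 → h ∣ᵖ (1# ∷ [])
  degree-0⇒unit {h} (lead ,ᵈ below) = let c⁻¹ , cc⁻¹≡1 = invertible _ lead in
    (c⁻¹ ∷ []) RawMagmaDefinitions., λ
      { zero    → trans (coeff-mul c⁻¹ [] h 0) (trans (+-identityʳ _) (trans (*-comm _ _) cc⁻¹≡1))
      ; (suc i) → trans (coeff-mul c⁻¹ [] h (suc i))
          (trans (+-identityʳ _) (trans (cong (c⁻¹ *_) (below (suc i) (s≤s z≤n))) (zeroʳ _))) }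

  unit⇒degree-0 : ∀ {h d} → h ∣ᵖ (1# ∷ []) → HasDegree h d → d ≡ 0
  unit⇒degree-0 {h} (w RawMagmaDefinitions., wh≈1) D with degree? w
  ... | inj₁ w≈0     = ⊥-elim (0≢1 (trans (sym (mul-zeroˡ w h w≈0 0)) (wh≈1 0)))
  ... | inj₂ (a , A) = ℕₚ.m+n≡0⇒n≡0 a (degree-unique (degree-resp {mulPoly K w h} {1# ∷ []} wh≈1 (degree-mul A D)) (degree-monic []))

  fit : ∀ k → Poly K → Vec Carrier k
  fit zero    _       = []
  fit (suc k) []      = 0# ∷ fit k []
  fit (suc k) (a ∷ p) = a ∷ fit k p

  fit-≈ : ∀ k p → Below k p → toList (fit k p) ≈ᵖ p
  fit-≈ zero    p       p< i       = sym (p< i z≤n)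
  fit-≈ (suc k) []      p< zero    = refl
  fit-≈ (suc k) []      p< (suc i) = fit-≈ k [] (λ _ _ → refl) i
  fit-≈ (suc k) (a ∷ p) p< zero    = refl
  fit-≈ (suc k) (a ∷ p) p< (suc i) = fit-≈ k p (λ j k≤j → p< (suc j) (s≤s k≤j)) i

  below-toList : ∀ {k} (v : Vec Carrier k) → Below k (toList v)
  below-toList []      i       _         = refl
  below-toList (a ∷ v) (suc i) (s≤s k≤i) = below-toList v i k≤i

  toList≈0 : ∀ {k} (v : Vec Carrier k) → toList v ≈ᵖ [] → v ≡ replicate k 0#
  toList≈0 []      _   = refl
  toList≈0 (a ∷ v) v≈0 = cong₂ _∷_ (v≈0 0) (toList≈0 v (v≈0 ∘ suc))

-- A vector space with an endomorphism R, as a module over the polynomials.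
record Operator {q} (K : FiniteField q) : Set₁ where
  private
    module K = FiniteField K
  infixr 6 _⊕_
  infixr 7 _•_
  field
    V          : Set
    _⊕_        : V → V → V
    𝟘          : V
    _•_        : K.Carrier → V → V
    R          : V → V
    ⊕-assoc    : ∀ u v w → (u ⊕ v) ⊕ w ≡ u ⊕ (v ⊕ w)
    ⊕-comm     : ∀ u v → u ⊕ v ≡ v ⊕ u
    ⊕-identity : ∀ v → 𝟘 ⊕ v ≡ v
    •-distribʳ : ∀ a b v → (a K.+ b) • v ≡ a • v ⊕ b • v
    •-distribˡ : ∀ a u v → a • (u ⊕ v) ≡ a • u ⊕ a • v
    •-assoc    : ∀ a b v → (a K.* b) • v ≡ a • b • v
    1•         : ∀ v → K.1# • v ≡ v
    0•         : ∀ v → K.0# • v ≡ 𝟘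
    R-⊕        : ∀ u v → R (u ⊕ v) ≡ R u ⊕ R v
    R-•        : ∀ a v → R (a • v) ≡ a • R v

  •-𝟘 : ∀ a → a • 𝟘 ≡ 𝟘
  •-𝟘 a = trans (cong (a •_) (sym (0• 𝟘))) (trans (sym (•-assoc a K.0# 𝟘))
    (trans (cong (_• 𝟘) (CommutativeRing.zeroʳ K.commutativeRing a)) (0• 𝟘)))

  R-𝟘 : R 𝟘 ≡ 𝟘
  R-𝟘 = trans (cong R (sym (0• 𝟘))) (trans (R-• K.0# 𝟘) (0• (R 𝟘)))

  ⊕-identityʳ : ∀ v → v ⊕ 𝟘 ≡ v
  ⊕-identityʳ v = trans (⊕-comm v 𝟘) (⊕-identity v)

  ⊕-interchange : ∀ u v w x → (u ⊕ v) ⊕ (w ⊕ x) ≡ (u ⊕ w) ⊕ (v ⊕ x)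
  ⊕-interchange u v w x = begin
    (u ⊕ v) ⊕ (w ⊕ x)    ≡⟨ ⊕-assoc u v _ ⟩
    u ⊕ (v ⊕ (w ⊕ x))    ≡⟨ cong (u ⊕_) (⊕-assoc v w x) ⟨
    u ⊕ ((v ⊕ w) ⊕ x)    ≡⟨ cong (λ y → u ⊕ (y ⊕ x)) (⊕-comm v w) ⟩
    u ⊕ ((w ⊕ v) ⊕ x)    ≡⟨ cong (u ⊕_) (⊕-assoc w v x) ⟩
    u ⊕ (w ⊕ (v ⊕ x))    ≡⟨ ⊕-assoc u w _ ⟨
    (u ⊕ w) ⊕ (v ⊕ x)    ∎
    where
    open ≡-Reasoning

-- Polynomials in an operator and annihilators of vectors

module Action {q} (K : FiniteField q) (O : Operator K) where
  open Operator O
  open Polynomials K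
  open ≡-Reasoning
  private
    module K = FiniteField K
    module KR = CommutativeRing K.commutativeRing

  -- This is p(R) v in Horner form. R will be multiplication by X on residues modulo w, and
  -- multiplication by a point x on L.
  act : Poly K → V → V
  act []      v = 𝟘
  act (a ∷ p) v = a • v ⊕ R (act p v)

  act-⊕ : ∀ p u v → act p (u ⊕ v) ≡ act p u ⊕ act p v
  act-⊕ []      u v = sym (⊕-identity 𝟘)
  act-⊕ (a ∷ p) u v = begin
    a • (u ⊕ v) ⊕ R (act p (u ⊕ v))                   ≡⟨ cong₂ _⊕_ (•-distribˡ a u v) (trans (cong R (act-⊕ p u v)) (R-⊕ _ _)) ⟩
    (a • u ⊕ a • v) ⊕ (R (act p u) ⊕ R (act p v))     ≡⟨ ⊕-interchange _ _ _ _ ⟩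
    (a • u ⊕ R (act p u)) ⊕ (a • v ⊕ R (act p v))     ∎

  act-R : ∀ p v → act p (R v) ≡ R (act p v)
  act-R []      v = sym R-𝟘
  act-R (a ∷ p) v = trans (cong₂ _⊕_ (sym (R-• a v)) (cong R (act-R p v))) (sym (R-⊕ _ _))

  act-• : ∀ p c v → act p (c • v) ≡ c • act p v
  act-• []      c v = sym (•-𝟘 c)
  act-• (a ∷ p) c v = trans
    (cong₂ _⊕_ (trans (sym (•-assoc a c v)) (trans (cong (_• v) (KR.*-comm a c)) (•-assoc c a v)))
               (trans (cong R (act-• p c v)) (R-• c _)))
    (sym (•-distribˡ c _ _))

  act-𝟘 : ∀ p → act p 𝟘 ≡ 𝟘
  act-𝟘 p = trans (cong (act p) (sym (0• 𝟘))) (trans (act-• p _ 𝟘) (0• _))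

  act-zero : ∀ p v → p ≈ᵖ [] → act p v ≡ 𝟘
  act-zero []      v _   = refl
  act-zero (a ∷ p) v p≈0 = begin
    a • v ⊕ R (act p v)    ≡⟨ cong₂ _⊕_ (trans (cong (_• v) (p≈0 0)) (0• v)) (cong R (act-zero p v (p≈0 ∘ suc))) ⟩
    𝟘 ⊕ R 𝟘                ≡⟨ ⊕-identity _ ⟩
    R 𝟘                    ≡⟨ R-𝟘 ⟩
    𝟘                      ∎

  act-≈ : ∀ p r v → p ≈ᵖ r → act p v ≡ act r v
  act-≈ []      r       v p≈r = sym (act-zero r v (sym ∘ p≈r))
  act-≈ (a ∷ p) []      v p≈r = act-zero (a ∷ p) v p≈r
  act-≈ (a ∷ p) (b ∷ r) v p≈r = cong₂ _⊕_ (cong (_• v) (p≈r 0)) (cong R (act-≈ p r v (p≈r ∘ suc)))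

  act-add : ∀ p r v → act (addPoly K p r) v ≡ act p v ⊕ act r v
  act-add []      r       v = sym (⊕-identity _)
  act-add (a ∷ p) []      v = sym (⊕-identityʳ _)
  act-add (a ∷ p) (b ∷ r) v = begin
    (a K.+ b) • v ⊕ R (act (addPoly K p r) v)         ≡⟨ cong₂ _⊕_ (•-distribʳ a b v) (trans (cong R (act-add p r v)) (R-⊕ _ _)) ⟩
    (a • v ⊕ b • v) ⊕ (R (act p v) ⊕ R (act r v))     ≡⟨ ⊕-interchange _ _ _ _ ⟩
    (a • v ⊕ R (act p v)) ⊕ (b • v ⊕ R (act r v))     ∎

  act-scale : ∀ c p v → act (List.map (c K.*_) p) v ≡ c • act p v
  act-scale c []      v = sym (•-𝟘 c)
  act-scale c (a ∷ p) v = trans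
    (cong₂ _⊕_ (•-assoc c a v) (trans (cong R (act-scale c p v)) (R-• c _))) (sym (•-distribˡ c _ _))

  act-mul : ∀ g h v → act (mulPoly K g h) v ≡ act g (act h v)
  act-mul []      h v = refl
  act-mul (a ∷ g) h v = begin
    act (addPoly K (List.map (a K.*_) h) (K.0# ∷ mulPoly K g h)) v    ≡⟨ act-add (List.map (a K.*_) h) _ v ⟩
    act (List.map (a K.*_) h) v ⊕ (K.0# • v ⊕ R (act (mulPoly K g h) v))
      ≡⟨ cong₂ _⊕_ (act-scale a h v) (cong₂ _⊕_ (0• v) (cong R (act-mul g h v))) ⟩
    a • act h v ⊕ (𝟘 ⊕ R (act g (act h v)))                           ≡⟨ cong (a • act h v ⊕_) (⊕-identity _) ⟩
    a • act h v ⊕ R (act g (act h v))                                 ∎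

  -- Polynomials in one operator commute because R commutes with each of them. Commutativity and
  -- associativity of the multiplication of residues come from here.
  act-comm : ∀ p r v → act p (act r v) ≡ act r (act p v)
  act-comm []      r v = sym (act-𝟘 r)
  act-comm (a ∷ p) r v = begin
    a • act r v ⊕ R (act p (act r v))        ≡⟨ cong₂ _⊕_ (sym (act-• r a v)) (cong R (act-comm p r v)) ⟩
    act r (a • v) ⊕ R (act r (act p v))      ≡⟨ cong (act r (a • v) ⊕_) (act-R r _) ⟨
    act r (a • v) ⊕ act r (R (act p v))      ≡⟨ act-⊕ r _ _ ⟨
    act r (a • v ⊕ R (act p v))              ∎

  annihilates-remainder : ∀ p h u r v → p ≈ᵖ addPoly K (mulPoly K h u) r → act p v ≡ 𝟘 → act u v ≡ 𝟘 → act r v ≡ 𝟘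
  annihilates-remainder p h u r v p≈ pv≡0 uv≡0 = begin
    act r v                              ≡⟨ ⊕-identity _ ⟨
    𝟘 ⊕ act r v                          ≡⟨ cong (_⊕ act r v) (trans (cong (act h) uv≡0) (act-𝟘 h)) ⟨
    act h (act u v) ⊕ act r v            ≡⟨ cong (_⊕ act r v) (act-mul h u v) ⟨
    act (mulPoly K h u) v ⊕ act r v      ≡⟨ act-add (mulPoly K h u) r v ⟨
    act (addPoly K (mulPoly K h u) r) v  ≡⟨ act-≈ p (addPoly K (mulPoly K h u) r) v p≈ ⟨
    act p v                              ≡⟨ pv≡0 ⟩
    𝟘                                    ∎

  constant-annihilator : ∀ u v → HasDegree u 0 → act u v ≡ 𝟘 → v ≡ 𝟘
  constant-annihilator []      v (lead ,ᵈ _)     _    = ⊥-elim (lead refl)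
  constant-annihilator (c ∷ u) v (lead ,ᵈ below) uv≡0 = let c⁻¹ , cc⁻¹≡1 = K.invertible c lead in begin
    v                              ≡⟨ 1• v ⟨
    K.1# • v                       ≡⟨ cong (_• v) (trans (KR.*-comm _ _) cc⁻¹≡1) ⟨
    (c⁻¹ K.* c) • v                ≡⟨ •-assoc c⁻¹ c v ⟩
    c⁻¹ • c • v                    ≡⟨ cong (c⁻¹ •_) (⊕-identityʳ _) ⟨
    c⁻¹ • (c • v ⊕ 𝟘)              ≡⟨ cong (λ w → c⁻¹ • (c • v ⊕ w)) (trans (cong R (act-zero u v (λ i → below (suc i) (s≤s z≤n)))) R-𝟘) ⟨
    c⁻¹ • (c • v ⊕ R (act u v))    ≡⟨ cong (c⁻¹ •_) uv≡0 ⟩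
    c⁻¹ • 𝟘                        ≡⟨ •-𝟘 c⁻¹ ⟩
    𝟘                              ∎

  -- Dividing the irreducible p by an annihilator r of v of smaller positive
  -- degree leaves a nonzero remainder, which again annihilates v.
  minimal-annihilator : ∀ {p k} → Irreducible p → HasDegree p k → ∀ {v} → v ≢ 𝟘 → act p v ≡ 𝟘 →
                        ∀ {r d} → HasDegree r d → d < k → act r v ≢ 𝟘
  minimal-annihilator {p} {k} irr p-deg {v} v≢0 pv≡0 {d = d} = descent (suc d) ℕₚ.≤-refl
    where
    open RawSemiringDefinitions.Irreducible irr
    descent : ∀ e {r d} → d < e → HasDegree r d → d < k → act r v ≢ 𝟘
    descent (suc e) {r} {zero}  d<e r-deg d<k rv≡0 = v≢0 (constant-annihilator r v r-deg rv≡0)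
    descent (suc e) {r} {suc d} d<e r-deg d<k rv≡0 with divide-by r-deg p
    ... | h , s , p≈ , s< with degree? s
    ...   | inj₂ (d′ , s-deg) = descent e (ℕₚ.<-≤-trans d′<d (ℕₚ.≤-pred d<e)) s-deg (ℕₚ.<-trans d′<d d<k)
                                  (annihilates-remainder p h r s v p≈ pv≡0 rv≡0)
      where d′<d = degree-below s-deg s<
    -- Now p = h r with 0 < deg r < k. A unit h would give r the degree of p, and a unit r would
    -- have degree 0, so irreducibility is contradicted either way.
    ...   | inj₁ s≈0 = exact s≈0 (degree? h)
      where
      exact : s ≈ᵖ [] → h ≈ᵖ [] ⊎ ∃ (HasDegree h) → ⊥
      exact s≈0 h-deg? = case (h-deg? , split-∣1 {h} {r} p≈hr) of λ
        { (inj₁ h≈0 , _) → degree≉0 p-deg (λ i → trans (p≈hr i) (mul-zeroˡ h r h≈0 i))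
        ; (inj₂ (b , h-deg) , inj₁ h∣1) → ℕₚ.<⇒≢ d<k (sym (trans
            (degree-unique p-deg (degree-resp {mulPoly K h r} {p} (sym ∘ p≈hr) (degree-mul h-deg r-deg)))
            (cong (ℕ._+ suc d) (unit⇒degree-0 h∣1 h-deg))))
        ; (inj₂ _ , inj₂ r∣1) → case unit⇒degree-0 r∣1 r-deg of λ () }
        where
        p≈hr : p ≈ᵖ mulPoly K h r
        p≈hr i = trans (p≈ i) (trans (coeff-add (mulPoly K h r) s i)
          (trans (cong (λ z → coeff K (mulPoly K h r) i K.+ z) (s≈0 i)) (KR.+-identityʳ _)))

-- The field of polynomials modulo an irreducible one

-- If y were missed, punching it out of the codomain would leave an injection into a smaller finite
-- set.
injective⇒surjective : ∀ {n} (f : Fin n → Fin n) → Injective _≡_ _≡_ f → ∀ y → ∃ λ x → f x ≡ y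
injective⇒surjective {suc n} f f-inj y with Finₚ.any? (λ x → f x Finₚ.≟ y)
... | yes ∃x = ∃x
... | no ∄x  = ⊥-elim (ℕₚ.1+n≰n (Finₚ.injective⇒≤ {f = λ x → punchOut (y≢f x)}
  (λ eq → f-inj (Finₚ.punchOut-injective (y≢f _) (y≢f _) eq))))
  where
  y≢f : ∀ x → y ≢ f x
  y≢f x y≡fx = ∄x (x , sym y≡fx)

vec↔ : ∀ {A : Set} {q} → A ↔ Fin q → ∀ k → Vec A k ↔ Fin (q ^ k)
vec↔ e zero    = mk↔ₛ′ (λ _ → zero) (λ _ → []) (λ { zero → refl }) (λ { [] → refl })
vec↔ e (suc k) = ↔-sym Finₚ.*↔× ↔-∘ ((e ×-↔ vec↔ e k) ↔-∘ uncons↔)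
  where uncons↔ = mk↔ₛ′ Vec.uncons (λ (a , v) → a ∷ v) (λ _ → refl) (λ { (a ∷ v) → refl })

module Quotient {q} (K : FiniteField q) {k} (w : Vec (FiniteField.Carrier K) (suc k))
                (irreducible : Polynomials.Irreducible K (monic K w)) where
  open FiniteField K
  open Fermat K using (_≟_)
  open Polynomials K
  open CommutativeRing commutativeRing
    using ( commutativeSemiring; *-assoc; *-identityˡ; *-identityʳ; zeroˡ; zeroʳ; distribˡ; distribʳ
          ; +-identityˡ; +-identityʳ; +-assoc; +-comm; -‿inverseʳ)
  open RingSolver commutativeSemiring using (solve; _:=_; _:+_; _:*_)
  open ≡-Reasoning

  private
    infixr 6 _⊕_
    _⊕_ : ∀ {j} → Vec Carrier j → Vec Carrier j → Vec Carrier j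
    _⊕_ = zipWith _+_

    infixr 7 _•_
    _•_ : ∀ {j} → Carrier → Vec Carrier j → Vec Carrier j
    a • v = Vec.map (a *_) v

    𝟘 : ∀ {j} → Vec Carrier j
    𝟘 = replicate _ 0#

    initial : ∀ {j} → Vec Carrier (suc j) → Vec Carrier j
    initial {zero}  (x ∷ []) = []
    initial {suc j} (x ∷ v)  = x ∷ initial v

    final : ∀ {j} → Vec Carrier (suc j) → Carrier
    final {zero}  (x ∷ []) = x
    final {suc j} (x ∷ v)  = final v

    axpy : ∀ {j} → Carrier → Vec Carrier j → Vec Carrier j → Vec Carrier j
    axpy c = zipWith (λ s t → s + c * t)

    •-distribʳ : ∀ {j} a b (v : Vec Carrier j) → (a + b) • v ≡ a • v ⊕ b • v
    •-distribʳ a b []      = refl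
    •-distribʳ a b (x ∷ v) = cong₂ _∷_ (distribʳ x a b) (•-distribʳ a b v)

    •-distribˡ : ∀ {j} a (u v : Vec Carrier j) → a • (u ⊕ v) ≡ a • u ⊕ a • v
    •-distribˡ a []      []      = refl
    •-distribˡ a (x ∷ u) (y ∷ v) = cong₂ _∷_ (distribˡ a x y) (•-distribˡ a u v)

    •-assoc : ∀ {j} a b (v : Vec Carrier j) → (a * b) • v ≡ a • b • v
    •-assoc a b []      = refl
    •-assoc a b (x ∷ v) = cong₂ _∷_ (*-assoc a b x) (•-assoc a b v)

    1• : ∀ {j} (v : Vec Carrier j) → 1# • v ≡ v
    1• []      = refl
    1• (x ∷ v) = cong₂ _∷_ (*-identityˡ x) (1• v)

    0• : ∀ {j} (v : Vec Carrier j) → 0# • v ≡ 𝟘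
    0• []      = refl
    0• (x ∷ v) = cong₂ _∷_ (zeroˡ x) (0• v)

    •-𝟘 : ∀ j a → a • 𝟘 {j} ≡ 𝟘
    •-𝟘 j a = trans (Vecₚ.map-replicate (a *_) 0# j) (cong (replicate j) (zeroʳ a))

    initial-⊕ : ∀ {j} (u v : Vec Carrier (suc j)) → initial (u ⊕ v) ≡ initial u ⊕ initial v
    initial-⊕ (x ∷ [])        (y ∷ [])        = refl
    initial-⊕ (x ∷ u@(_ ∷ _)) (y ∷ v@(_ ∷ _)) = cong ((x + y) ∷_) (initial-⊕ u v)

    initial-• : ∀ {j} a (v : Vec Carrier (suc j)) → initial (a • v) ≡ a • initial v
    initial-• a (x ∷ [])        = refl
    initial-• a (x ∷ v@(_ ∷ _)) = cong ((a * x) ∷_) (initial-• a v)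

    final-⊕ : ∀ {j} (u v : Vec Carrier (suc j)) → final (u ⊕ v) ≡ final u + final v
    final-⊕ (x ∷ [])        (y ∷ [])        = refl
    final-⊕ (x ∷ u@(_ ∷ _)) (y ∷ v@(_ ∷ _)) = final-⊕ u v

    final-• : ∀ {j} a (v : Vec Carrier (suc j)) → final (a • v) ≡ a * final v
    final-• a (x ∷ [])        = refl
    final-• a (x ∷ v@(_ ∷ _)) = final-• a v

    axpy-⊕ : ∀ {j} c d (s s′ t : Vec Carrier j) → axpy (c + d) (s ⊕ s′) t ≡ axpy c s t ⊕ axpy d s′ t
    axpy-⊕ c d []      []        []      = refl
    axpy-⊕ c d (x ∷ s) (y ∷ s′) (z ∷ t) = cong₂ _∷_
      (solve 5 (λ c d x y z → (x :+ y) :+ (c :+ d) :* z := (x :+ c :* z) :+ (y :+ d :* z)) refl c d x y z)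
      (axpy-⊕ c d s s′ t)

    axpy-• : ∀ {j} a c (s t : Vec Carrier j) → axpy (a * c) (a • s) t ≡ a • axpy c s t
    axpy-• a c []      []      = refl
    axpy-• a c (x ∷ s) (z ∷ t) = cong₂ _∷_
      (solve 4 (λ a c x z → a :* x :+ a :* c :* z := a :* (x :+ c :* z)) refl a c x z) (axpy-• a c s t)

    axpy-0 : ∀ {j} (s t : Vec Carrier j) → axpy 0# s t ≡ s
    axpy-0 []      []      = refl
    axpy-0 (x ∷ s) (z ∷ t) = cong₂ _∷_ (trans (cong (λ y → x + y) (zeroˡ z)) (+-identityʳ x)) (axpy-0 s t)

    -- Multiplication by X modulo the monic polynomial w.
    R : Vec Carrier (suc k) → Vec Carrier (suc k)
    R v = axpy (final v) (0# ∷ initial v) (Vec.map -_ w)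

    R-⊕ : ∀ u v → R (u ⊕ v) ≡ R u ⊕ R v
    R-⊕ u v = trans (cong₂ (λ c s → axpy c s (Vec.map -_ w)) (final-⊕ u v) (cong₂ _∷_ (sym (+-identityˡ 0#)) (initial-⊕ u v)))
      (axpy-⊕ (final u) (final v) (0# ∷ initial u) (0# ∷ initial v) (Vec.map -_ w))

    R-• : ∀ a v → R (a • v) ≡ a • R v
    R-• a v = trans (cong₂ (λ c s → axpy c s (Vec.map -_ w)) (final-• a v) (cong₂ _∷_ (sym (zeroʳ a)) (initial-• a v)))
      (axpy-• a (final v) (0# ∷ initial v) (Vec.map -_ w))

  operator : Operator K
  operator = record
    { V = Vec Carrier (suc k) ; _⊕_ = _⊕_ ; 𝟘 = 𝟘 ; _•_ = _•_ ; R = R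
    ; ⊕-assoc = Vecₚ.zipWith-assoc +-assoc ; ⊕-comm = Vecₚ.zipWith-comm +-comm
    ; ⊕-identity = Vecₚ.zipWith-identityˡ +-identityˡ
    ; •-distribʳ = •-distribʳ ; •-distribˡ = •-distribˡ ; •-assoc = •-assoc
    ; 1• = 1• ; 0• = 0• ; R-⊕ = R-⊕ ; R-• = R-•
    }

  open Operator operator using (V; ⊕-assoc; ⊕-comm; ⊕-identity; ⊕-identityʳ; R-𝟘)
  open Action K operator

  private
    𝟙 : V
    𝟙 = 1# ∷ replicate k 0#

    fit-[] : ∀ j → fit j [] ≡ 𝟘
    fit-[] zero    = refl
    fit-[] (suc j) = cong (0# ∷_) (fit-[] j)

    fit-toList : ∀ {j} (v : Vec Carrier j) → fit j (toList v) ≡ v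
    fit-toList []      = refl
    fit-toList (x ∷ v) = cong (x ∷_) (fit-toList v)

    initial-fit : ∀ j p → initial (fit (suc j) p) ≡ fit j p
    initial-fit zero    []      = refl
    initial-fit zero    (a ∷ p) = refl
    initial-fit (suc j) []      = cong (0# ∷_) (initial-fit j [])
    initial-fit (suc j) (a ∷ p) = cong (a ∷_) (initial-fit j p)

    final-fit : ∀ j p → length p ≤ j → final (fit (suc j) p) ≡ 0#
    final-fit zero    []      _         = refl
    final-fit (suc j) []      _         = final-fit j [] z≤n
    final-fit (suc j) (a ∷ p) (s≤s p≤j) = final-fit j p p≤j

    a•𝟙⊕ : ∀ a x (v : Vec Carrier k) → a • 𝟙 ⊕ (x ∷ v) ≡ (a + x) ∷ v
    a•𝟙⊕ a x v = cong₂ _∷_ (cong (_+ x) (*-identityʳ a))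
      (trans (cong (_⊕ v) (•-𝟘 k a)) (Vecₚ.zipWith-identityˡ +-identityˡ v))

    -- Within this length nothing is reduced: the top coefficient is zero whenever R is applied, so
    -- R merely shifts.
    act-𝟙-fit : ∀ p → length p ≤ suc k → act p 𝟙 ≡ fit (suc k) p
    act-𝟙-fit []      _         = sym (fit-[] (suc k))
    act-𝟙-fit (a ∷ p) (s≤s p≤k) = begin
      a • 𝟙 ⊕ R (act p 𝟙)                                ≡⟨ cong (λ v → a • 𝟙 ⊕ R v) (act-𝟙-fit p (ℕₚ.m≤n⇒m≤1+n p≤k)) ⟩
      a • 𝟙 ⊕ R (fit (suc k) p)                          ≡⟨ cong₂ (λ c v → a • 𝟙 ⊕ axpy c (0# ∷ v) (Vec.map -_ w)) (final-fit k p p≤k) (initial-fit k p) ⟩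
      a • 𝟙 ⊕ axpy 0# (0# ∷ fit k p) (Vec.map -_ w)      ≡⟨ cong (a • 𝟙 ⊕_) (axpy-0 (0# ∷ fit k p) (Vec.map -_ w)) ⟩
      a • 𝟙 ⊕ (0# ∷ fit k p)                             ≡⟨ a•𝟙⊕ a 0# (fit k p) ⟩
      (a + 0#) ∷ fit k p                                 ≡⟨ cong (_∷ fit k p) (+-identityʳ a) ⟩
      a ∷ fit k p                                        ∎

    -- `𝟙` is a cyclic vector: every residue is a polynomial in R applied to it. As these
    -- polynomials commute, identities between them need checking only at `𝟙`.
    act-𝟙 : ∀ (v : V) → act (toList v) 𝟙 ≡ v
    act-𝟙 v = trans (act-𝟙-fit (toList v) (ℕₚ.≤-reflexive (Vecₚ.length-toList v))) (fit-toList v)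

    initial-∷ʳ : ∀ {j} (v : Vec Carrier j) c → initial (v ∷ʳ c) ≡ v
    initial-∷ʳ []          c = refl
    initial-∷ʳ (x ∷ [])    c = refl
    initial-∷ʳ (x ∷ y ∷ v) c = cong (x ∷_) (initial-∷ʳ (y ∷ v) c)

    final-∷ʳ : ∀ {j} (v : Vec Carrier j) c → final (v ∷ʳ c) ≡ c
    final-∷ʳ []          c = refl
    final-∷ʳ (x ∷ [])    c = refl
    final-∷ʳ (x ∷ y ∷ v) c = final-∷ʳ (y ∷ v) c

    axpy-neg : ∀ {j} (v : Vec Carrier j) → axpy 1# v (Vec.map -_ v) ≡ 𝟘
    axpy-neg []      = refl
    axpy-neg (x ∷ v) = cong₂ _∷_ (trans (cong (λ y → x + y) (*-identityˡ _)) (-‿inverseʳ x)) (axpy-neg v)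

    -- The copy u of the module parameter w can be split into head and tail while w stays inside R.
    -- Reducing the leading term subtracts w, which cancels the lower coefficients.
    monic-𝟙 : ∀ (u : Vec Carrier (suc k)) → u ≡ w → act (monic K u) 𝟙 ≡ 𝟘
    monic-𝟙 (a ∷ u) u≡w = begin
      a • 𝟙 ⊕ R (act (toList (u ∷ʳ 1#)) 𝟙)               ≡⟨ cong (λ v → a • 𝟙 ⊕ R v) (act-𝟙 (u ∷ʳ 1#)) ⟩
      a • 𝟙 ⊕ R (u ∷ʳ 1#)                                ≡⟨ cong₂ (λ c v → a • 𝟙 ⊕ axpy c (0# ∷ v) (Vec.map -_ w)) (final-∷ʳ u 1#) (initial-∷ʳ u 1#) ⟩
      a • 𝟙 ⊕ axpy 1# (0# ∷ u) (Vec.map -_ w)            ≡⟨ cong (λ v → a • 𝟙 ⊕ axpy 1# (0# ∷ u) (Vec.map -_ v)) u≡w ⟨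
      a • 𝟙 ⊕ (0# + 1# * - a ∷ axpy 1# u (Vec.map -_ u)) ≡⟨ a•𝟙⊕ a _ _ ⟩
      (a + (0# + 1# * - a)) ∷ axpy 1# u (Vec.map -_ u)   ≡⟨ cong₂ _∷_ (trans (cong (λ y → a + y) (trans (+-identityˡ _) (*-identityˡ _))) (-‿inverseʳ a)) (axpy-neg u) ⟩
      𝟘                                                  ∎

  act-monic : ∀ v → act (monic K w) v ≡ 𝟘
  act-monic v = begin
    act (monic K w) v                         ≡⟨ cong (act (monic K w)) (act-𝟙 v) ⟨
    act (monic K w) (act (toList v) 𝟙)        ≡⟨ act-comm (monic K w) (toList v) 𝟙 ⟩
    act (toList v) (act (monic K w) 𝟙)        ≡⟨ cong (act (toList v)) (monic-𝟙 w refl) ⟩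
    act (toList v) 𝟘                          ≡⟨ act-𝟘 (toList v) ⟩
    𝟘                                         ∎

  -- Every vector is annihilated by the irreducible polynomial, so no nonzero r of smaller degree
  -- can annihilate a nonzero v. For r a residue this excludes zero divisors.
  annihilator-zero : ∀ r {v} → Below (suc k) r → v ≢ 𝟘 → act r v ≡ 𝟘 → r ≈ᵖ []
  annihilator-zero r {v} r< v≢0 rv≡0 with degree? r
  ... | inj₁ r≈0         = r≈0
  ... | inj₂ (d , r-deg) = ⊥-elim
    (minimal-annihilator irreducible (degree-monic w) v≢0 (act-monic v) r-deg (degree-below r-deg r<) rv≡0)

  private
    infixl 7 _⊗_
    -- The left factor is read as a polynomial in R, so the field laws become statements about
    -- `act`.
    _⊗_ : V → V → V
    u ⊗ v = act (toList u) v

    ⊗-comm : ∀ u v → u ⊗ v ≡ v ⊗ u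
    ⊗-comm u v = begin
      act (toList u) v                         ≡⟨ cong (act (toList u)) (act-𝟙 v) ⟨
      act (toList u) (act (toList v) 𝟙)        ≡⟨ act-comm (toList u) (toList v) 𝟙 ⟩
      act (toList v) (act (toList u) 𝟙)        ≡⟨ cong (act (toList v)) (act-𝟙 u) ⟩
      act (toList v) u                         ∎

    ⊗-assoc : ∀ u v x → (u ⊗ v) ⊗ x ≡ u ⊗ (v ⊗ x)
    ⊗-assoc u v x = begin
      (u ⊗ v) ⊗ x      ≡⟨ ⊗-comm (u ⊗ v) x ⟩
      x ⊗ (u ⊗ v)      ≡⟨ act-comm (toList x) (toList u) v ⟩
      u ⊗ (x ⊗ v)      ≡⟨ cong (u ⊗_) (⊗-comm x v) ⟩
      u ⊗ (v ⊗ x)      ∎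

    -1• : V → V
    -1• v = - 1# • v

    ⊕-inverse : ∀ (v : V) → v ⊕ -1• v ≡ 𝟘
    ⊕-inverse v = begin
      v ⊕ - 1# • v         ≡⟨ cong (_⊕ - 1# • v) (1• v) ⟨
      1# • v ⊕ - 1# • v    ≡⟨ •-distribʳ 1# (- 1#) v ⟨
      (1# + - 1#) • v      ≡⟨ cong (_• v) (-‿inverseʳ 1#) ⟩
      0# • v               ≡⟨ 0• v ⟩
      𝟘                    ∎

    ⊗-injective : ∀ {u} → u ≢ 𝟘 → ∀ {x y} → u ⊗ x ≡ u ⊗ y → x ≡ y
    ⊗-injective {u} u≢0 {x} {y} eq with Vecₚ.≡-dec _≟_ (x ⊕ -1• y) 𝟘
    ... | yes x-y≡0 = begin
      x                      ≡⟨ ⊕-identityʳ x ⟨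
      x ⊕ 𝟘                  ≡⟨ cong (x ⊕_) (trans (⊕-comm (-1• y) y) (⊕-inverse y)) ⟨
      x ⊕ (-1• y ⊕ y)        ≡⟨ ⊕-assoc x (-1• y) y ⟨
      (x ⊕ -1• y) ⊕ y        ≡⟨ cong (_⊕ y) x-y≡0 ⟩
      𝟘 ⊕ y                  ≡⟨ ⊕-identity y ⟩
      y                      ∎
    ... | no x-y≢0 = ⊥-elim (u≢0 (toList≈0 u (annihilator-zero (toList u) (below-toList u) x-y≢0 (begin
      u ⊗ (x ⊕ -1• y)        ≡⟨ act-⊕ (toList u) x (-1• y) ⟩
      u ⊗ x ⊕ u ⊗ (-1• y)    ≡⟨ cong₂ _⊕_ eq (act-• (toList u) (- 1#) y) ⟩
      u ⊗ y ⊕ -1• (u ⊗ y)    ≡⟨ ⊕-inverse _ ⟩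
      𝟘                      ∎))))

    V↔ : V ↔ Fin (q ^ suc k)
    V↔ = vec↔ finite (suc k)

    -- Multiplication by u is injective on a finite set, hence reaches `𝟙`.
    ⊗-invertible : ∀ u → u ≢ 𝟘 → ∃ λ v → u ⊗ v ≡ 𝟙
    ⊗-invertible u u≢0 = from (proj₁ preimage) , (begin
      u ⊗ from (proj₁ preimage)                ≡⟨ strictlyInverseʳ _ ⟨
      from (to (u ⊗ from (proj₁ preimage)))    ≡⟨ cong from (proj₂ preimage) ⟩
      from (to 𝟙)                              ≡⟨ strictlyInverseʳ 𝟙 ⟩
      𝟙                                        ∎)
      where
      open Inverse V↔
      preimage = injective⇒surjective (λ i → to (u ⊗ from i))
        (λ {i} {j} eq → trans (sym (strictlyInverseˡ i)) (trans
          (cong to (⊗-injective u≢0 (trans (sym (strictlyInverseʳ _)) (trans (cong from eq) (strictlyInverseʳ _)))))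
          (strictlyInverseˡ j)))
        (to 𝟙)

  quotientField : FiniteField (q ^ suc k)
  quotientField = record
    { Carrier = V ; _+_ = _⊕_ ; _*_ = _⊗_ ; -_ = -1• ; 0# = 𝟘 ; 1# = 𝟙
    ; isCommutativeRing = isCommutativeRing-≡ ⊕-assoc ⊕-comm ⊕-identity
        (λ v → trans (⊕-comm _ v) (⊕-inverse v)) ⊗-assoc ⊗-comm
        (λ v → trans (⊗-comm 𝟙 v) (act-𝟙 v)) (λ u → act-⊕ (toList u))
    ; 0≢1 = 0≢1 ∘ Vecₚ.∷-injectiveˡ
    ; invertible = ⊗-invertible
    ; finite = V↔
    }

  private
    power : ∀ n → Fermat._^ᶠ_ quotientField (R 𝟙) n ≡ act (X^ n) 𝟙
    power zero    = sym (trans (cong₂ _⊕_ (1• 𝟙) R-𝟘) (⊕-identityʳ 𝟙))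
    power (suc n) = begin
      R 𝟙 ⊗ Fermat._^ᶠ_ quotientField (R 𝟙) n    ≡⟨ cong (R 𝟙 ⊗_) (power n) ⟩
      R 𝟙 ⊗ v                                    ≡⟨ ⊗-comm (R 𝟙) v ⟩
      v ⊗ R 𝟙                                    ≡⟨ act-R (toList v) 𝟙 ⟩
      R (v ⊗ 𝟙)                                  ≡⟨ cong R (act-𝟙 v) ⟩
      R v                                        ≡⟨ ⊕-identity _ ⟨
      𝟘 ⊕ R v                                    ≡⟨ cong (_⊕ R v) (0• 𝟙) ⟨
      0# • 𝟙 ⊕ R v                               ∎
      where v = act (X^ n) 𝟙

    fermat : ∀ x j → Fermat._^ᶠ_ quotientField x ((q ^ suc k) ^ j) ≡ x
    fermat x zero    = act-𝟙 x
    fermat x (suc j) = begin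
      x ^ᵠ (n ℕ.* n ^ j)    ≡⟨ ^-assocʳ x n (n ^ j) ⟨
      (x ^ᵠ n) ^ᵠ (n ^ j)   ≡⟨ cong (_^ᵠ (n ^ j)) (Fermat.^-order quotientField x) ⟩
      x ^ᵠ (n ^ j)          ≡⟨ fermat x j ⟩
      x                     ∎
      where
      n = q ^ suc k
      open Exp (CommutativeRing.commutativeSemiring (FiniteField.commutativeRing quotientField)) using (^-assocʳ)
      open Fermat quotientField using () renaming (_^ᶠ_ to _^ᵠ_)

  -- The class `R 𝟙` of X is fixed by the power map of the quotient field, so the remainder modulo w
  -- annihilates `𝟙` and must be zero. The case j = 1 bounds the period of a root by the degree; the
  -- case that makes the exponent q^m yields a root in L.
  irreducible∣X^-X : ∀ j → ∃ λ h → X^ ((q ^ suc k) ^ j) -X ≈ᵖ mulPoly K h (monic K w)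
  irreducible∣X^-X j with divide-by (degree-monic w) X^ ((q ^ suc k) ^ j) -X
  ... | h , r , eq , r< = h , λ i → trans (eq i) (trans (coeff-add (mulPoly K h (monic K w)) r i)
    (trans (cong (λ z → coeff K (mulPoly K h (monic K w)) i + z) (r≈0 i)) (+-identityʳ _)))
    where
    n = (q ^ suc k) ^ j

    annihilates : act (X^ n -X) 𝟙 ≡ 𝟘
    annihilates = begin
      act (X^ n -X) 𝟙                                     ≡⟨ act-add (X^ n) _ 𝟙 ⟩
      act (X^ n) 𝟙 ⊕ (0# • 𝟙 ⊕ R (- 1# • 𝟙 ⊕ R 𝟘))        ≡⟨ cong₂ _⊕_ (trans (sym (power n)) (fermat (R 𝟙) j))
                                                             (trans (cong (_⊕ R (- 1# • 𝟙 ⊕ R 𝟘)) (0• 𝟙)) (⊕-identity _)) ⟩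
      R 𝟙 ⊕ R (- 1# • 𝟙 ⊕ R 𝟘)                            ≡⟨ cong (λ v → R 𝟙 ⊕ R v) (trans (cong (-1• 𝟙 ⊕_) R-𝟘) (⊕-identityʳ _)) ⟩
      R 𝟙 ⊕ R (- 1# • 𝟙)                                  ≡⟨ cong (R 𝟙 ⊕_) (R-• (- 1#) 𝟙) ⟩
      R 𝟙 ⊕ -1• (R 𝟙)                                     ≡⟨ ⊕-inverse (R 𝟙) ⟩
      𝟘                                                   ∎

    r≈0 : r ≈ᵖ []
    r≈0 = annihilator-zero r r< (λ 𝟙≡0 → 0≢1 (sym (Vecₚ.∷-injectiveˡ 𝟙≡0)))
      (annihilates-remainder (X^ n -X) h (monic K w) r 𝟙 eq annihilates (act-monic 𝟙))

-- Frobenius orbits and irreducible polynomials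

module Orbits {q m} (1≤m : 1 ≤ m) (K : FiniteField q) (L : FiniteField (q ^ m)) (ι : K ↪ L) where
  open FiniteField L
  private
    module K = FiniteField K
  open _↪_ ι
  open Fermat L
  open FieldProperties L
  open Frobenius 1≤m K L ι
  open FixedField 1≤m K L ι
  open Polynomials K
  open RingMorphisms.IsRingHomomorphism isRingHomomorphism
  open CommutativeRing commutativeRing
    using ( commutativeSemiring; *-assoc; *-comm; *-identityˡ; *-identityʳ; zeroˡ; zeroʳ; distribˡ; distribʳ
          ; +-identityˡ; +-identityʳ; +-assoc; +-comm; +-group; ring)
  open Exp commutativeSemiring using (^-assocʳ)
  open GroupProperties +-group using (x∙y⁻¹≈ε⇒x≈y; x≈y⇒x∙y⁻¹≈ε; ∙-cancelˡ)
  open ≡-Reasoning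

  -- Here `act p 1#` is p(x), so the laws of evaluation and the minimality of irreducible
  -- annihilators carry over to roots in L.
  multiplication : Carrier → Operator K
  multiplication x = record
    { V = Carrier ; _⊕_ = _+_ ; 𝟘 = 0# ; _•_ = λ a v → ⟦ a ⟧ * v ; R = x *_
    ; ⊕-assoc = +-assoc ; ⊕-comm = +-comm ; ⊕-identity = +-identityˡ
    ; •-distribʳ = λ a b v → trans (cong (_* v) (+-homo a b)) (distribʳ v _ _)
    ; •-distribˡ = λ a → distribˡ ⟦ a ⟧
    ; •-assoc = λ a b v → trans (cong (_* v) (*-homo a b)) (*-assoc _ _ v)
    ; 1• = λ v → trans (cong (_* v) 1#-homo) (*-identityˡ v)
    ; 0• = λ v → trans (cong (_* v) 0#-homo) (zeroˡ v)
    ; R-⊕ = distribˡ x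
    ; R-• = λ a v → trans (sym (*-assoc x _ v)) (trans (cong (_* v) (*-comm x _)) (*-assoc _ x v))
    }

  module _ {x : Carrier} where
    open Action K (multiplication x)

    eval-act : ∀ p v → act p v ≡ evalᴷ p x * v
    eval-act []      v = sym (zeroˡ v)
    eval-act (a ∷ p) v = begin
      ⟦ a ⟧ * v + x * act p v              ≡⟨ cong (λ z → ⟦ a ⟧ * v + x * z) (eval-act p v) ⟩
      ⟦ a ⟧ * v + x * (evalᴷ p x * v)      ≡⟨ cong (λ z → ⟦ a ⟧ * v + z) (*-assoc x _ v) ⟨
      ⟦ a ⟧ * v + x * evalᴷ p x * v        ≡⟨ distribʳ v _ _ ⟨
      (⟦ a ⟧ + x * evalᴷ p x) * v          ∎

    eval-act-1 : ∀ p → act p 1# ≡ evalᴷ p x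
    eval-act-1 p = trans (eval-act p 1#) (*-identityʳ _)

    eval-≈ : ∀ p r → p ≈ᵖ r → evalᴷ p x ≡ evalᴷ r x
    eval-≈ p r p≈r = trans (sym (eval-act-1 p)) (trans (act-≈ p r 1# p≈r) (eval-act-1 r))

    eval-+ : ∀ p r → evalᴷ (addPoly K p r) x ≡ evalᴷ p x + evalᴷ r x
    eval-+ p r = trans (sym (eval-act-1 (addPoly K p r)))
      (trans (act-add p r 1#) (cong₂ _+_ (eval-act-1 p) (eval-act-1 r)))

    eval-* : ∀ g h → evalᴷ (mulPoly K g h) x ≡ evalᴷ g x * evalᴷ h x
    eval-* g h = trans (sym (eval-act-1 (mulPoly K g h)))
      (trans (act-mul g h 1#) (trans (eval-act g _) (cong (evalᴷ g x *_) (eval-act-1 h))))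

    minimal-degree : ∀ {p k} → Irreducible p → HasDegree p k → evalᴷ p x ≡ 0# →
                     ∀ {r d} → HasDegree r d → d < k → evalᴷ r x ≢ 0#
    minimal-degree {p} irr p-deg px≡0 {r} r-deg d<k rx≡0 =
      minimal-annihilator irr p-deg (0≢1 ∘ sym) (trans (eval-act-1 p) px≡0) r-deg d<k
        (trans (eval-act-1 r) rx≡0)

    eval-X^-X : ∀ n → evalᴷ (X^ n -X) x ≡ x ^ᶠ n + - x
    eval-X^-X n = trans (eval-+ (X^ n) _) (cong₂ _+_ (eval-X^ n) (begin
      ⟦ K.0# ⟧ + x * (⟦ K.- K.1# ⟧ + x * 0#)    ≡⟨ cong₂ (λ a b → a + x * b) 0#-homo
                                                    (trans (cong₂ _+_ (trans (-‿homo K.1#) (cong -_ 1#-homo)) (zeroʳ x)) (+-identityʳ _)) ⟩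
      0# + x * - 1#                             ≡⟨ +-identityˡ _ ⟩
      x * - 1#                                  ≡⟨ *-comm x _ ⟩
      - 1# * x                                  ≡⟨ RingProperties.-1*x≈-x ring x ⟩
      - x                                       ∎))
      where
      eval-X^ : ∀ n → evalᴷ (X^ n) x ≡ x ^ᶠ n
      eval-X^ zero    = trans (cong₂ _+_ 1#-homo (zeroʳ x)) (+-identityʳ 1#)
      eval-X^ (suc n) = trans (cong₂ _+_ 0#-homo (cong (x *_) (eval-X^ n))) (+-identityˡ _)

  eval-monic : ∀ {k} (v : Vec K.Carrier k) y → evalᴷ (monic K v) y ≡ y ^ᶠ k + ev (Vec.map ⟦_⟧ v) y
  eval-monic {k} v y = begin
    evalᴷ (toList (v ∷ʳ K.1#)) y                    ≡⟨ eval-ev (v ∷ʳ K.1#) y ⟩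
    ev (Vec.map ⟦_⟧ (v ∷ʳ K.1#)) y                  ≡⟨ cong (λ p → ev p y) (Vecₚ.map-∷ʳ ⟦_⟧ K.1# v) ⟩
    ev (Vec.map ⟦_⟧ v ∷ʳ ⟦ K.1# ⟧) y                ≡⟨ ev-∷ʳ (Vec.map ⟦_⟧ v) _ y ⟩
    y ^ᶠ k * ⟦ K.1# ⟧ + ev (Vec.map ⟦_⟧ v) y        ≡⟨ cong (_+ ev (Vec.map ⟦_⟧ v) y) (trans (cong (y ^ᶠ k *_) 1#-homo) (*-identityʳ _)) ⟩
    y ^ᶠ k + ev (Vec.map ⟦_⟧ v) y                   ∎

  map-⟦⟧-injective : ∀ {k} (u v : Vec K.Carrier k) → Vec.map ⟦_⟧ u ≡ Vec.map ⟦_⟧ v → u ≡ v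
  map-⟦⟧-injective []      []      _  = refl
  map-⟦⟧-injective (a ∷ u) (b ∷ v) eq =
    cong₂ _∷_ (⟦⟧-injective (Vecₚ.∷-injectiveˡ eq)) (map-⟦⟧-injective u v (Vecₚ.∷-injectiveʳ eq))

  eval-root-bound : ∀ {k} r → Below k r → (a : Fin k → Carrier) → Injective _≡_ _≡_ a →
                    (∀ i → evalᴷ r (a i) ≡ 0#) → r ≈ᵖ []
  eval-root-bound {k} r r< a a-inj root i = begin
    coeff K r i                                       ≡⟨ fit-≈ k r r< i ⟨
    coeff K (toList (fit k r)) i                      ≡⟨ cong (λ v → coeff K (toList v) i) fit≡0 ⟩
    coeff K (toList (replicate k K.0#)) i             ≡⟨ zeros k i ⟩
    K.0#                                              ∎
    where
    zeros : ∀ k i → coeff K (toList (replicate k K.0#)) i ≡ K.0#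
    zeros zero    i       = refl
    zeros (suc k) zero    = refl
    zeros (suc k) (suc i) = zeros k i

    fit≡0 : fit k r ≡ replicate k K.0#
    fit≡0 = map-⟦⟧-injective _ _ (begin
      Vec.map ⟦_⟧ (fit k r)                ≡⟨ root-bound _ a a-inj (λ i → begin
        ev (Vec.map ⟦_⟧ (fit k r)) (a i)     ≡⟨ eval-ev (fit k r) (a i) ⟨
        evalᴷ (toList (fit k r)) (a i)       ≡⟨ eval-≈ (toList (fit k r)) r (fit-≈ k r r<) ⟩
        evalᴷ r (a i)                        ≡⟨ root i ⟩
        0#                                   ∎) ⟩
      replicate k 0#                       ≡⟨ cong (replicate k) 0#-homo ⟨
      replicate k ⟦ K.0# ⟧                 ≡⟨ Vecₚ.map-replicate ⟦_⟧ K.0# k ⟨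
      Vec.map ⟦_⟧ (replicate k K.0#)       ∎)

  -- Leastness is taken in the divisibility order: this makes the period unique by antisymmetry and
  -- matches exponents modulo k.
  record IsPeriod (k : ℕ) (x : Carrier) : Set where
    constructor mkPeriod
    field
      fixed : Fr k x ≡ x
      least : ∀ n → Fr n x ≡ x → k ∣ n
  open IsPeriod

  Fr-multiple : ∀ {k x} → Fr k x ≡ x → ∀ {n} → k ∣ n → Fr n x ≡ x
  Fr-multiple {k} {x} eq (ℕ∣.divides c refl) = go c
    where
    go : ∀ c → Fr (c ℕ.* k) x ≡ x
    go zero    = refl
    go (suc c) = trans (Fr-∘ k (c ℕ.* k) x) (trans (cong (Fr k) (go c)) eq)

  period-unique : ∀ {j k x} → IsPeriod j x → IsPeriod k x → j ≡ k
  period-unique P Q = ℕ∣.∣-antisym (least P _ (fixed Q)) (least Q _ (fixed P))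

  -- The search stops by m since F^m is the identity. If k is the first return time and F^n x = x,
  -- then n % k is a return time below k, hence 0.
  period : ∀ x → ∃ λ k → 1 ≤ k × k ∣ m × IsPeriod k x
  period x with find m
    where
    find : ∀ n → (∃ λ k → 1 ≤ k × Fr k x ≡ x × (∀ j → 1 ≤ j → j < k → Fr j x ≢ x)) ⊎
                 (∀ j → 1 ≤ j → j ≤ n → Fr j x ≢ x)
    find zero = inj₂ λ { (suc j) _ () }
    find (suc n) with find n
    ... | inj₁ found = inj₁ found
    ... | inj₂ none with Fr (suc n) x ≟ x
    ...   | yes eq = inj₁ (suc n , s≤s z≤n , eq , λ j 1≤j j<1+n → none j 1≤j (ℕₚ.≤-pred j<1+n))
    ...   | no neq = inj₂ λ j 1≤j j≤1+n → case ℕₚ.m≤n⇒m<n∨m≡n j≤1+n of λ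
      { (inj₁ j<1+n) → none j 1≤j (ℕₚ.≤-pred j<1+n) ; (inj₂ refl) → neq }
  ... | inj₂ none = ⊥-elim (none m 1≤m ℕₚ.≤-refl (Fr-order x))
  ... | inj₁ (k , 1≤k , eq , smallest) = k , 1≤k , k∣ m (Fr-order x) , mkPeriod eq k∣
    where
    instance
      k≢0 : NonZero k
      k≢0 = ℕ.>-nonZero 1≤k
    k∣ : ∀ n → Fr n x ≡ x → k ∣ n
    k∣ n Frn≡x = ℕ∣.m%n≡0⇒n∣m n k (remainder (n % k) (m%n<n n k) (begin
      Fr (n % k) x                             ≡⟨ cong (Fr (n % k)) (Fr-multiple eq (ℕ∣.divides (n / k) refl)) ⟨
      Fr (n % k) (Fr ((n / k) ℕ.* k) x)        ≡⟨ Fr-∘ (n % k) _ x ⟨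
      Fr (n % k ℕ.+ (n / k) ℕ.* k) x           ≡⟨ cong (λ j → Fr j x) (m≡m%n+[m/n]*n n k) ⟨
      Fr n x                                   ≡⟨ Frn≡x ⟩
      x                                        ∎))
      where
      remainder : ∀ r → r < k → Fr r x ≡ x → r ≡ 0
      remainder zero    _   _  = refl
      remainder (suc r) r<k eq = ⊥-elim (smallest (suc r) (s≤s z≤n) r<k eq)

  period-Fr : ∀ {k x} j → IsPeriod k x → IsPeriod k (Fr j x)
  period-Fr {k} {x} j P = mkPeriod (trans (Fr-comm k j x) (cong (Fr j) (fixed P)))
    λ n eq → least P n (Fr-injective j (trans (Fr-comm j n x) eq))

  Fr-∸ : ∀ {i j} → i ≤ j → ∀ x → Fr j x ≡ Fr i (Fr (j ℕ.∸ i) x)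
  Fr-∸ {i} i≤j x = trans (cong (λ k → Fr k x) (sym (ℕₚ.m+[n∸m]≡n i≤j))) (Fr-∘ i _ x)

  period-∸ : ∀ {k x i j} → IsPeriod k x → i ≤ j → Fr i x ≡ Fr j x → k ∣ j ℕ.∸ i
  period-∸ {x = x} {i} P i≤j eq = least P _ (Fr-injective i (trans (sym (Fr-∸ i≤j x)) (sym eq)))

  conjugate : ∀ {k} → Carrier → Fin k → Carrier
  conjugate x i = Fr (toℕ i) x

  conjugate-injective : ∀ {k x} → IsPeriod k x → Injective _≡_ _≡_ (conjugate {k} x)
  conjugate-injective {k} {x} P {i} {j} eq = Finₚ.toℕ-injective (case ℕₚ.≤-total (toℕ i) (toℕ j) of λ
    { (inj₁ i≤j) → equal i≤j (Finₚ.toℕ<n j) eq ; (inj₂ j≤i) → sym (equal j≤i (Finₚ.toℕ<n i) (sym eq)) })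
    where
    equal : ∀ {i j} → i ≤ j → j < k → Fr i x ≡ Fr j x → i ≡ j
    equal {i} {j} i≤j j<k eq with j ℕ.∸ i in j∸i≡ | period-∸ P i≤j eq
    ... | zero  | _   = ℕₚ.≤-antisym i≤j (ℕₚ.m∸n≡0⇒m≤n j∸i≡)
    ... | suc d | k∣d = ⊥-elim (ℕₚ.<⇒≱ j<k (ℕₚ.≤-trans (ℕ∣.∣⇒≤ k∣d) (subst (_≤ j) j∸i≡ (ℕₚ.m∸n≤m j i))))

  Fr-zero : ∀ j → Fr j 0# ≡ 0#
  Fr-zero j = trans (cong (Fr j) (sym 0#-homo)) (trans (Fr-⟦⟧ j K.0#) 0#-homo)

  root-conjugate : ∀ p j {x} → evalᴷ p x ≡ 0# → evalᴷ p (Fr j x) ≡ 0#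
  root-conjugate p j {x} px≡0 = trans (eval-Fr j p x) (trans (cong (Fr j) px≡0) (Fr-zero j))

  -- A polynomial over K that vanishes at x vanishes at its k distinct conjugates as well, too many
  -- for a degree below k.
  period-degree : ∀ {k x} → IsPeriod k x → ∀ r → Below k r → evalᴷ r x ≡ 0# → r ≈ᵖ []
  period-degree {k} {x} P r r< rx≡0 = eval-root-bound r r< (conjugate x) (conjugate-injective P)
    (λ i → root-conjugate r (toℕ i) rx≡0)

  -- Ensures k ≤ m ≤ q^m, so that `descend` has enough points for the minimal polynomial.
  n<q^n : ∀ n → n < q ^ n
  n<q^n zero    = s≤s z≤n
  n<q^n (suc n) = ℕₚ.≤-trans (ℕₚ.+-mono-≤ {1} (ℕₚ.m^n>0 q n) (n<q^n n))
    (ℕₚ.≤-trans (ℕₚ.≤-reflexive (cong (q ^ n ℕ.+_) (sym (ℕₚ.+-identityʳ _)))) (ℕₚ.*-monoˡ-≤ (q ^ n) 2≤q))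

  -- Isolates the last factor; for the shifted conjugates it belongs to F^k x = x and closes the
  -- cycle.
  ∏-minus-snoc : ∀ k (g : ℕ → Carrier) z →
                 ∏-minus {suc k} (g ∘ toℕ) z ≡ ∏-minus {k} (g ∘ toℕ) z * (z + - g k)
  ∏-minus-snoc zero    g z = *-comm _ _
  ∏-minus-snoc (suc k) g z = trans (cong ((z + - g 0) *_) (∏-minus-snoc k (g ∘ suc) z)) (sym (*-assoc _ _ _))

  F-∏-minus : ∀ {k} (g : Fin k → Carrier) z → F (∏-minus g z) ≡ ∏-minus (F ∘ g) (F z)
  F-∏-minus {zero}  g z = F-one
  F-∏-minus {suc k} g z = trans (F-* _ _) (cong₂ _*_
    (trans (F-+ z _) (cong (λ y → F z + y) (F-neg _))) (F-∏-minus (g ∘ suc) z))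

  -- The coefficients of ∏ (X - F^i x) are fixed by F, which permutes the
  -- roots cyclically.
  minimal-polynomial : ∀ {k x} → 1 ≤ k → k ≤ m → Fr k x ≡ x → ∃ λ (v : Vec K.Carrier k) → evalᴷ (monic K v) x ≡ 0#
  minimal-polynomial {k@(suc k′)} {x} _ k≤m Frk≡x
    with subst (λ d → Monicᶠ d (∏-minus {k} (conjugate x))) (ℕₚ.*-identityʳ k)
           (∏-minus-monic {k} (conjugate x) ℕₚ.≤-refl (monic-ext (λ y → sym (*-identityʳ y)) (monic-X^ 1)))
  ... | l , (p , l≗p) , ∏≗ =
    let v , eq = descend (ℕₚ.≤-trans k≤m (ℕₚ.<⇒≤ (n<q^n m))) p p-F
    in v , (begin
      evalᴷ (monic K v) x                       ≡⟨ eval-monic v x ⟩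
      x ^ᶠ k + ev (Vec.map ⟦_⟧ v) x             ≡⟨ cong (λ r → x ^ᶠ k + ev r x) eq ⟩
      x ^ᶠ k + ev p x                           ≡⟨ expand x ⟨
      ∏-minus {k} (conjugate x) x               ≡⟨ ∏-minus-zero (conjugate {k} x) zero refl ⟩
      0#                                        ∎)
    where
    expand : ∀ y → ∏-minus {k} (conjugate x) y ≡ y ^ᶠ k + ev p y
    expand y = trans (∏≗ y) (cong (λ z → y ^ᶠ k + z) (l≗p y))

    ∏-F : ∀ y → ∏-minus {k} (conjugate x) (F y) ≡ F (∏-minus {k} (conjugate x) y)
    ∏-F y = sym (begin
      F (∏-minus {k} (conjugate x) y)                                      ≡⟨ F-∏-minus {k} (conjugate x) y ⟩
      ∏-minus {k} (λ i → Fr (suc (toℕ i)) x) (F y)                         ≡⟨ ∏-minus-snoc k′ (λ i → Fr (suc i) x) (F y) ⟩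
      ∏-minus {k′} (λ i → Fr (suc (toℕ i)) x) (F y) * (F y + - Fr k x)     ≡⟨ cong (λ z → ∏-minus {k′} (λ i → Fr (suc (toℕ i)) x) (F y) * (F y + - z)) Frk≡x ⟩
      ∏-minus {k′} (λ i → Fr (suc (toℕ i)) x) (F y) * (F y + - x)          ≡⟨ *-comm _ _ ⟩
      ∏-minus {k} (conjugate x) (F y)                                      ∎)

    F-^ : ∀ y → F (y ^ᶠ k) ≡ F y ^ᶠ k
    F-^ y = trans (^-assocʳ y k q) (trans (cong (y ^ᶠ_) (ℕₚ.*-comm k q)) (sym (^-assocʳ y q k)))

    p-F : ∀ y → ev p (F y) ≡ F (ev p y)
    p-F y = ∙-cancelˡ (F y ^ᶠ k) _ _ (begin
      F y ^ᶠ k + ev p (F y)                    ≡⟨ expand (F y) ⟨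
      ∏-minus {k} (conjugate x) (F y)          ≡⟨ ∏-F y ⟩
      F (∏-minus {k} (conjugate x) y)          ≡⟨ cong F (expand y) ⟩
      F (y ^ᶠ k + ev p y)                      ≡⟨ F-+ _ _ ⟩
      F (y ^ᶠ k) + F (ev p y)                  ≡⟨ cong (_+ F (ev p y)) (F-^ y) ⟩
      F y ^ᶠ k + F (ev p y)                    ∎)

  period⇒irreducible : ∀ {k x} (v : Vec K.Carrier k) → 1 ≤ k → IsPeriod k x → evalᴷ (monic K v) x ≡ 0# →
                       Irreducible (monic K v)
  period⇒irreducible {k} {x} v 1≤k P root = record
    { p∤1 = λ v∣1 → ℕₚ.<⇒≢ 1≤k (sym (unit⇒degree-0 v∣1 (degree-monic v)))
    ; split-∣1 = λ {g} {h} v≈gh → split g h v≈gh (degree? g) (degree? h)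
    }
    where
    -- A factor g vanishing at x has k roots, which leaves degree 0 for h.
    cofactor : ∀ {a b} g → HasDegree g a → evalᴷ g x ≡ 0# → a ℕ.+ b ≡ k → b ≡ 0
    cofactor {a} {b} g g-deg gx≡0 a+b≡k = ℕₚ.m+n≡0⇒m≡0 b {0} (trans (ℕₚ.+-identityʳ b) (ℕₚ.n≤0⇒n≡0
      (ℕₚ.+-cancelˡ-≤ a b 0 (ℕₚ.≤-trans (ℕₚ.≤-reflexive a+b≡k) (ℕₚ.≤-trans k≤a (ℕₚ.m≤m+n a 0))))))
      where
      k≤a : k ≤ a
      k≤a = ℕₚ.≮⇒≥ λ a<k → degree≉0 g-deg
        (period-degree P g (λ i k≤i → HasDegree.bounded g-deg i (ℕₚ.≤-trans a<k k≤i)) gx≡0)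

    split : ∀ g h → monic K v ≈ᵖ mulPoly K g h → g ≈ᵖ [] ⊎ ∃ (HasDegree g) → h ≈ᵖ [] ⊎ ∃ (HasDegree h) →
            g ∣ᵖ (K.1# ∷ []) ⊎ h ∣ᵖ (K.1# ∷ [])
    split g h v≈gh (inj₁ g≈0) _ =
      ⊥-elim (degree≉0 (degree-monic v) (λ i → trans (v≈gh i) (mul-zeroˡ g h g≈0 i)))
    split g h v≈gh (inj₂ _) (inj₁ h≈0) =
      ⊥-elim (degree≉0 (degree-monic v) (λ i → trans (v≈gh i) (mul-zeroʳ g h h≈0 i)))
    split g h v≈gh (inj₂ (a , g-deg)) (inj₂ (b , h-deg)) =
      case zero-product (trans (sym (eval-* g h)) (trans (sym (eval-≈ (monic K v) (mulPoly K g h) v≈gh)) root)) of λ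
        { (inj₁ gx≡0) → inj₂ (degree-0⇒unit (subst (HasDegree h) (cofactor g g-deg gx≡0 a+b≡k) h-deg))
        ; (inj₂ hx≡0) → inj₁ (degree-0⇒unit (subst (HasDegree g) (cofactor h h-deg hx≡0 (trans (ℕₚ.+-comm b a) a+b≡k)) g-deg)) }
      where
      a+b≡k : a ℕ.+ b ≡ k
      a+b≡k = degree-unique (degree-resp {mulPoly K g h} {monic K v} (sym ∘ v≈gh) (degree-mul g-deg h-deg)) (degree-monic v)

  -- A root x is fixed by F^k, so its period d divides k; if d < k, the minimal polynomial of x
  -- would vanish at a root of an irreducible polynomial of larger degree. Without a root, the
  -- cofactor h in X^(q^m) - X = h w would vanish on all of L although its degree is below q^m.
  irreducible-root : ∀ {k} (v : Vec K.Carrier k) → Irreducible (monic K v) → k ∣ m →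
                     ∃ λ x → evalᴷ (monic K v) x ≡ 0# × IsPeriod k x
  irreducible-root {zero}   [] irr _ = ⊥-elim (p∤1 (degree-0⇒unit (degree-monic [])))
    where
    open RawSemiringDefinitions.Irreducible irr
  irreducible-root {k@(suc _)} v irr k∣m@(ℕ∣.divides j m≡jk) with search (λ x → evalᴷ (monic K v) x ≟ 0#)
  ... | yes (x , root) = x , root , subst (λ d → IsPeriod d x) d≡k P
    where
    Frk≡x : Fr k x ≡ x
    Frk≡x = let h , eq = Quotient.irreducible∣X^-X K v irr 1 in x∙y⁻¹≈ε⇒x≈y _ _ (begin
      Fr k x + - x                                ≡⟨ cong (_+ - x) (trans (Fr-^ k x) (cong (x ^ᶠ_) (sym (ℕₚ.*-identityʳ (q ^ k))))) ⟩
      x ^ᶠ ((q ^ k) ^ 1) + - x                    ≡⟨ eval-X^-X ((q ^ k) ^ 1) ⟨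
      evalᴷ (X^ ((q ^ k) ^ 1) -X) x               ≡⟨ eval-≈ (X^ ((q ^ k) ^ 1) -X) (mulPoly K h (monic K v)) eq ⟩
      evalᴷ (mulPoly K h (monic K v)) x           ≡⟨ eval-* h (monic K v) ⟩
      evalᴷ h x * evalᴷ (monic K v) x             ≡⟨ cong (evalᴷ h x *_) root ⟩
      evalᴷ h x * 0#                              ≡⟨ zeroʳ _ ⟩
      0#                                          ∎)

    d = proj₁ (period x)
    P = proj₂ (proj₂ (proj₂ (period x)))
    d∣k = least P k Frk≡x

    d≡k : d ≡ k
    d≡k = case ℕₚ.m≤n⇒m<n∨m≡n (ℕ∣.∣⇒≤ d∣k) of λ
      { (inj₂ eq)  → eq
      ; (inj₁ d<k) → let u , ux≡0 = minimal-polynomial (proj₁ (proj₂ (period x)))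
                           (ℕ∣.∣⇒≤ {{ℕ.>-nonZero 1≤m}} (proj₁ (proj₂ (proj₂ (period x))))) (fixed P)
                     in ⊥-elim (minimal-degree irr (degree-monic v) root (degree-monic u) d<k ux≡0) }
  -- With j = m / k the exponent (q^k)^j is q^m, the order of L.
  ... | no rootless with Quotient.irreducible∣X^-X K v irr j
  ...   | h , eq = ⊥-elim (contradiction′ (degree? h))
    where
    N = (q ^ k) ^ j

    N≡q^m : N ≡ q ^ m
    N≡q^m = trans (ℕₚ.^-*-assoc q k j) (cong (q ^_) (trans (ℕₚ.*-comm k j) (sym m≡jk)))

    N-deg : HasDegree (X^ N -X) N
    N-deg = degree-X^-X (subst (2 ≤_) (sym N≡q^m) (2≤q^ 1≤m))

    h-vanishes : ∀ x → evalᴷ h x ≡ 0#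
    h-vanishes x = case zero-product product≡0 of λ
      { (inj₁ hx≡0) → hx≡0 ; (inj₂ vx≡0) → ⊥-elim (rootless (x , vx≡0)) }
      where
      product≡0 : evalᴷ h x * evalᴷ (monic K v) x ≡ 0#
      product≡0 = begin
        evalᴷ h x * evalᴷ (monic K v) x         ≡⟨ eval-* h (monic K v) ⟨
        evalᴷ (mulPoly K h (monic K v)) x       ≡⟨ eval-≈ (X^ N -X) (mulPoly K h (monic K v)) eq ⟨
        evalᴷ (X^ N -X) x                       ≡⟨ eval-X^-X N ⟩
        x ^ᶠ N + - x                            ≡⟨ x≈y⇒x∙y⁻¹≈ε (trans (cong (x ^ᶠ_) N≡q^m) (^-order x)) ⟩
        0#                                      ∎

    contradiction′ : h ≈ᵖ [] ⊎ ∃ (HasDegree h) → ⊥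
    contradiction′ (inj₁ h≈0) = degree≉0 N-deg (λ i → trans (eq i) (mul-zeroˡ h (monic K v) h≈0 i))
    contradiction′ (inj₂ (b , h-deg)) = degree≉0 h-deg (eval-root-bound h (HasDegree.bounded h-deg)
      (λ i → Inverse.from finite (inject≤ i b<q^m)) (Finₚ.inject≤-injective b<q^m b<q^m _ _ ∘ from-injective)
      (λ i → h-vanishes _))
      where
      b+k≡N : b ℕ.+ k ≡ N
      b+k≡N = degree-unique (degree-resp {mulPoly K h (monic K v)} {X^ N -X} (sym ∘ eq) (degree-mul h-deg (degree-monic v))) N-deg
      b<q^m : b < q ^ m
      b<q^m = subst (b <_) (trans b+k≡N N≡q^m) (ℕₚ.m<m+n b (s≤s z≤n))

-- The product is indexed by numbers paired with divisibility proofs, so each divisor must carry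
-- just one proof. Positivity of n excludes k = 0, where the quotient would be arbitrary.
∣-irrelevant : ∀ {k n} → 1 ≤ n → (d d′ : k ∣ n) → d ≡ d′
∣-irrelevant {zero}  1≤n d d′ = ⊥-elim (ℕₚ.<⇒≢ 1≤n (sym (ℕ∣.0∣⇒≡0 d)))
∣-irrelevant {suc k} 1≤n (ℕ∣.divides c eq) (ℕ∣.divides c′ eq′)
  with refl ← ℕₚ.*-cancelʳ-≡ c c′ (suc k) (trans (sym eq) eq′) = cong (ℕ∣.divides c) (ℕₚ.≡-irrelevant eq eq′)

-- One root for each irreducible polynomial, and coordinates relative to these roots

module Representatives {q m} (1≤m : 1 ≤ m) (K : FiniteField q) (L : FiniteField (q ^ m)) (ι : K ↪ L)
                       (π : ℕ → ℕ) (count : ∀ k → MonicIrreducibleCount K k (π k)) where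
  open FiniteField L
  private
    module K = FiniteField K
    module π k = Inverse (count k)
  open _↪_ ι
  open Fermat L
  open FieldProperties L
  open Frobenius 1≤m K L ι
  open Polynomials K
  open Orbits 1≤m K L ι
  open IsPeriod
  open GroupProperties (CommutativeRing.+-group commutativeRing) using (∙-cancelˡ)
  open ≡-Reasoning

  private
    polynomial : ∀ k → Fin (π k) → Vec K.Carrier k
    polynomial k i = proj₁ (π.from k i)

  module _ {k} (k∣m : k ∣ m) where
    1≤divisor : 1 ≤ k
    1≤divisor = ℕₚ.n≢0⇒n>0 λ { refl → ℕₚ.<⇒≢ 1≤m (sym (ℕ∣.0∣⇒≡0 k∣m)) }

    private
      root : ∀ i → ∃ λ x → evalᴷ (monic K (polynomial k i)) x ≡ 0# × IsPeriod k x
      root i = irreducible-root (polynomial k i) (proj₂ (π.from k i)) k∣m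

    rep : Fin (π k) → Carrier
    rep i = proj₁ (root i)

    rep-root : ∀ i → evalᴷ (monic K (polynomial k i)) (rep i) ≡ 0#
    rep-root i = proj₁ (proj₂ (root i))

    rep-period : ∀ i → IsPeriod k (rep i)
    rep-period i = proj₂ (proj₂ (root i))

    private
      -- Both monic polynomials vanish at the k conjugates of z. Cancelling the leading powers
      -- leaves lower parts of degree below k that agree at k points, so they are equal.
      index-unique : ∀ {z} → IsPeriod k z → ∀ i i′ → evalᴷ (monic K (polynomial k i)) z ≡ 0# →
                     evalᴷ (monic K (polynomial k i′)) z ≡ 0# → i ≡ i′
      index-unique {z} P i i′ root root′ = begin
        i                          ≡⟨ π.strictlyInverseˡ k i ⟨
        π.to k (π.from k i)        ≡⟨ π.to-cong k (map-⟦⟧-injective _ _ (ev-unique _ _ (conjugate z) (conjugate-injective P)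
                                        (λ j → ∙-cancelˡ (conjugate z j ^ᶠ k) _ _ (begin
          conjugate z j ^ᶠ k + ev (Vec.map ⟦_⟧ (polynomial k i)) (conjugate z j)     ≡⟨ eval-monic (polynomial k i) (conjugate z j) ⟨
          evalᴷ (monic K (polynomial k i)) (conjugate z j)                           ≡⟨ root-conjugate (monic K (polynomial k i)) (toℕ j) root ⟩
          0#                                                                         ≡⟨ root-conjugate (monic K (polynomial k i′)) (toℕ j) root′ ⟨
          evalᴷ (monic K (polynomial k i′)) (conjugate z j)                          ≡⟨ eval-monic (polynomial k i′) (conjugate z j) ⟩
          conjugate z j ^ᶠ k + ev (Vec.map ⟦_⟧ (polynomial k i′)) (conjugate z j)    ∎)))) ⟩
        π.to k (π.from k i′)       ≡⟨ π.strictlyInverseˡ k i′ ⟩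
        i′                         ∎

    -- Take i to be the index of the minimal polynomial of y. Were y not conjugate to `rep i`, this
    -- polynomial of degree k would have k + 1 roots.
    locate : ∀ {y} → IsPeriod k y → ∃₂ λ i j → y ≡ Fr j (rep i)
    locate {y} P with minimal-polynomial 1≤divisor (ℕ∣.∣⇒≤ {{ℕ.>-nonZero 1≤m}} k∣m) (fixed P)
    ... | v , v-root with Finₚ.any? (λ j → y ≟ conjugate {k} (rep i) j)
      where i = π.to k (v , period⇒irreducible v 1≤divisor P v-root)
    ...   | yes (j , y≡) = _ , toℕ j , y≡
    ...   | no none = ⊥-elim (degree≉0 (degree-monic v) (eval-root-bound (monic K v) (HasDegree.bounded (degree-monic v))
        point point-injective point-root))
      where
      i = π.to k (v , period⇒irreducible v 1≤divisor P v-root)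

      polynomial≡v : polynomial k i ≡ v
      polynomial≡v = π.strictlyInverseʳ k _

      point : Fin (suc k) → Carrier
      point zero    = y
      point (suc j) = conjugate (rep i) j

      point-injective : Injective _≡_ _≡_ point
      point-injective {zero}  {zero}  _  = refl
      point-injective {zero}  {suc j} eq = ⊥-elim (none (j , eq))
      point-injective {suc j} {zero}  eq = ⊥-elim (none (j , sym eq))
      point-injective {suc i} {suc j} eq = cong suc (conjugate-injective (rep-period _) eq)

      point-root : ∀ j → evalᴷ (monic K v) (point j) ≡ 0#
      point-root zero    = v-root
      point-root (suc j) = subst (λ u → evalᴷ (monic K u) (conjugate (rep i) j) ≡ 0#) polynomial≡v
        (root-conjugate (monic K (polynomial k i)) (toℕ j) (rep-root i))

    rep-index : ∀ {i i′ j j′} → Fr j (rep i) ≡ Fr j′ (rep i′) → i ≡ i′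
    rep-index {i} {i′} {j} {j′} eq = index-unique (period-Fr j (rep-period i)) i i′
      (root-conjugate (monic K (polynomial k i)) j (rep-root i))
      (trans (cong (evalᴷ (monic K (polynomial k i′))) eq) (root-conjugate (monic K (polynomial k i′)) j′ (rep-root i′)))

  ∣diff∣ : ∀ {i j} → i ≤ j → ℤ.∣ + j ℤ.- + i ∣ ≡ j ℕ.∸ i
  ∣diff∣ {i} {j} i≤j = cong ℤ.∣_∣ (trans (ℤₚ.m-n≡m⊖n j i) (ℤₚ.⊖-≥ i≤j))

  Fr-≡⇒≈ : ∀ {k x} → IsPeriod k x → ∀ i j → Fr i x ≡ Fr j x → (+ i) ≈ (+ j) mod k
  Fr-≡⇒≈ {k} {x} P i j eq = case ℕₚ.≤-total i j of λ
    { (inj₁ i≤j) → AbelianGroup.sym (C k) (ordered i≤j (sym eq)) ; (inj₂ j≤i) → ordered j≤i eq }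
    where
    ordered : ∀ {i j} → j ≤ i → Fr i x ≡ Fr j x → (+ i) ≈ (+ j) mod k
    ordered j≤i eq = congruent (ℤ∣.∣ᵤ⇒∣ (subst (k ∣_) (sym (∣diff∣ j≤i)) (period-∸ P j≤i (sym eq))))

  Fr-≈⇒≡ : ∀ {k x} → Fr k x ≡ x → ∀ i j → (+ i) ≈ (+ j) mod k → Fr i x ≡ Fr j x
  Fr-≈⇒≡ {k} {x} Frk≡x i j i≈j = case ℕₚ.≤-total i j of λ
    { (inj₁ i≤j) → sym (ordered i≤j (AbelianGroup.sym (C k) i≈j)) ; (inj₂ j≤i) → ordered j≤i i≈j }
    where
    ordered : ∀ {i j} → j ≤ i → (+ i) ≈ (+ j) mod k → Fr i x ≡ Fr j x
    ordered {i} {j} j≤i (congruent k∣i-j) = trans (Fr-∸ j≤i x)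
      (cong (Fr j) (Fr-multiple Frk≡x (subst (k ∣_) (∣diff∣ j≤i) (ℤ∣.∣⇒∣ᵤ k∣i-j))))

  rep-unique : ∀ {k} (k∣m : k ∣ m) {i i′ j j′} → Fr j (rep k∣m i) ≡ Fr j′ (rep k∣m i′) →
               i ≡ i′ × (+ j) ≈ (+ j′) mod k
  rep-unique k∣m {i} {j = j} {j′} eq with refl ← rep-index k∣m {j = j} {j′} eq =
    refl , Fr-≡⇒≈ (rep-period k∣m i) j j′ eq

  Divisor : Set
  Divisor = ∃ (_∣ m)

  divisor-≡ : ∀ {k k′} {d : k ∣ m} {d′ : k′ ∣ m} → k ≡ k′ → _≡_ {A = Divisor} (k , d) (k′ , d′)
  divisor-≡ {d = d} {d′} refl = cong (_ ,_) (∣-irrelevant 1≤m d d′)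

-- Maps in coordinates: the isomorphism and its inverse

module Isomorphism {q m} (1≤m : 1 ≤ m) (K : FiniteField q) (L : FiniteField (q ^ m)) (ι : K ↪ L)
                   (π : ℕ → ℕ) (count : ∀ k → MonicIrreducibleCount K k (π k)) where
  open FiniteField L
  open _↪_ ι
  open Fermat L using (_≟_)
  open Frobenius 1≤m K L ι
  open FixedField 1≤m K L ι
  open Orbits 1≤m K L ι
  open IsPeriod
  open Representatives 1≤m K L ι π count
  open ≡-Reasoning
  private
    module G k = AbelianGroup (C k)
    module 𝒯 = Monoid (𝒯 q m K L ι)
    𝒫 : Monoid 0ℓ 0ℓ
    𝒫 = Π Divisor (λ (k , _) → M[ π k ] ⋉ C[ k ]^ π k by Γ k (π k))
    module 𝒫 = Monoid 𝒫

  commutes : ((f , _) : 𝒯.Carrier) → ∀ j x → f (Fr j x) ≡ Fr j (f x)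
  commutes F                 zero    x = refl
  commutes F@(f , _ , induced) (suc j) x =
    trans (induced⇒commutes induced (Fr j x)) (cong (Fr 1) (commutes F j x))

  -- Let d be the period of f x. Commutation gives d ∣ k. If F^d moved x, then x would lie in the
  -- subfield for k but not in the one for d, so f x could not lie in the latter, which it does.
  preserves-period : (F@(f , _) : 𝒯.Carrier) → ∀ {k x} → k ∣ m → IsPeriod k x → IsPeriod k (f x)
  preserves-period F@(f , (_ , f-subfields) , _) {k} {x} k∣m P with period (f x)
  ... | d , _ , d∣m , Q = subst (λ k → IsPeriod k (f x)) (ℕ∣.∣-antisym
      (least Q k (trans (sym (commutes F k x)) (cong f (fixed P)))) (least P d Frd≡)) Q
    where
    Frd≡ : Fr d x ≡ x
    Frd≡ with Fr d x ≟ x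
    ... | yes eq = eq
    ... | no neq = ⊥-elim (proj₂ (f-subfields k d k∣m d∣m x
      (fixed⇒InSubfield k k∣m (fixed P) , neq ∘ InSubfield⇒fixed d)) (fixed⇒InSubfield d d∣m (fixed Q)))

  -- Equal periods mean that x and f x are fixed by the same powers of F, hence lie in the same
  -- subfields.
  commuting-preserving⇒T : ∀ f → (∀ x → f (Fr 1 x) ≡ Fr 1 (f x)) → (∀ {k x} → IsPeriod k x → IsPeriod k (f x)) →
                           IsT q m K L ι f
  commuting-preserving⇒T f comm preserves = (scalars , subfields) , commutes⇒induced comm
    where
    scalars : ∀ a → ∃ λ b → f ⟦ a ⟧ ≡ ⟦ b ⟧
    scalars a = fixed⇒scalar (trans (sym (comm ⟦ a ⟧)) (cong f (F-⟦⟧ a)))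

    fixed⇔ : ∀ x n → (Fr n x ≡ x → Fr n (f x) ≡ f x) × (Fr n (f x) ≡ f x → Fr n x ≡ x)
    fixed⇔ x n = let _ , _ , _ , P = period x in
      (λ eq → Fr-multiple (fixed (preserves P)) (least P n eq)) ,
      (λ eq → Fr-multiple (fixed P) (least (preserves P) n eq))

    subfields : ∀ d s → d ∣ m → s ∣ m → ∀ x → InSubfield L (q ^ d) x × ¬ InSubfield L (q ^ s) x →
                InSubfield L (q ^ d) (f x) × ¬ InSubfield L (q ^ s) (f x)
    subfields d s d∣m s∣m x (x∈d , x∉s) =
      fixed⇒InSubfield d d∣m (proj₁ (fixed⇔ x d) (InSubfield⇒fixed d x∈d)) ,
      λ fx∈s → x∉s (fixed⇒InSubfield s s∣m (proj₂ (fixed⇔ x s) (InSubfield⇒fixed s fx∈s)))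

  module _ (F : 𝒯.Carrier) (d : Divisor) (i : Fin (π (proj₁ d))) where
    private
      k   = proj₁ d
      k∣m = proj₂ d
      location = locate k∣m (preserves-period F k∣m (rep-period k∣m i))

    σ : Fin (π k)
    σ = proj₁ location

    γ : ℕ
    γ = proj₁ (proj₂ location)

    image : proj₁ F (rep k∣m i) ≡ Fr γ (rep k∣m σ)
    image = proj₂ (proj₂ location)

  φ : 𝒯.Carrier → 𝒫.Carrier
  φ F d = σ F d , λ i → + γ F d i

  -- `locate` returns an arbitrary choice, but any other expression for the images has the same
  -- indices and congruent exponents. Each law for `φ` thus reduces to exhibiting one suitable
  -- expression.
  φ-unique : ∀ F d → (s : Fin (π (proj₁ d)) → Fin (π (proj₁ d))) (c : Fin (π (proj₁ d)) → ℕ) →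
             (∀ i → proj₁ F (rep (proj₂ d) i) ≡ Fr (c i) (rep (proj₂ d) (s i))) →
             (∀ i → σ F d i ≡ s i) × (∀ i → (+ γ F d i) ≈ (+ c i) mod proj₁ d)
  φ-unique F d@(k , k∣m) s c eq = (λ i → proj₁ (unique i)) , (λ i → proj₂ (unique i))
    where
    unique : ∀ i → σ F d i ≡ s i × (+ γ F d i) ≈ (+ c i) mod k
    unique i = rep-unique k∣m (trans (sym (image F d i)) (eq i))

  φ-cong : ∀ {F G} → F 𝒯.≈ G → φ F 𝒫.≈ φ G
  φ-cong {F} {G} F≈G d = φ-unique F d (σ G d) (γ G d) (λ i → trans (F≈G _) (image G d i))

  -- The outer map commutes with the power of the Frobenius produced by the inner one, and its own
  -- exponent is read at `σ G d i`. This reindexing is the action `Γ`.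
  φ-∙ : ∀ F G → φ (F 𝒯.∙ G) 𝒫.≈ (φ F 𝒫.∙ φ G)
  φ-∙ F G d@(k , k∣m) = φ-unique (F 𝒯.∙ G) d (λ i → σ F d (σ G d i)) (λ i → γ F d (σ G d i) ℕ.+ γ G d i) λ i → begin
    proj₁ F (proj₁ G (rep k∣m i))                                        ≡⟨ cong (proj₁ F) (image G d i) ⟩
    proj₁ F (Fr (γ G d i) (rep k∣m (σ G d i)))                           ≡⟨ commutes F (γ G d i) _ ⟩
    Fr (γ G d i) (proj₁ F (rep k∣m (σ G d i)))                           ≡⟨ cong (Fr (γ G d i)) (image F d (σ G d i)) ⟩
    Fr (γ G d i) (Fr (γ F d (σ G d i)) (rep k∣m (σ F d (σ G d i))))      ≡⟨ Fr-comm (γ G d i) (γ F d (σ G d i)) _ ⟩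
    Fr (γ F d (σ G d i)) (Fr (γ G d i) (rep k∣m (σ F d (σ G d i))))      ≡⟨ Fr-∘ (γ F d (σ G d i)) (γ G d i) _ ⟨
    Fr (γ F d (σ G d i) ℕ.+ γ G d i) (rep k∣m (σ F d (σ G d i)))         ∎

  φ-ε : φ 𝒯.ε 𝒫.≈ 𝒫.ε
  φ-ε d = φ-unique 𝒯.ε d id (λ _ → 0) (λ _ → refl)

  Coordinates : Carrier → Set
  Coordinates x = Σ[ (k , k∣m) ∈ Divisor ] ∃₂ λ i j → IsPeriod k x × x ≡ Fr j (rep k∣m i)

  coordinates : ∀ x → Coordinates x
  coordinates x = let k , _ , k∣m , P = period x ; i , j , eq = locate k∣m P in (k , k∣m) , i , j , P , eq

  φ-injective : ∀ {F G} → φ F 𝒫.≈ φ G → F 𝒯.≈ G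
  φ-injective {F} {G} φF≈φG x = begin
    proj₁ F x                               ≡⟨ cong (proj₁ F) x≡ ⟩
    proj₁ F (Fr j (rep k∣m i))              ≡⟨ commutes F j _ ⟩
    Fr j (proj₁ F (rep k∣m i))              ≡⟨ cong (Fr j) (image F d i) ⟩
    Fr j (Fr (γ F d i) (rep k∣m (σ F d i))) ≡⟨ cong (λ s → Fr j (Fr (γ F d i) (rep k∣m s))) (proj₁ (φF≈φG d) i) ⟩
    Fr j (Fr (γ F d i) (rep k∣m (σ G d i))) ≡⟨ cong (Fr j) (Fr-≈⇒≡ (fixed (rep-period k∣m _)) (γ F d i) (γ G d i) (proj₂ (φF≈φG d) i)) ⟩
    Fr j (Fr (γ G d i) (rep k∣m (σ G d i))) ≡⟨ cong (Fr j) (image G d i) ⟨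
    Fr j (proj₁ G (rep k∣m i))              ≡⟨ commutes G j _ ⟨
    proj₁ G (Fr j (rep k∣m i))              ≡⟨ cong (proj₁ G) x≡ ⟨
    proj₁ G x                               ∎
    where
    d = proj₁ (coordinates x)
    k∣m = proj₂ d
    i = proj₁ (proj₂ (coordinates x))
    j = proj₁ (proj₂ (proj₂ (coordinates x)))
    x≡ = proj₂ (proj₂ (proj₂ (proj₂ (coordinates x))))

  module _ (t : 𝒫.Carrier) where
    -- Elements of `C k` are integers while `Fr` iterates along naturals, so the least nonnegative
    -- residue is taken.
    exponent : ∀ d → Fin (π (proj₁ d)) → ℕ
    exponent d@(k , k∣m) i = _%ℕ_ (proj₂ (t d) i) k {{ℕ.>-nonZero (1≤divisor k∣m)}}

    exponent-≈ : ∀ d i → (+ exponent d i) ≈ proj₂ (t d) i mod proj₁ d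
    exponent-≈ d@(k , k∣m) i = AbelianGroup.sym (C k) (congruent (divides (z /ℕ k) (begin
      z ℤ.- + (z %ℕ k)                                          ≡⟨ cong (ℤ._- + (z %ℕ k)) (a≡a%ℕn+[a/ℕn]*n z k) ⟩
      (+ (z %ℕ k) ℤ.+ (z /ℕ k) ℤ.* + k) ℤ.- + (z %ℕ k)          ≡⟨ cong (ℤ._- + (z %ℕ k)) (ℤₚ.+-comm (+ (z %ℕ k)) ((z /ℕ k) ℤ.* + k)) ⟩
      ((z /ℕ k) ℤ.* + k ℤ.+ + (z %ℕ k)) ℤ.- + (z %ℕ k)          ≡⟨ ℤₚ.+-assoc ((z /ℕ k) ℤ.* + k) (+ (z %ℕ k)) _ ⟩
      (z /ℕ k) ℤ.* + k ℤ.+ (+ (z %ℕ k) ℤ.- + (z %ℕ k))          ≡⟨ cong (λ y → (z /ℕ k) ℤ.* + k ℤ.+ y) (ℤₚ.+-inverseʳ (+ (z %ℕ k))) ⟩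
      (z /ℕ k) ℤ.* + k ℤ.+ + 0                                  ≡⟨ ℤₚ.+-identityʳ _ ⟩
      (z /ℕ k) ℤ.* + k                                          ∎)))
      where
      z = proj₂ (t d) i
      instance
        k≢0 : NonZero k
        k≢0 = ℕ.>-nonZero (1≤divisor k∣m)

    target : ∀ d → Fin (π (proj₁ d)) → Carrier
    target d i = Fr (exponent d i) (rep (proj₂ d) (proj₁ (t d) i))

    target-period : ∀ d i → IsPeriod (proj₁ d) (target d i)
    target-period d i = period-Fr (exponent d i) (rep-period (proj₂ d) _)

    extend : ∀ {x} → Coordinates x → Carrier
    extend (d , i , j , _) = Fr j (target d i)

    f : Carrier → Carrier
    f x = extend (coordinates x)

    -- The value does not depend on the coordinates: x determines its period, then i, and j modulo
    -- k, and the target has period k too. The coordinates `c` are a variable so that their divisor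
    -- can be unified with d.
    extend-spec : ∀ {x} (c : Coordinates x) (d : Divisor) i j → x ≡ Fr j (rep (proj₂ d) i) →
                  extend c ≡ Fr j (target d i)
    extend-spec ((k′ , k′∣m) , i′ , j′ , P , eq′) d i j eq
      with refl ← divisor-≡ {d = k′∣m} {proj₂ d} (period-unique P
             (subst (IsPeriod (proj₁ d)) (sym eq) (period-Fr j (rep-period (proj₂ d) i))))
      with refl , j′≈j ← rep-unique (proj₂ d) {i′} {i} {j′} {j} (trans (sym eq′) eq)
      = Fr-≈⇒≡ (fixed (target-period d i)) j′ j j′≈j

    f-spec : ∀ {x} (d : Divisor) i j → x ≡ Fr j (rep (proj₂ d) i) → f x ≡ Fr j (target d i)
    f-spec {x} = extend-spec (coordinates x)

    -- Applying the Frobenius raises the coordinate j of x by one and leaves the others unchanged.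
    f-commutes : ∀ x → f (Fr 1 x) ≡ Fr 1 (f x)
    f-commutes x = let d , i , j , _ , eq = coordinates x in f-spec d i (suc j) (cong (Fr 1) eq)

    f-period : ∀ {k x} → IsPeriod k x → IsPeriod k (f x)
    f-period {k} {x} P = let d , i , j , Q , _ = coordinates x in
      subst (λ k → IsPeriod k (f x)) (period-unique Q P) (period-Fr j (target-period d i))

    preimage : 𝒯.Carrier
    preimage = f , commuting-preserving⇒T f f-commutes f-period

    φ-preimage : φ preimage 𝒫.≈ t
    φ-preimage d = let σ≗ , γ≈ = φ-unique preimage d (proj₁ (t d)) (exponent d) (λ i → f-spec d i 0 refl) in
      σ≗ , λ i → G.trans (proj₁ d) (γ≈ i) (exponent-≈ d i)

  isomorphism : 𝒯 q m K L ι ≅ 𝒫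
  isomorphism = φ , record
    { isMonoidMonomorphism = record
      { isMonoidHomomorphism = record
        { isMagmaHomomorphism = record
          { isRelHomomorphism = record { cong = λ {F} {G} → φ-cong {F} {G} }
          ; homo = φ-∙
          }
        ; ε-homo = φ-ε
        }
      ; injective = λ {F} {G} → φ-injective {F} {G}
      }
    ; surjective = λ y → preimage y , λ {F} F≈ →
        𝒫.trans {φ F} {φ (preimage y)} {y} (φ-cong {F} {preimage y} F≈) (φ-preimage y)
    }

theorem13 : ∀ (q m : ℕ) → IsPrimePower q → 1 ≤ m →
    (K : FiniteField q) (L : FiniteField (q ^ m)) (ι : K ↪ L) →
    (π : ℕ → ℕ) → (∀ k → MonicIrreducibleCount K k (π k)) →
    𝒯 q m K L ι ≅ Π (∃ λ k → k ∣ m) (λ (k , _) → M[ π k ] ⋉ C[ k ]^ π k by Γ k (π k))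
theorem13 q m _ 1≤m K L ι π count = Isomorphism.isomorphism 1≤m K L ι π count
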